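{- Let $m$ be a fixed positive integer, $p\in(0,1)$, $q=1-p$ and $\rho=p/q$. The asymptotic probability (as $n\to\infty$ with $p$ fixed) that a random graph $g$ in the Erdős–Rényi model $G(n,p)$ has $m$ connected components satisfies $$\mathbb P(g\text{ has }m\text{ connected components})\approx\sum_{k\ge0}P_{k,m}(\rho)\cdot\binom nk\cdot\frac{q^{nk}}{q^{k(k+1)/2}},$$ where $$P_{k,m}(\rho)=\sum_{g'\in\mathcal G_k}(-1)^{\pi_0(g')-(m-1)}\binom{\pi_0(g')}{m-1}w(g')$$ and $\pi_0(g')$ is the number of connected components of the graph $g'$.
   Context: $G(n,p)$ is the random labeled simple graph with vertex set $[n]=\{1,\dots,n\}$ in which each pair of distinct vertices is joined by an edge independently with probability $p$. $\mathcal G_k$ is the set of all labeled simple graphs with vertex set $[k]$ (for $k=0$ there is exactly one, the empty graph, with $\pi_0=0$). The weight of a graph $g'$ is $w(g')=\rho^{|E(g')|}$, where $|E(g')|$ is its number of edges. Notation $\approx$: $p_n\approx\sum_{k\ge0}c_kg_k(n)$ (here $g_k(n)=\binom nk q^{nk-k(k+1)/2}$) means that $g_{k+1}(n)=o(g_k(n))$ for every $k$ and, for every integer $r\ge0$, $p_n=\sum_{k=0}^rc_kg_k(n)+O(g_{r+1}(n))$ as $n\to\infty$. -}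

module Defs where

open import Algebra.Apartness.Bundles using (HeytingField)
open import Algebra.Bundles using (CommutativeRing; Semiring)
import Algebra.Definitions.RawSemiring as RawSemiringOps
open import Data.Empty using (⊥)
open import Data.Fin.Base using (Fin; zero; suc)
open import Data.Fin.Properties using (any?)
open import Data.Fin.Subset using (Subset; Side; inside; outside; _∈_; ∣_∣)
open import Data.Fin.Subset.Properties using (_∈?_)
open import Data.List.Base
  using (List; []; _∷_; foldr; filter; length; upTo; allFin; deduplicate; cartesianProductWith)
open import Data.Nat.Base as ℕ using (ℕ; zero; suc; pred; _∸_)
open import Data.Nat.Combinatorics using (_C_)
open import Data.Product.Base using (_×_; _,_; proj₁; proj₂; ∃-syntax)
open import Data.Sum.Base using (_⊎_; inj₁; inj₂)
open import Data.Unit.Base using (⊤; tt)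
import Data.Vec.Base as Vec
open import Function.Bundles using (_⇔_; Equivalence)
open import Level using (0ℓ; _⊔_) renaming (suc to lsuc)
open import Relation.Binary.Construct.Closure.ReflexiveTransitive as Star using (Star; ε; _◅_; _◅◅_)
open import Relation.Binary.Core using (Rel)
import Relation.Binary.Definitions as B
open import Relation.Binary.Lattice.Definitions using (Supremum)
open import Relation.Binary.Structures using (IsStrictPartialOrder)
open import Relation.Nullary.Decidable using (yes; map′; _×-dec_; _⊎-dec_)
open import Relation.Nullary.Negation using (¬_)
open import Relation.Unary using (Pred; Decidable)

-- The standard library has no type of real numbers, so ℝ is characterised
-- axiomatically as a Cauchy-complete Archimedean ordered field.
-- Classically these axioms determine ℝ up to unique isomorphism.  The
-- axioms are phrased constructively (order and apartness are primitive,
-- decidability of neither is assumed).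

record RealNumbers c ℓ₁ ℓ₂ : Set (lsuc (c ⊔ ℓ₁ ⊔ ℓ₂)) where
  field
    heytingField : HeytingField c ℓ₁ ℓ₂

  open HeytingField heytingField public

  commutativeRing : CommutativeRing c ℓ₁
  commutativeRing = record { isCommutativeRing = isCommutativeRing }

  open RawSemiringOps (Semiring.rawSemiring (CommutativeRing.semiring commutativeRing)) public
    using (_^_) renaming (_×_ to infixr 8 _·_)   -- n · x = x + ⋯ + x

  infix  4 _<_ _≤_
  infixr 6 _∨_
  field
    _<_ : Rel Carrier ℓ₂
    _∨_ : Carrier → Carrier → Carrier

  _≤_ : Rel Carrier ℓ₂
  x ≤ y = ¬ (y < x)

  abs : Carrier → Carrier
  abs x = x ∨ (- x)

  _⟶_ : (ℕ → Carrier) → Carrier → Set (c ⊔ ℓ₂)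
  u ⟶ l = ∀ e → 0# < e → ∃[ N ] ∀ n → N ℕ.≤ n → abs (u n - l) ≤ e

  Cauchy : (ℕ → Carrier) → Set (c ⊔ ℓ₂)
  Cauchy u = ∀ e → 0# < e →
    ∃[ N ] ∀ i j → N ℕ.≤ i → N ℕ.≤ j → abs (u i - u j) ≤ e

  field
    <-isStrictPartialOrder : IsStrictPartialOrder _≈_ _<_
    #⇔<         : ∀ {x y} → (x # y) ⇔ (x < y ⊎ y < x)
    +-monoˡ-<   : ∀ {x y} z → x < y → x + z < y + z
    *-positive  : ∀ {x y} → 0# < x → 0# < y → 0# < x * y
    ∨-supremum  : Supremum _≤_ _∨_
    archimedean : ∀ x → ∃[ n ] x < n · 1#
    complete    : ∀ u → Cauchy u → ∃[ l ] (u ⟶ l)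

  -- 1 / (y - x)
  recipDiff : ∀ {x y} → x < y → Carrier
  recipDiff x<y = proj₁ (#⇒invertible (Equivalence.from #⇔< (inj₂ x<y)))

  ∑ : ∀ {a} {A : Set a} → List A → (A → Carrier) → Carrier
  ∑ xs f = foldr (λ x s → f x + s) 0# xs

-- A simple graph is stored as the strict triangular half of its adjacency
-- matrix: in N ∷ g, vertex zero has neighbourhood N among the remaining
-- vertices, and g is the graph induced on those.  Every labelled simple
-- graph is represented exactly once.

data Graph : ℕ → Set where
  []  : Graph zero
  _∷_ : ∀ {n} → Subset n → Graph n → Graph (suc n)

private
  variable
    n : ℕ

Adj : Graph n → Rel (Fin n) 0ℓ
Adj (N ∷ g) zero    zero    = ⊥
Adj (N ∷ g) zero    (suc j) = j ∈ N
Adj (N ∷ g) (suc i) zero    = i ∈ N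
Adj (N ∷ g) (suc i) (suc j) = Adj g i j

edgeCount : Graph n → ℕ
edgeCount []      = 0
edgeCount (N ∷ g) = ∣ N ∣ ℕ.+ edgeCount g

subsets : ∀ n → List (Subset n)
subsets zero    = Vec.[] ∷ []
subsets (suc n) = cartesianProductWith Vec._∷_ (outside ∷ inside ∷ []) (subsets n)

graphs : ∀ n → List (Graph n)
graphs zero    = [] ∷ []
graphs (suc n) = cartesianProductWith _∷_ (subsets n) (graphs n)

Connected : Graph n → Rel (Fin n) 0ℓ
Connected g = Star (Adj g)

Adj-sym : (g : Graph n) → B.Symmetric (Adj g)
Adj-sym (N ∷ g) {zero}  {suc j} e = e
Adj-sym (N ∷ g) {suc i} {zero}  e = e
Adj-sym (N ∷ g) {suc i} {suc j} e = Adj-sym g e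

-- Paths in N ∷ g described by paths in g: vertices i and j ≠ zero are
-- joined either within g or through vertex zero.
module Paths {n : ℕ} (N : Subset n) (g : Graph n) where

  Touches : Pred (Fin n) 0ℓ
  Touches i = ∃[ k ] (k ∈ N × Connected g k i)

  Via : Rel (Fin (suc n)) 0ℓ
  Via zero    zero    = ⊤
  Via zero    (suc j) = Touches j
  Via (suc i) zero    = Touches i
  Via (suc i) (suc j) = Connected g i j ⊎ (Touches i × Touches j)

  touches-adj : ∀ {i j} → Adj g i j → Touches j → Touches i
  touches-adj e (k , k∈N , p) = k , k∈N , p ◅◅ Adj-sym g e ◅ ε

  step : ∀ {i j k} → Adj (N ∷ g) i j → Via j k → Via i k
  step {zero}  {suc j} {zero}  e v              = tt
  step {zero}  {suc j} {suc k} e (inj₁ p)       = j , e , p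
  step {zero}  {suc j} {suc k} e (inj₂ (_ , t)) = t
  step {suc i} {zero}  {zero}  e v              = i , e , ε
  step {suc i} {zero}  {suc k} e t              = inj₂ ((i , e , ε) , t)
  step {suc i} {suc j} {zero}  e t              = touches-adj e t
  step {suc i} {suc j} {suc k} e (inj₁ p)       = inj₁ (e ◅ p)
  step {suc i} {suc j} {suc k} e (inj₂ (s , t)) = inj₂ (touches-adj e s , t)

  via-refl : ∀ i → Via i i
  via-refl zero    = tt
  via-refl (suc i) = inj₁ ε

  to-via : ∀ {i j} → Connected (N ∷ g) i j → Via i j
  to-via ε       = via-refl _
  to-via (e ◅ p) = step e (to-via p)

  from-zero : ∀ {j} → Touches j → Connected (N ∷ g) zero (suc j)
  from-zero (k , k∈N , p) = k∈N ◅ Star.gmap suc (λ e → e) p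

  to-zero : ∀ {i} → Touches i → Connected (N ∷ g) (suc i) zero
  to-zero t = Star.reverse (λ {i} {j} → Adj-sym (N ∷ g) {i} {j}) (from-zero t)

  from-via : ∀ i j → Via i j → Connected (N ∷ g) i j
  from-via zero    zero    _              = ε
  from-via zero    (suc j) t              = from-zero t
  from-via (suc i) zero    t              = to-zero t
  from-via (suc i) (suc j) (inj₁ p)       = Star.gmap suc (λ e → e) p
  from-via (suc i) (suc j) (inj₂ (s , t)) = to-zero s ◅◅ from-zero t

connected? : (g : Graph n) → B.Decidable (Connected g)
connected? (N ∷ g) i j = map′ (from-via i j) to-via (via? i j)
  where
  open Paths N g

  touches? : Decidable Touches
  touches? i = any? (λ k → (k ∈? N) ×-dec connected? g k i)

  via? : B.Decidable Via
  via? zero    zero    = yes tt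
  via? zero    (suc j) = touches? j
  via? (suc i) zero    = touches? i
  via? (suc i) (suc j) = connected? g i j ⊎-dec (touches? i ×-dec touches? j)

-- deduplicate keeps one vertex from each class of the relation Connected g.
π₀ : Graph n → ℕ
π₀ {n} g = length (deduplicate (connected? g) (allFin n))

module _ {c ℓ₁ ℓ₂} (ℝ : RealNumbers c ℓ₁ ℓ₂) where
  open RealNumbers ℝ

  -- Probability of a single graph in G(n,p): every pair of vertices
  -- contributes a factor p if it is an edge and 1 - p if it is not.
  mass : Carrier → Graph n → Carrier
  mass p []      = 1#
  mass p (N ∷ g) = Vec.foldr′ (λ s x → factor s * x) 1# N * mass p g
    where
    factor : Side → Carrier
    factor inside  = p
    factor outside = 1# - p

  ℙ : ∀ {ℓ} {A : Pred (Graph n) ℓ} → Carrier → Decidable A → Carrier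
  ℙ {n} p A? = ∑ (filter A? (graphs n)) (mass p)

  weight : Carrier → Graph n → Carrier
  weight ρ g = ρ ^ edgeCount g

  -- The binomial coefficient vanishes when π₀ g < m - 1, so truncated
  -- subtraction in the exponent of - 1 is harmless.
  P : (k m : ℕ) .{{_ : ℕ.NonZero m}} → Carrier → Carrier
  P k m ρ = ∑ (graphs k) λ g →
    (- 1#) ^ (π₀ g ∸ pred m) * (π₀ g C pred m) · weight ρ g

  BigO : (f g : ℕ → Carrier) → Set (c ⊔ ℓ₂)
  BigO f g = ∃[ K ] ∃[ N ] ∀ n → N ℕ.≤ n → abs (f n) ≤ K * abs (g n)

  LittleO : (f g : ℕ → Carrier) → Set (c ⊔ ℓ₂)
  LittleO f g = ∀ e → 0# < e → ∃[ N ] ∀ n → N ℕ.≤ n → abs (f n) ≤ e * abs (g n)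

  -- a(n) ≈ ∑ₖ coeff(k) · scale(k, n)
  AsymptoticExpansion : (a : ℕ → Carrier) (coeff : ℕ → Carrier) (scale : ℕ → ℕ → Carrier) → Set (c ⊔ ℓ₂)
  AsymptoticExpansion a coeff scale =
      (∀ k → LittleO (scale (suc k)) (scale k))
    × (∀ r → BigO (λ n → a n - ∑ (upTo (suc r)) (λ k → coeff k * scale k n)) (scale (suc r)))

{-# OPTIONS --safe #-}

-- For a natural number y, E n y = 𝔼 (y ^ π₀) over G(n,p) is the expected number of
-- y-colourings of the vertices that are constant along edges, that is, the sum over
-- all colourings of q ^ (number of bichromatic pairs).  Splitting off the colour class
-- of the first vertex gives, first for natural x and hence between polynomials in x,
--   E (n + 1) x = x · Σₖ C(n,k) q ^ (k (n + 1 - k)) E k (x - 1).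
-- Fix m and let a t n be the coefficient of x ^ m in x (x - 1) ⋯ (x - t + 1) E n (x - t).
-- Then a 0 n is the probability of m components, a 1 k is q ^ (k (k - 1) / 2) P k m, and
--   a t (n + 1) = Σₖ C(n,k) q ^ (k (n + 1 - k)) a (t + 1) k.
-- In this sum the terms with k far from 0 and n are negligible, those with small k are
-- explicit, and into those with k near n one inserts the expansion of a (t + 1) k to a
-- lower order.  So induction on the order r, for all t at once, proves
--   a t n = Σ_{k < r} C(n,k) q ^ (k (n - k)) a (t + 1) k + O(poly(n) q ^ (r n)).

module Submission where

open import Defs
open import Algebra.Bundles using (CommutativeRing)
open import Data.Empty using (⊥-elim)
open import Data.Fin.Base using (Fin; zero; suc; punchIn)
open import Data.Fin.Properties as Fin using (all?; any?; punchInᵢ≢i; punchIn-injective)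
open import Data.Fin.Subset using (Subset; Side; inside; outside; _∈_; ∣_∣)
open import Data.Fin.Subset.Properties using (_∈?_)
open import Data.List.Base using (List; []; _∷_; _++_; map; filter; tabulate; applyUpTo; upTo; allFin; cartesianProductWith; length; deduplicate)
open import Data.List.Properties using (filter-all; filter-reject; length-map; map-tabulate)
open import Data.List.Relation.Unary.All as All using (All; []; _∷_)
import Data.List.Relation.Unary.All.Properties as All
open import Data.List.Relation.Unary.AllPairs.Core using (AllPairs; []; _∷_)
open import Data.List.Relation.Unary.Any as Any using (Any; here; there)
import Data.List.Relation.Unary.Any.Properties as Any
open import Data.List.Relation.Unary.Unique.DecSetoid.Properties using (deduplicate-!)
open import Data.Nat.Base as ℕ using (ℕ; zero; suc; z≤n; s≤s; _∸_; _!; ⌊_/2⌋; _/_)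
open import Data.Nat.Combinatorics using (_C_; nCk+nC[k+1]≡[n+1]C[k+1]; nCn≡1; nCk≡nC[n∸k]; k>n⇒nCk≡0)
open import Data.Nat.DivMod using (m*n/n≡m)
open import Data.Nat.Properties as ℕₚ using (_≟_)
open import Data.Nat.Solver using (module +-*-Solver)
open import Data.Product.Base using (_×_; _,_; proj₁; proj₂; ∃-syntax)
open import Data.Sum.Base using (_⊎_; inj₁; inj₂)
open import Data.Vec.Base using (Vec; []; _∷_; lookup; foldr′; here; there)
open import Data.Vec.Functional using (removeAt)
open import Function.Base using (flip; id; _∘_; _on_)
open import Function.Bundles using (Equivalence)
open import Level using (Level; 0ℓ)
open import Relation.Binary.Construct.Closure.ReflexiveTransitive as Star using (ε; _◅_; _◅◅_)
open import Relation.Binary.Core using (Rel)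
import Relation.Binary.Definitions as B
open import Relation.Binary.PropositionalEquality as ≡ using (_≡_; _≢_)
open import Relation.Binary.Structures using (IsStrictPartialOrder; IsEquivalence)
open import Relation.Nullary.Decidable using (Dec; yes; no; map′; ¬?; _→-dec_)
open import Relation.Nullary.Negation using (¬_; contradiction)
open import Relation.Unary using (Pred; Decidable)

-- The recursion lowers `x` by one, so the coefficients of `x ^ m` alone do not satisfy a closed
-- relation. Keeping the factors `x (x - 1) ⋯` and lowering only the argument of `E` repairs this:
-- each use raises `t` by one, which is why a whole family must be treated together. No equations
-- for the coefficients are solved. When truncations with coefficients `a (t + 2)` replace
-- `a (t + 1) k` for `k` near `n`, the double sum regroups into the recursion itself and returns
-- values of `a (t + 1)`. In the step to order `r + 1`, a class of `j + 1` vertices already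
-- contributes about `q ^ ((j + 1) n)`, so it needs the next sequence only to order `r - j`. The
-- estimates need `a t n` to be bounded in `n`, although it is an alternating sum. Multiplication by
-- `x - t` enlarges a bound on coefficients by at most `t + 1`, which reduces this to bounding
-- `E n (t + 1)`. Polynomial factors in the errors are tolerated throughout and removed once, at the
-- end, by going one order further.

-- Arithmetic, order and absolute value without a decidable order.

module OrderedField {c ℓ₁ ℓ₂} (ℝ : RealNumbers c ℓ₁ ℓ₂) where
  open RealNumbers ℝ public hiding (zero)
  open CommutativeRing (RealNumbers.commutativeRing ℝ) public
    using (ring; semiring; commutativeSemiring; +-group)
  open import Algebra.Properties.Ring ring public
    using (-0#≈0#; -‿distribˡ-*; -‿distribʳ-*; -‿involutive; -‿+-comm; -1*x≈-x)
  open import Algebra.Properties.Group +-group public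
    using (x∙y⁻¹≈ε⇒x≈y)
  open import Algebra.Properties.Semiring.Mult semiring public
    using (×-congʳ; ×-homo-+; ×1-homo-*; ×-assoc-*)
  open import Algebra.Properties.Semiring.Exp semiring public
    using (^-congˡ; ^-homo-*; ^-assocʳ)
  open import Algebra.Properties.CommutativeSemiring.Exp commutativeSemiring public
    using (^-distrib-*)
  open import Algebra.Solver.Ring.NaturalCoefficients.Default commutativeSemiring public
    using (solve; _:=_; _:+_; _:*_; con)
  open import Relation.Binary.Reasoning.Setoid setoid public

  private
    module O = IsStrictPartialOrder <-isStrictPartialOrder

  private
    variable
      x y z w : Carrier

  <-respʳ : x ≈ y → z < x → z < y
  <-respʳ = O.<-respʳ-≈

  <-respˡ : x ≈ y → x < z → y < z
  <-respˡ = O.<-respˡ-≈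

  <-trans : x < y → y < z → x < z
  <-trans = O.trans

  <-irrefl : ¬ (x < x)
  <-irrefl = O.irrefl refl

  x+[-x+y]≈y : ∀ x y → x + (- x + y) ≈ y
  x+[-x+y]≈y x y = trans (sym (+-assoc x (- x) y)) (trans (+-congʳ (-‿inverseʳ x)) (+-identityˡ y))

  x+y-x≈y : ∀ x y → x + y - x ≈ y
  x+y-x≈y x y = trans (+-assoc x y (- x)) (trans (+-congˡ (+-comm y (- x))) (x+[-x+y]≈y x y))

  x-y+y≈x : ∀ x y → x - y + y ≈ x
  x-y+y≈x x y = trans (+-assoc x (- y) y) (trans (+-congˡ (-‿inverseˡ y)) (+-identityʳ x))

  x≈y+z⇒x-y≈z : x ≈ y + z → x - y ≈ z
  x≈y+z⇒x-y≈z {y = y} {z} eq = trans (+-congʳ eq) (x+y-x≈y y z)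

  x-0≈x : ∀ x → x - 0# ≈ x
  x-0≈x x = trans (+-congˡ -0#≈0#) (+-identityʳ x)

  -- Stands in for trichotomy. It comes from cotransitivity of apartness; where apartness yields the
  -- wrong sign, transitivity with `x < y` gives the other alternative.
  <-cotrans : x < y → ∀ z → x < z ⊎ z < y
  <-cotrans {x} {y} x<y z with #-cotrans (Equivalence.from #⇔< (inj₁ x<y)) z
  ... | inj₁ x#z with Equivalence.to #⇔< x#z
  ...   | inj₁ x<z = inj₁ x<z
  ...   | inj₂ z<x = inj₂ (<-trans z<x x<y)
  <-cotrans x<y z | inj₂ z#y with Equivalence.to #⇔< z#y
  ...   | inj₁ z<y = inj₂ z<y
  ...   | inj₂ y<z = inj₁ (<-trans x<y y<z)

  ≤-refl : x ≤ x
  ≤-refl = <-irrefl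

  ≤-reflexive : x ≈ y → x ≤ y
  ≤-reflexive x≈y y<x = <-irrefl (<-respʳ x≈y y<x)

  ≤-trans : x ≤ y → y ≤ z → x ≤ z
  ≤-trans {y = y} x≤y y≤z z<x with <-cotrans z<x y
  ... | inj₁ z<y = y≤z z<y
  ... | inj₂ y<x = x≤y y<x

  <⇒≤ : x < y → x ≤ y
  <⇒≤ x<y y<x = <-irrefl (<-trans x<y y<x)

  <-≤-trans : x < y → y ≤ z → x < z
  <-≤-trans {z = z} x<y y≤z with <-cotrans x<y z
  ... | inj₁ x<z = x<z
  ... | inj₂ z<y = ⊥-elim (y≤z z<y)

  ≤-respʳ : x ≈ y → z ≤ x → z ≤ y
  ≤-respʳ x≈y z≤x = ≤-trans z≤x (≤-reflexive x≈y)

  ≤-respˡ : x ≈ y → x ≤ z → y ≤ z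
  ≤-respˡ x≈y x≤z = ≤-trans (≤-reflexive (sym x≈y)) x≤z

  +-monoˡ-≤ : ∀ z → x ≤ y → x + z ≤ y + z
  +-monoˡ-≤ {x} {y} z x≤y lt = x≤y (<-respˡ (cancel y) (<-respʳ (cancel x) (+-monoˡ-< (- z) lt)))
    where
    cancel : ∀ x → x + z - z ≈ x
    cancel x = trans (+-assoc x z (- z)) (trans (+-congˡ (-‿inverseʳ z)) (+-identityʳ x))

  +-mono-≤ : x ≤ y → z ≤ w → x + z ≤ y + w
  +-mono-≤ {x} {y} {z} {w} x≤y z≤w = ≤-trans (+-monoˡ-≤ z x≤y)
    (≤-respˡ (+-comm z y) (≤-respʳ (+-comm w y) (+-monoˡ-≤ y z≤w)))

  0≤+ : 0# ≤ x → 0# ≤ y → 0# ≤ x + y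
  0≤+ 0≤x 0≤y = ≤-respˡ (+-identityˡ 0#) (+-mono-≤ 0≤x 0≤y)

  neg-anti-≤ : x ≤ y → - y ≤ - x
  neg-anti-≤ {x} {y} x≤y = ≤-respˡ (x+[-x+y]≈y x (- y))
    (≤-respʳ (trans (+-congˡ (+-comm (- x) (- y))) (x+[-x+y]≈y y (- x))) (+-monoˡ-≤ (- x - y) x≤y))

  x<y⇒0<y-x : x < y → 0# < y - x
  x<y⇒0<y-x {x} x<y = <-respˡ (-‿inverseʳ x) (+-monoˡ-< (- x) x<y)

  x≤y⇒0≤y-x : x ≤ y → 0# ≤ y - x
  x≤y⇒0≤y-x {x} x≤y = ≤-respˡ (-‿inverseʳ x) (+-monoˡ-≤ (- x) x≤y)

  0≤y-x⇒x≤y : 0# ≤ y - x → x ≤ y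
  0≤y-x⇒x≤y {y} {x} le = ≤-respˡ (+-identityˡ x) (≤-respʳ (x-y+y≈x y x) (+-monoˡ-≤ x le))

  private
    factor#0 : ∀ {x y} → (x * y) # 0# → x # 0#
    factor#0 {x} {y} xy#0 with #⇒invertible xy#0
    ... | i , i*xy≈1 , xy*i≈1 = invertible⇒# (y * i , left , right)
      where
      right : (x - 0#) * (y * i) ≈ 1#
      right = trans (*-congʳ (x-0≈x x)) (trans (sym (*-assoc x y i)) (trans (*-congʳ (sym (x-0≈x _))) xy*i≈1))
      left : (y * i) * (x - 0#) ≈ 1#
      left = trans (*-comm _ _) right

    neg-cancel : ∀ {x y} → x * - y ≈ - (x * y)
    neg-cancel = sym (-‿distribʳ-* _ _)

  -- `≤` is a negation, so `x * y < 0#` may be assumed. Then `x * y` is invertible, hence so are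
  -- both factors, and apartness from `0#` decides their signs.
  0≤* : 0# ≤ x → 0# ≤ y → 0# ≤ x * y
  0≤* {x} {y} 0≤x 0≤y xy<0 with Equivalence.to #⇔< (factor#0 xy#0) | Equivalence.to #⇔< (factor#0 yx#0)
    where
    xy#0 = Equivalence.from #⇔< (inj₁ xy<0)
    yx#0 = Equivalence.from #⇔< (inj₁ (<-respˡ (*-comm x y) xy<0))
  ... | inj₁ x<0 | _        = 0≤x x<0
  ... | inj₂ _   | inj₁ y<0 = 0≤y y<0
  ... | inj₂ 0<x | inj₂ 0<y = <-irrefl (<-trans (*-positive 0<x 0<y) xy<0)

  *-monoˡ-≤ : 0# ≤ z → x ≤ y → z * x ≤ z * y
  *-monoˡ-≤ {z} {x} {y} 0≤z x≤y = 0≤y-x⇒x≤y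
    (≤-respʳ (trans (distribˡ z y (- x)) (+-congˡ neg-cancel)) (0≤* 0≤z (x≤y⇒0≤y-x x≤y)))

  *-monoʳ-≤ : 0# ≤ z → x ≤ y → x * z ≤ y * z
  *-monoʳ-≤ 0≤z x≤y = ≤-respˡ (*-comm _ _) (≤-respʳ (*-comm _ _) (*-monoˡ-≤ 0≤z x≤y))

  *-mono-≤ : 0# ≤ z → 0# ≤ y → x ≤ y → z ≤ w → x * z ≤ y * w
  *-mono-≤ 0≤z 0≤y x≤y z≤w = ≤-trans (*-monoʳ-≤ 0≤z x≤y) (*-monoˡ-≤ 0≤y z≤w)

  -- `1#` is apart from `0#` because it is invertible; if it were negative, `- 1#` and hence its
  -- square `1#` would be positive.
  0<1 : 0# < 1#
  0<1 with Equivalence.to #⇔< (invertible⇒# {1#} {0#} (1# , eq , trans (*-comm _ _) eq))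
    where
    eq : 1# * (1# - 0#) ≈ 1#
    eq = trans (*-identityˡ _) (x-0≈x 1#)
  ... | inj₂ 0<1 = 0<1
  ... | inj₁ 1<0 = ⊥-elim (<-irrefl (<-trans 1<0 (<-respʳ eq (*-positive 0<-1 0<-1))))
    where
    0<-1 : 0# < - 1#
    0<-1 = <-respʳ (+-identityˡ (- 1#)) (x<y⇒0<y-x 1<0)
    eq : - 1# * - 1# ≈ 1#
    eq = trans (-1*x≈-x (- 1#)) (-‿involutive 1#)

  0≤1 : 0# ≤ 1#
  0≤1 = <⇒≤ 0<1

  *-cancelˡ-≤ : 0# < z → z * x ≤ z * y → x ≤ y
  *-cancelˡ-≤ {z} {x} {y} 0<z le y<x =
    le (<-respˡ (+-identityˡ (z * y)) (<-respʳ eq (+-monoˡ-< (z * y) (*-positive 0<z (x<y⇒0<y-x y<x)))))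
    where
    eq : z * (x - y) + z * y ≈ z * x
    eq = trans (sym (distribˡ z (x - y) y)) (*-congˡ (x-y+y≈x x y))

  reciprocal : 0# < x → ∃[ i ] (0# < i × x * i ≈ 1#)
  reciprocal {x} 0<x with #⇒invertible (Equivalence.from #⇔< (inj₂ 0<x))
  ... | i , _ , xi≈1′ = i , positive , xi≈1
    where
    xi≈1 : x * i ≈ 1#
    xi≈1 = trans (*-congʳ (sym (x-0≈x x))) xi≈1′
    ix#0 : (i * x) # 0#
    ix#0 = Equivalence.from #⇔< (inj₂ (<-respʳ (sym (trans (*-comm i x) xi≈1)) 0<1))
    positive : 0# < i
    positive with Equivalence.to #⇔< (factor#0 ix#0)
    ... | inj₂ 0<i = 0<i
    ... | inj₁ i<0 = ⊥-elim (≤-trans (≤-respˡ xi≈1 (*-monoˡ-≤ (<⇒≤ 0<x) (<⇒≤ i<0)))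
                                     (≤-reflexive (zeroʳ x)) 0<1)

  0≤^ : ∀ n → 0# ≤ x → 0# ≤ x ^ n
  0≤^ zero    _   = 0≤1
  0≤^ (suc n) 0≤x = 0≤* 0≤x (0≤^ n 0≤x)

  0<^ : ∀ n → 0# < x → 0# < x ^ n
  0<^ zero    _   = 0<1
  0<^ (suc n) 0<x = *-positive 0<x (0<^ n 0<x)

  ^-monoˡ-≤ : ∀ n → 0# ≤ x → x ≤ y → x ^ n ≤ y ^ n
  ^-monoˡ-≤ zero    _   _   = ≤-refl
  ^-monoˡ-≤ (suc n) 0≤x x≤y = *-mono-≤ (0≤^ n 0≤x) (≤-trans 0≤x x≤y) x≤y (^-monoˡ-≤ n 0≤x x≤y)

  ^≤1 : ∀ n → 0# ≤ x → x ≤ 1# → x ^ n ≤ 1#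
  ^≤1 zero    _   _   = ≤-refl
  ^≤1 (suc n) 0≤x x≤1 = ≤-respʳ (*-identityˡ 1#) (*-mono-≤ (0≤^ n 0≤x) 0≤1 x≤1 (^≤1 n 0≤x x≤1))

  ^-antiʳ-≤ : ∀ {m n} → 0# ≤ x → x ≤ 1# → m ℕ.≤ n → x ^ n ≤ x ^ m
  ^-antiʳ-≤ {n = n} 0≤x x≤1 z≤n       = ^≤1 n 0≤x x≤1
  ^-antiʳ-≤         0≤x x≤1 (s≤s m≤n) = *-monoˡ-≤ 0≤x (^-antiʳ-≤ 0≤x x≤1 m≤n)

  1^n≈1 : ∀ n → 1# ^ n ≈ 1#
  1^n≈1 zero    = refl
  1^n≈1 (suc n) = trans (*-identityˡ _) (1^n≈1 n)

  1≤^ : ∀ n → 1# ≤ x → 1# ≤ x ^ n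
  1≤^ n 1≤x = ≤-respˡ (1^n≈1 n) (^-monoˡ-≤ n 0≤1 1≤x)

  ^-monoʳ-≤ : ∀ {m n} → 1# ≤ x → m ℕ.≤ n → x ^ m ≤ x ^ n
  ^-monoʳ-≤ {n = n} 1≤x z≤n       = 1≤^ n 1≤x
  ^-monoʳ-≤         1≤x (s≤s m≤n) = *-monoˡ-≤ (≤-trans 0≤1 1≤x) (^-monoʳ-≤ 1≤x m≤n)

  ι : ℕ → Carrier
  ι n = n · 1#

  ·≈ι* : ∀ n x → n · x ≈ ι n * x
  ·≈ι* n x = trans (×-congʳ n (sym (*-identityˡ x))) (sym (×-assoc-* n 1# x))

  ι-+ : ∀ m n → ι (m ℕ.+ n) ≈ ι m + ι n
  ι-+ = ×-homo-+ 1#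

  ι-* : ∀ m n → ι (m ℕ.* n) ≈ ι m * ι n
  ι-* = ×1-homo-*

  ι-^ : ∀ m n → ι (m ℕ.^ n) ≈ ι m ^ n
  ι-^ m zero    = +-identityʳ 1#
  ι-^ m (suc n) = trans (ι-* m (m ℕ.^ n)) (*-congˡ (ι-^ m n))

  ι1≈1 : ι 1 ≈ 1#
  ι1≈1 = +-identityʳ 1#

  0≤ι : ∀ n → 0# ≤ ι n
  0≤ι zero    = ≤-refl
  0≤ι (suc n) = 0≤+ 0≤1 (0≤ι n)

  ι-mono-≤ : ∀ {m n} → m ℕ.≤ n → ι m ≤ ι n
  ι-mono-≤ {n = n} z≤n = 0≤ι n
  ι-mono-≤ (s≤s m≤n)   = +-mono-≤ ≤-refl (ι-mono-≤ m≤n)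

  1≤ι : ∀ {n} → 1 ℕ.≤ n → 1# ≤ ι n
  1≤ι 1≤n = ≤-respˡ ι1≈1 (ι-mono-≤ 1≤n)

  0<ι : ∀ {n} → 1 ℕ.≤ n → 0# < ι n
  0<ι 1≤n = <-≤-trans 0<1 (1≤ι 1≤n)

  x≤abs : ∀ x → x ≤ abs x
  x≤abs x = proj₁ (∨-supremum x (- x))

  -x≤abs : ∀ x → - x ≤ abs x
  -x≤abs x = proj₁ (proj₂ (∨-supremum x (- x)))

  abs≤ : x ≤ y → - x ≤ y → abs x ≤ y
  abs≤ {x} {y} = proj₂ (proj₂ (∨-supremum x (- x))) y

  abs-congˡ-≤ : x ≈ y → abs x ≤ z → abs y ≤ z
  abs-congˡ-≤ x≈y le = abs≤ (≤-respˡ x≈y (≤-trans (x≤abs _) le))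
                            (≤-respˡ (-‿cong x≈y) (≤-trans (-x≤abs _) le))

  nonneg⇒abs≤ : 0# ≤ x → x ≤ y → abs x ≤ y
  nonneg⇒abs≤ 0≤x x≤y = abs≤ x≤y (≤-trans (≤-respʳ -0#≈0# (neg-anti-≤ 0≤x)) (≤-trans 0≤x x≤y))

  abs-+ : abs x ≤ z → abs y ≤ w → abs (x + y) ≤ z + w
  abs-+ {x} {z} {y} {w} le₁ le₂ = abs≤
    (+-mono-≤ (≤-trans (x≤abs x) le₁) (≤-trans (x≤abs y) le₂))
    (≤-respˡ (-‿+-comm x y) (+-mono-≤ (≤-trans (-x≤abs x) le₁) (≤-trans (-x≤abs y) le₂)))

  abs-* : 0# ≤ x → abs y ≤ z → abs (x * y) ≤ x * z
  abs-* {x} {y} 0≤x le = abs≤ (*-monoˡ-≤ 0≤x (≤-trans (x≤abs y) le))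
    (≤-respˡ (sym (-‿distribʳ-* x y)) (*-monoˡ-≤ 0≤x (≤-trans (-x≤abs y) le)))

  abs-0 : 0# ≤ y → abs 0# ≤ y
  abs-0 = nonneg⇒abs≤ ≤-refl

  abs-neg : abs x ≤ y → abs (- x) ≤ y
  abs-neg {x} le = abs≤ (≤-trans (-x≤abs x) le)
                        (≤-respˡ (sym (-‿involutive x)) (≤-trans (x≤abs x) le))

-- Binomial coefficients indexed by the two parts, so that no truncated
-- subtraction is needed.
binom : ℕ → ℕ → ℕ
binom i j = (i ℕ.+ j) C i

binom-zeroʳ : ∀ i → binom i 0 ≡ 1
binom-zeroʳ i = ≡.trans (≡.cong (_C i) (ℕₚ.+-identityʳ i)) (nCn≡1 i)

binom-pascal : ∀ i j → binom (suc i) (suc j) ≡ binom i (suc j) ℕ.+ binom (suc i) j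
binom-pascal i j = ≡.trans (≡.sym (nCk+nC[k+1]≡[n+1]C[k+1] (i ℕ.+ suc j) i))
  (≡.cong (λ n → (i ℕ.+ suc j) C i ℕ.+ n C suc i) (ℕₚ.+-suc i j))

-- Finite sums over lists, initial segments and antidiagonals.

module Sums {c ℓ₁ ℓ₂} (ℝ : RealNumbers c ℓ₁ ℓ₂) where
  open OrderedField ℝ

  private
    variable
      a b : Level
      A : Set a
      B : Set b

  ∑-cong : ∀ (xs : List A) {f g : A → Carrier} → (∀ x → f x ≈ g x) → ∑ xs f ≈ ∑ xs g
  ∑-cong []       f≈g = refl
  ∑-cong (x ∷ xs) f≈g = +-cong (f≈g x) (∑-cong xs f≈g)

  private
    interchange : ∀ w x y z → (w + x) + (y + z) ≈ (w + y) + (x + z)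
    interchange = solve 4 (λ w x y z → (w :+ x) :+ (y :+ z) := (w :+ y) :+ (x :+ z)) refl

  ∑-+ : ∀ (xs : List A) f g → ∑ xs (λ x → f x + g x) ≈ ∑ xs f + ∑ xs g
  ∑-+ []       f g = sym (+-identityˡ 0#)
  ∑-+ (x ∷ xs) f g = trans (+-congˡ (∑-+ xs f g)) (interchange _ _ _ _)

  ∑-0 : ∀ (xs : List A) → ∑ xs (λ _ → 0#) ≈ 0#
  ∑-0 []       = refl
  ∑-0 (x ∷ xs) = trans (+-identityˡ _) (∑-0 xs)

  ∑-*ˡ : ∀ (xs : List A) k f → ∑ xs (λ x → k * f x) ≈ k * ∑ xs f
  ∑-*ˡ []       k f = sym (zeroʳ k)
  ∑-*ˡ (x ∷ xs) k f = trans (+-congˡ (∑-*ˡ xs k f)) (sym (distribˡ k _ _))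

  ∑-*ʳ : ∀ (xs : List A) k f → ∑ xs (λ x → f x * k) ≈ ∑ xs f * k
  ∑-*ʳ xs k f = trans (∑-cong xs (λ x → *-comm (f x) k)) (trans (∑-*ˡ xs k f) (*-comm k _))

  ∑-++ : ∀ (xs ys : List A) f → ∑ (xs ++ ys) f ≈ ∑ xs f + ∑ ys f
  ∑-++ []       ys f = sym (+-identityˡ _)
  ∑-++ (x ∷ xs) ys f = trans (+-congˡ (∑-++ xs ys f)) (sym (+-assoc _ _ _))

  ∑-map : ∀ (h : A → B) xs f → ∑ (map h xs) f ≈ ∑ xs (f ∘ h)
  ∑-map h []       f = refl
  ∑-map h (x ∷ xs) f = +-congˡ (∑-map h xs f)

  ∑-cartesianProductWith : ∀ {c} {C : Set c} (h : A → B → C) xs ys f →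
    ∑ (cartesianProductWith h xs ys) f ≈ ∑ xs λ x → ∑ ys λ y → f (h x y)
  ∑-cartesianProductWith h []       ys f = refl
  ∑-cartesianProductWith h (x ∷ xs) ys f =
    trans (∑-++ (map (h x) ys) _ f) (+-cong (∑-map (h x) ys f) (∑-cartesianProductWith h xs ys f))

  ∑-comm : ∀ (xs : List A) (ys : List B) (f : A → B → Carrier) →
    (∑ xs λ x → ∑ ys λ y → f x y) ≈ (∑ ys λ y → ∑ xs λ x → f x y)
  ∑-comm []       ys f = sym (∑-0 ys)
  ∑-comm (x ∷ xs) ys f = trans (+-congˡ (∑-comm xs ys f)) (sym (∑-+ ys (f x) _))

  abs-∑ : ∀ (xs : List A) {f g : A → Carrier} → (∀ x → abs (f x) ≤ g x) → abs (∑ xs f) ≤ ∑ xs g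
  abs-∑ []       le = abs-0 ≤-refl
  abs-∑ (x ∷ xs) le = abs-+ (le x) (abs-∑ xs le)

  indicator : ∀ {p} {P : Set p} → Dec P → Carrier
  indicator (yes _) = 1#
  indicator (no _)  = 0#

  indicator-cong : ∀ {p q} {P : Set p} {Q : Set q} (P? : Dec P) (Q? : Dec Q) →
    (P → Q) → (Q → P) → indicator P? ≈ indicator Q?
  indicator-cong (yes p) (yes q) _ _ = refl
  indicator-cong (no ¬p) (no ¬q) _ _ = refl
  indicator-cong (yes p) (no ¬q) f _ = contradiction (f p) ¬q
  indicator-cong (no ¬p) (yes q) _ g = contradiction (g q) ¬p

  ∑-filter : ∀ {p} {P : Pred A p} (P? : Decidable P) xs f →
    ∑ (filter P? xs) f ≈ ∑ xs λ x → f x * indicator (P? x)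
  ∑-filter P? []       f = refl
  ∑-filter P? (x ∷ xs) f with P? x
  ... | yes _ = +-cong (sym (*-identityʳ _)) (∑-filter P? xs f)
  ... | no  _ = trans (∑-filter P? xs f) (sym (trans (+-congʳ (zeroʳ _)) (+-identityˡ _)))

  sum< : ℕ → (ℕ → Carrier) → Carrier
  sum< zero    f = 0#
  sum< (suc n) f = f 0 + sum< n (f ∘ suc)

  ∑-upTo : ∀ n f → ∑ (upTo n) f ≈ sum< n f
  ∑-upTo n f = go n id
    where
    go : ∀ n h → ∑ (applyUpTo h n) f ≈ sum< n (f ∘ h)
    go zero    h = refl
    go (suc n) h = +-congˡ (go n (h ∘ suc))

  sum<-cong : ∀ n {f g : ℕ → Carrier} → (∀ i → i ℕ.< n → f i ≈ g i) → sum< n f ≈ sum< n g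
  sum<-cong zero    f≈g = refl
  sum<-cong (suc n) f≈g = +-cong (f≈g 0 (s≤s z≤n)) (sum<-cong n (λ i i<n → f≈g (suc i) (s≤s i<n)))

  sum<-+ : ∀ n f g → sum< n (λ i → f i + g i) ≈ sum< n f + sum< n g
  sum<-+ zero    f g = sym (+-identityˡ 0#)
  sum<-+ (suc n) f g = trans (+-congˡ (sum<-+ n _ _)) (interchange _ _ _ _)

  sum<-*ˡ : ∀ n k f → sum< n (λ i → k * f i) ≈ k * sum< n f
  sum<-*ˡ zero    k f = sym (zeroʳ k)
  sum<-*ˡ (suc n) k f = trans (+-congˡ (sum<-*ˡ n k _)) (sym (distribˡ k _ _))

  sum<-last : ∀ n f → sum< (suc n) f ≈ sum< n f + f n
  sum<-last zero    f = +-comm _ _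
  sum<-last (suc n) f = trans (+-congˡ (sum<-last n (f ∘ suc))) (sym (+-assoc _ _ _))

  antidiag : ℕ → (ℕ → ℕ → Carrier) → Carrier
  antidiag zero    F = F 0 0
  antidiag (suc n) F = F 0 (suc n) + antidiag n (λ i j → F (suc i) j)

  antidiag-cong : ∀ n {F G : ℕ → ℕ → Carrier} →
    (∀ i j → i ℕ.+ j ≡ n → F i j ≈ G i j) → antidiag n F ≈ antidiag n G
  antidiag-cong zero    F≈G = F≈G 0 0 ≡.refl
  antidiag-cong (suc n) F≈G = +-cong (F≈G 0 (suc n) ≡.refl)
    (antidiag-cong n (λ i j eq → F≈G (suc i) j (≡.cong suc eq)))

  antidiag-+ : ∀ n F G → antidiag n (λ i j → F i j + G i j) ≈ antidiag n F + antidiag n G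
  antidiag-+ zero    F G = refl
  antidiag-+ (suc n) F G = trans (+-congˡ (antidiag-+ n _ _)) (interchange _ _ _ _)

  antidiag-*ˡ : ∀ n k F → antidiag n (λ i j → k * F i j) ≈ k * antidiag n F
  antidiag-*ˡ zero    k F = refl
  antidiag-*ˡ (suc n) k F = trans (+-congˡ (antidiag-*ˡ n k _)) (sym (distribˡ k _ _))

  antidiag-sucʳ : ∀ n F → antidiag (suc n) F ≈ antidiag n (λ i j → F i (suc j)) + F (suc n) 0
  antidiag-sucʳ zero    F = refl
  antidiag-sucʳ (suc n) F = trans (+-congˡ (antidiag-sucʳ n (λ i j → F (suc i) j))) (sym (+-assoc _ _ _))

  antidiag-flip : ∀ n F → antidiag n F ≈ antidiag n (flip F)
  antidiag-flip zero    F = refl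
  antidiag-flip (suc n) F = trans (antidiag-sucʳ n F)
    (trans (+-comm _ _) (+-congˡ (antidiag-flip n (λ i j → F i (suc j)))))

  antidiag-mono-≤ : ∀ n {F G : ℕ → ℕ → Carrier} →
    (∀ i j → i ℕ.+ j ≡ n → F i j ≤ G i j) → antidiag n F ≤ antidiag n G
  antidiag-mono-≤ zero    F≤G = F≤G 0 0 ≡.refl
  antidiag-mono-≤ (suc n) F≤G = +-mono-≤ (F≤G 0 (suc n) ≡.refl)
    (antidiag-mono-≤ n (λ i j eq → F≤G (suc i) j (≡.cong suc eq)))

  abs-antidiag : ∀ n {F G : ℕ → ℕ → Carrier} →
    (∀ i j → i ℕ.+ j ≡ n → abs (F i j) ≤ G i j) → abs (antidiag n F) ≤ antidiag n G
  abs-antidiag zero    le = le 0 0 ≡.refl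
  abs-antidiag (suc n) le = abs-+ (le 0 (suc n) ≡.refl)
    (abs-antidiag n (λ i j eq → le (suc i) j (≡.cong suc eq)))

  antidiag-lower : ∀ r n F →
    antidiag (r ℕ.+ n) F ≈ sum< r (λ i → F i ((r ℕ.+ n) ∸ i)) + antidiag n (λ i j → F (r ℕ.+ i) j)
  antidiag-lower zero    n F = sym (+-identityˡ _)
  antidiag-lower (suc r) n F = trans (+-congˡ (antidiag-lower r n _)) (sym (+-assoc _ _ _))

  antidiag-upper : ∀ r n F →
    antidiag (r ℕ.+ n) F ≈ sum< r (λ j → F ((r ℕ.+ n) ∸ j) j) + antidiag n (λ i j → F i (r ℕ.+ j))
  antidiag-upper r n F = trans (antidiag-flip (r ℕ.+ n) F) (trans (antidiag-lower r n (flip F))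
    (+-congˡ (antidiag-flip n _)))

  -- Removing the line `j = 0` from the triangle `i + j < suc r` leaves the same triangle for `r`.
  sum<-antidiag : ∀ r F → sum< r (λ l → antidiag l F) ≈ sum< r (λ j → sum< (r ∸ j) (λ i → F i j))
  sum<-antidiag zero    F = refl
  sum<-antidiag (suc r) F = begin
    F 0 0 + sum< r (λ l → antidiag (suc l) F)
      ≈⟨ +-congˡ (trans (sum<-cong r (λ l _ → trans (antidiag-sucʳ l F) (+-comm _ _))) (sum<-+ r _ _)) ⟩
    F 0 0 + (sum< r (λ l → F (suc l) 0) + sum< r (λ l → antidiag l (λ i j → F i (suc j))))
      ≈⟨ +-congˡ (+-congˡ (sum<-antidiag r _)) ⟩
    F 0 0 + (sum< r (λ l → F (suc l) 0) + sum< r (λ j → sum< (r ∸ j) (λ i → F i (suc j))))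
      ≈⟨ sym (+-assoc _ _ _) ⟩
    sum< (suc r) (λ i → F i 0) + sum< r (λ j → sum< (r ∸ j) (λ i → F i (suc j))) ∎

  -- Pascal's rule splits each coefficient on diagonal `suc n` between its two predecessors on
  -- diagonal `n`. Regrouping by predecessor is what adds one vertex in `T-split`.
  antidiag-pascal : ∀ n (G : ℕ → ℕ → Carrier) →
    antidiag (suc n) (λ i j → ι (binom i j) * G i j) ≈
    antidiag n (λ i j → ι (binom i j) * (G (suc i) j + G i (suc j)))
  antidiag-pascal n G = begin
    antidiag (suc n) (λ i j → ι (binom i j) * G i j)
      ≈⟨ antidiag-cong (suc n) (λ i j eq → trans (*-congʳ (split i j eq)) (distribʳ (G i j) _ _)) ⟩
    antidiag (suc n) (λ i j → L i j * G i j + R i j * G i j)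
      ≈⟨ antidiag-+ (suc n) (λ i j → L i j * G i j) (λ i j → R i j * G i j) ⟩
    antidiag (suc n) (λ i j → L i j * G i j) + antidiag (suc n) (λ i j → R i j * G i j)
      ≈⟨ +-cong (trans (+-congʳ (zeroˡ (G 0 (suc n)))) (+-identityˡ _))
                (trans (antidiag-sucʳ n (λ i j → R i j * G i j)) (trans (+-congˡ (zeroˡ _)) (+-identityʳ _))) ⟩
    antidiag n (λ i j → ι (binom i j) * G (suc i) j) + antidiag n (λ i j → ι (binom i j) * G i (suc j))
      ≈⟨ sym (antidiag-+ n (λ i j → ι (binom i j) * G (suc i) j) (λ i j → ι (binom i j) * G i (suc j))) ⟩
    antidiag n (λ i j → ι (binom i j) * G (suc i) j + ι (binom i j) * G i (suc j))
      ≈⟨ antidiag-cong n (λ i j _ → sym (distribˡ _ _ _)) ⟩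
    antidiag n (λ i j → ι (binom i j) * (G (suc i) j + G i (suc j))) ∎
    where
    -- The shares of the predecessors `(i - 1, j)` and `(i, j - 1)`, zero where there is no such
    -- predecessor.
    L R : ℕ → ℕ → Carrier
    L zero    j = 0#
    L (suc i) j = ι (binom i j)
    R i zero    = 0#
    R i (suc j) = ι (binom i j)
    split : ∀ i j → i ℕ.+ j ≡ suc n → ι (binom i j) ≈ L i j + R i j
    split zero    (suc j) eq = sym (+-identityˡ _)
    split (suc i) zero    eq = trans (reflexive (≡.cong ι (≡.trans (binom-zeroʳ (suc i)) (≡.sym (binom-zeroʳ i)))))
                                     (sym (+-identityʳ _))
    split (suc i) (suc j) eq = trans (reflexive (≡.cong ι (binom-pascal i j))) (ι-+ (binom i (suc j)) (binom (suc i) j))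

-- Counting equivalence classes by deduplication.

module _ {a b} {A : Set a} {B : Set b} {R : Rel B 0ℓ} (R? : B.Decidable R) (h : A → B) where
  filter-map : ∀ z xs → filter (¬? ∘ R? (h z)) (map h xs) ≡ map h (filter (λ x → ¬? (R? (h z) (h x))) xs)
  filter-map z []       = ≡.refl
  filter-map z (x ∷ xs) with R? (h z) (h x)
  ... | yes _ = filter-map z xs
  ... | no  _ = ≡.cong (h x ∷_) (filter-map z xs)

  deduplicate-map : ∀ xs → deduplicate R? (map h xs) ≡ map h (deduplicate (λ x y → R? (h x) (h y)) xs)
  deduplicate-map []       = ≡.refl
  deduplicate-map (x ∷ xs) = ≡.cong (h x ∷_)
    (≡.trans (≡.cong (filter (¬? ∘ R? (h x))) (deduplicate-map xs)) (filter-map x (deduplicate (λ x y → R? (h x) (h y)) xs)))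

module _ {a} {A : Set a} {R : Rel A 0ℓ} (isEquivalence : IsEquivalence R) (R? : B.Decidable R) where
  open IsEquivalence isEquivalence

  -- The entries of `xs` represent distinct classes, so at most one of them lies in the class of
  -- `z`, and `Any` supplies one.
  length-filter-unrelated : ∀ z {xs} → AllPairs (λ x y → ¬ R x y) xs → Any (R z) xs →
    suc (length (filter (¬? ∘ R? z) xs)) ≡ length xs
  length-filter-unrelated z {x ∷ xs} (x# ∷ xs#) (here Rzx)
    rewrite filter-reject (¬? ∘ R? z) {x} {xs} (λ ¬Rzx → ¬Rzx Rzx)
          | filter-all (¬? ∘ R? z) (All.map (λ ¬Rxy Rzy → ¬Rxy (trans (sym Rzx) Rzy)) x#) = ≡.refl
  length-filter-unrelated z {x ∷ xs} (x# ∷ xs#) (there any) with R? z x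
  ... | no  _   = ≡.cong suc (length-filter-unrelated z xs# any)
  ... | yes Rzx = contradiction any (All.All¬⇒¬Any (All.map (λ ¬Rxy Rzy → ¬Rxy (trans (sym Rzx) Rzy)) x#))

module _ {n : ℕ} {R : Rel (Fin n) 0ℓ} (R? : B.Decidable R) where
  -- Defined for any relation, since restricting `Connected (N ∷ g)` to the vertices other than zero
  -- does not give `Connected g`: paths may run through vertex zero.
  classes : ℕ
  classes = length (deduplicate R? (allFin n))

module _ {n : ℕ} {R : Rel (Fin (suc n)) 0ℓ} (isEquivalence : IsEquivalence R) (R? : B.Decidable R) where
  open IsEquivalence isEquivalence

  private
    R⁺? : B.Decidable (R on suc)
    R⁺? i j = R? (suc i) (suc j)

    tails : List (Fin (suc n))
    tails = deduplicate R? (tabulate suc)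

    length-tails : length tails ≡ classes R⁺?
    length-tails = ≡.trans (≡.cong (length ∘ deduplicate R?) (≡.sym (map-tabulate (λ i → i) suc)))
      (≡.trans (≡.cong length (deduplicate-map R? suc (allFin n))) (length-map {B = Fin (suc n)} suc (deduplicate R⁺? (allFin n))))

  -- `deduplicate` puts `zero` in front and discards from the later representatives exactly one,
  -- that of the class of `zero`, so the count does not change.
  classes-attached : ∀ j → R zero (suc j) → classes R? ≡ classes R⁺?
  classes-attached j R0j = ≡.trans (length-filter-unrelated isEquivalence R? zero
      (deduplicate-! (record { isDecEquivalence = record { isEquivalence = isEquivalence ; _≟_ = R? } }) (tabulate suc))
      (Any.deduplicate⁺ R? (λ Ryx Rzx → trans Rzx (sym Ryx)) (Any.tabulate⁺ j R0j)))
    length-tails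

  classes-isolated : (∀ j → ¬ R zero (suc j)) → classes R? ≡ suc (classes R⁺?)
  classes-isolated isolated = ≡.cong suc (≡.trans
    (≡.cong length (filter-all (¬? ∘ R? zero) (All.deduplicate⁺ R? (All.tabulate⁺ isolated))))
    length-tails)

-- Colourings that are constant along edges.

colourings : ∀ y n → List (Vec (Fin y) n)
colourings y zero    = [] ∷ []
colourings y (suc n) = cartesianProductWith _∷_ (allFin y) (colourings y n)

module _ {n y : ℕ} {R : Rel (Fin n) 0ℓ} where
  ConstantOn : Vec (Fin y) n → Set
  ConstantOn f = ∀ i j → R i j → lookup f i ≡ lookup f j

  constantOn? : B.Decidable R → ∀ f → Dec (ConstantOn f)
  constantOn? R? f = all? λ i → all? λ j → R? i j →-dec (lookup f i Fin.≟ lookup f j)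

Monochromatic : ∀ {n y} → Graph n → Vec (Fin y) n → Set
Monochromatic g f = ∀ i j → Adj g i j → lookup f i ≡ lookup f j

Agrees : ∀ {n y} → Subset n → Fin y → Vec (Fin y) n → Set
Agrees N c f = ∀ j → j ∈ N → c ≡ lookup f j

agrees? : ∀ {n y} N (c : Fin y) (f : Vec (Fin y) n) → Dec (Agrees N c f)
agrees? N c f = all? λ j → (j ∈? N) →-dec (c Fin.≟ lookup f j)

monochromatic⇒constant : ∀ {n y} (g : Graph n) (f : Vec (Fin y) n) → Monochromatic g f → ConstantOn {R = Connected g} f
monochromatic⇒constant g f mono i j ε       = ≡.refl
monochromatic⇒constant g f mono i j (e ◅ p) = ≡.trans (mono _ _ e) (monochromatic⇒constant g f mono _ j p)

monochromatic? : ∀ {n y} (g : Graph n) (f : Vec (Fin y) n) → Dec (Monochromatic g f)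
monochromatic? g f = map′ (λ const i j e → const i j (e ◅ ε)) (monochromatic⇒constant g f) (constantOn? (connected? g) f)

-- The expectation of `y ^ π₀` as a sum over colourings.

module Colourings {c ℓ₁ ℓ₂} (ℝ : RealNumbers c ℓ₁ ℓ₂) where
  open OrderedField ℝ
  open Sums ℝ
  open import Algebra.Properties.Semiring.Sum semiring public
    using (sum; sum-remove; *-distribˡ-sum; sum-cong-≋)

  ∑-tabulate : ∀ {a} {A : Set a} {n} (h : Fin n → A) f → ∑ (tabulate h) f ≈ sum (f ∘ h)
  ∑-tabulate {n = zero}  h f = refl
  ∑-tabulate {n = suc n} h f = +-congˡ (∑-tabulate (h ∘ suc) f)

  ∑-allFin : ∀ n f → ∑ (allFin n) f ≈ sum f
  ∑-allFin n = ∑-tabulate {n = n} (λ i → i)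

  ∑-allFin-const : ∀ n x → ∑ (allFin n) (λ _ → x) ≈ ι n * x
  ∑-allFin-const n x = trans (∑-allFin n (λ _ → x)) (go n)
    where
    go : ∀ n → sum {n} (λ _ → x) ≈ ι n * x
    go zero    = sym (zeroˡ x)
    go (suc n) = trans (+-cong (sym (*-identityˡ x)) (go n)) (sym (distribʳ x 1# (ι n)))

  sum-0 : ∀ n → sum {n} (λ _ → 0#) ≈ 0#
  sum-0 zero    = refl
  sum-0 (suc n) = trans (+-identityˡ _) (sum-0 n)

  ∑-indicator-≟ : ∀ {n} (j : Fin n) → ∑ (allFin n) (λ i → indicator (i Fin.≟ j)) ≈ 1#
  ∑-indicator-≟ {n} j = trans (∑-allFin n (λ i → indicator (i Fin.≟ j))) (go j)
    where
    go : ∀ {n} (j : Fin n) → sum (λ i → indicator (i Fin.≟ j)) ≈ 1#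
    go {suc n} zero    = trans (+-congˡ (sum-0 n)) (+-identityʳ 1#)
    go {suc n} (suc j) = trans (+-identityˡ _) (trans
      (sum-cong-≋ (λ i → indicator-cong (suc i Fin.≟ suc j) (i Fin.≟ j) Fin.suc-injective (≡.cong suc)))
      (go j))

  indicator-× : ∀ {p q r} {P : Set p} {Q : Set q} {R : Set r} (P? : Dec P) (Q? : Dec Q) (R? : Dec R) →
    (P → Q → R) → (R → P × Q) → indicator R? ≈ indicator P? * indicator Q?
  indicator-× (yes p) (yes q) (yes r) _ _ = sym (*-identityˡ 1#)
  indicator-× (yes p) (yes q) (no ¬r) f _ = contradiction (f p q) ¬r
  indicator-× (yes p) (no ¬q) (yes r) _ g = contradiction (proj₂ (g r)) ¬q
  indicator-× (yes p) (no ¬q) (no ¬r) _ _ = sym (zeroʳ 1#)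
  indicator-× (no ¬p) Q?      (yes r) _ g = contradiction (proj₁ (g r)) ¬p
  indicator-× (no ¬p) Q?      (no ¬r) _ _ = sym (zeroˡ _)

  -- Either the first vertex is related to a later one and its colour is forced, or it is alone in
  -- its class and its colour is free; `classes` stays the same or grows by one accordingly.
  ∑-constantOn : ∀ y {n} {R : Rel (Fin n) 0ℓ} → IsEquivalence R → (R? : B.Decidable R) →
    ∑ (colourings y n) (λ f → indicator (constantOn? R? f)) ≈ ι y ^ classes R?
  ∑-constantOn y {zero}          isEquivalence R? = +-identityʳ 1#
  ∑-constantOn y {suc n} {R = R} isEquivalence R? = trans
    (∑-cartesianProductWith _∷_ (allFin y) (colourings y n) (λ f → indicator (constantOn? R? f)))
    (cases (any? (λ j → R? zero (suc j))))
    where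
    open IsEquivalence isEquivalence renaming (refl to R-refl; sym to R-sym; trans to R-trans)

    R⁺? : B.Decidable (R on suc)
    R⁺? i j = R? (suc i) (suc j)

    colourings⁺ = colourings y n

    ih : ∑ colourings⁺ (λ f → indicator (constantOn? R⁺? f)) ≈ ι y ^ classes R⁺?
    ih = ∑-constantOn y (record { refl = R-refl ; sym = R-sym ; trans = R-trans }) R⁺?

    cases : Dec (∃[ j ] R zero (suc j)) →
      (∑ (allFin y) λ c → ∑ colourings⁺ λ f → indicator (constantOn? R? (c ∷ f))) ≈ ι y ^ classes R?
    cases (yes (k , R0k)) = begin
      (∑ (allFin y) λ c → ∑ colourings⁺ λ f → indicator (constantOn? R? (c ∷ f)))
        ≈⟨ ∑-comm (allFin y) colourings⁺ _ ⟩
      (∑ colourings⁺ λ f → ∑ (allFin y) λ c → indicator (constantOn? R? (c ∷ f)))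
        ≈⟨ ∑-cong colourings⁺ (λ f → trans (∑-cong (allFin y) (split f))
             (trans (∑-*ˡ (allFin y) _ _)
             (trans (*-congˡ (∑-indicator-≟ (lookup f k))) (*-identityʳ _)))) ⟩
      (∑ colourings⁺ λ f → indicator (constantOn? R⁺? f))
        ≈⟨ ih ⟩
      ι y ^ classes R⁺?
        ≡⟨ ≡.cong (ι y ^_) (≡.sym (classes-attached isEquivalence R? k R0k)) ⟩
      ι y ^ classes R? ∎
      where
      split : ∀ f c → indicator (constantOn? R? (c ∷ f)) ≈ indicator (constantOn? R⁺? f) * indicator (c Fin.≟ lookup f k)
      split f c = indicator-× (constantOn? R⁺? f) (c Fin.≟ lookup f k) (constantOn? R? (c ∷ f)) to
        (λ const → (λ i j → const (suc i) (suc j)) , const zero (suc k) R0k)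
        where
        to : ConstantOn {R = R on suc} f → c ≡ lookup f k → ConstantOn {R = R} (c ∷ f)
        to const c≡ zero    zero    r = ≡.refl
        to const c≡ zero    (suc j) r = ≡.trans c≡ (const k j (R-trans (R-sym R0k) r))
        to const c≡ (suc i) zero    r = ≡.trans (const i k (R-trans r R0k)) (≡.sym c≡)
        to const c≡ (suc i) (suc j) r = const i j r
    cases (no isolated) = begin
      (∑ (allFin y) λ c → ∑ colourings⁺ λ f → indicator (constantOn? R? (c ∷ f)))
        ≈⟨ ∑-cong (allFin y) (λ c → trans (∑-cong colourings⁺ (drop c)) ih) ⟩
      (∑ (allFin y) λ c → ι y ^ classes R⁺?)
        ≈⟨ ∑-allFin-const y _ ⟩
      ι y * ι y ^ classes R⁺?
        ≡⟨ ≡.cong (ι y ^_) (≡.sym (classes-isolated isEquivalence R? (λ j r → isolated (j , r)))) ⟩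
      ι y ^ classes R? ∎
      where
      drop : ∀ c f → indicator (constantOn? R? (c ∷ f)) ≈ indicator (constantOn? R⁺? f)
      drop c f = indicator-cong (constantOn? R? (c ∷ f)) (constantOn? R⁺? f) (λ const i j → const (suc i) (suc j)) from
        where
        from : ConstantOn {R = R on suc} f → ConstantOn {R = R} (c ∷ f)
        from const zero    zero    r = ≡.refl
        from const zero    (suc j) r = contradiction (j , r) isolated
        from const (suc i) zero    r = contradiction (i , R-sym r) isolated
        from const (suc i) (suc j) r = const i j r

  Connected-isEquivalence : ∀ {n} (g : Graph n) → IsEquivalence (Connected g)
  Connected-isEquivalence g = record
    { refl  = ε
    ; sym   = Star.reverse (Adj-sym g)
    ; trans = _◅◅_
    }

  -- The indicator of `Agrees` as a product with one factor per neighbour, so that the sum over all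
  -- neighbourhoods factorises.
  agreement : ∀ {n y} → Subset n → Fin y → Vec (Fin y) n → Carrier
  agreement []            c []      = 1#
  agreement (outside ∷ N) c (d ∷ f) = agreement N c f
  agreement (inside ∷ N)  c (d ∷ f) = indicator (c Fin.≟ d) * agreement N c f

  agreement≈indicator : ∀ {n y} N (c : Fin y) (f : Vec (Fin y) n) → agreement N c f ≈ indicator (agrees? N c f)
  agreement≈indicator []            c []      = refl
  agreement≈indicator (outside ∷ N) c (d ∷ f) = trans (agreement≈indicator N c f)
    (indicator-cong (agrees? N c f) (agrees? (outside ∷ N) c (d ∷ f)) to (λ agrees j j∈N → agrees (suc j) (there j∈N)))
    where
    to : Agrees N c f → Agrees (outside ∷ N) c (d ∷ f)
    to agrees (suc j) (there j∈N) = agrees j j∈N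
  agreement≈indicator (inside ∷ N)  c (d ∷ f) = trans (*-congˡ (agreement≈indicator N c f))
    (sym (indicator-× (c Fin.≟ d) (agrees? N c f) (agrees? (inside ∷ N) c (d ∷ f)) to
      (λ agrees → agrees zero here , λ j j∈N → agrees (suc j) (there j∈N))))
    where
    to : c ≡ d → Agrees N c f → Agrees (inside ∷ N) c (d ∷ f)
    to c≡d agrees zero    here        = c≡d
    to c≡d agrees (suc j) (there j∈N) = agrees j j∈N

  monochromacy : ∀ {n y} → Graph n → Vec (Fin y) n → Carrier
  monochromacy []      []      = 1#
  monochromacy (N ∷ g) (c ∷ f) = agreement N c f * monochromacy g f

  monochromacy≈indicator : ∀ {n y} (g : Graph n) (f : Vec (Fin y) n) → monochromacy g f ≈ indicator (monochromatic? g f)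
  monochromacy≈indicator []      []      = refl
  monochromacy≈indicator (N ∷ g) (c ∷ f) = trans
    (*-cong (agreement≈indicator N c f) (monochromacy≈indicator g f))
    (sym (indicator-× (agrees? N c f) (monochromatic? g f) (monochromatic? (N ∷ g) (c ∷ f)) to
      (λ mono → (λ j → mono zero (suc j)) , (λ i j → mono (suc i) (suc j)))))
    where
    to : Agrees N c f → Monochromatic g f → Monochromatic (N ∷ g) (c ∷ f)
    to agrees mono zero    (suc j) e = agrees j e
    to agrees mono (suc i) zero    e = ≡.sym (agrees i e)
    to agrees mono (suc i) (suc j) e = mono i j e

  ∑-monochromacy : ∀ {n} (g : Graph n) y → ∑ (colourings y n) (monochromacy g) ≈ ι y ^ π₀ g
  ∑-monochromacy {n} g y = trans
    (∑-cong (colourings y n) (λ f → trans (monochromacy≈indicator g f)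
      (indicator-cong (monochromatic? g f) (constantOn? (connected? g) f)
        (monochromatic⇒constant g f) (λ const i j e → const i j (e ◅ ε)))))
    (∑-constantOn y (Connected-isEquivalence g) (connected? g))

  module Model (p : Carrier) where
    q : Carrier
    q = 1# - p

    q+p≈1 : q + p ≈ 1#
    q+p≈1 = x-y+y≈x 1# p

    neighbourhoodMass : ∀ {n} → Subset n → Carrier
    neighbourhoodMass []            = 1#
    neighbourhoodMass (outside ∷ N) = q * neighbourhoodMass N
    neighbourhoodMass (inside ∷ N)  = p * neighbourhoodMass N

    mass-∷ : ∀ {n} (N : Subset n) g → mass ℝ p (N ∷ g) ≡ neighbourhoodMass N * mass ℝ p g
    mass-∷ N g = ≡.cong (_* mass ℝ p g) (foldr-factor _ ≡.refl ≡.refl N)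
      where
      foldr-factor : ∀ (factor : Side → Carrier) → factor inside ≡ p → factor outside ≡ q →
        ∀ {n} (N : Subset n) → foldr′ (λ s x → factor s * x) 1# N ≡ neighbourhoodMass N
      foldr-factor factor eqᵢ eqₒ []            = ≡.refl
      foldr-factor factor eqᵢ eqₒ (outside ∷ N) = ≡.cong₂ _*_ eqₒ (foldr-factor factor eqᵢ eqₒ N)
      foldr-factor factor eqᵢ eqₒ (inside ∷ N)  = ≡.cong₂ _*_ eqᵢ (foldr-factor factor eqᵢ eqₒ N)

    -- The probability that a pair of vertices coloured c and d is not a bichromatic edge.
    κ : ∀ {y} → Fin y → Fin y → Carrier
    κ c d = q + p * indicator (c Fin.≟ d)

    links : ∀ {n y} → Fin y → Vec (Fin y) n → Carrier
    links c []      = 1#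
    links c (d ∷ f) = κ c d * links c f

    allLinks : ∀ {n y} → Vec (Fin y) n → Carrier
    allLinks []      = 1#
    allLinks (c ∷ f) = links c f * allLinks f

    private
      *-interchange : ∀ w x y z → (w * x) * (y * z) ≈ (w * y) * (x * z)
      *-interchange = solve 4 (λ w x y z → (w :* x) :* (y :* z) := (w :* y) :* (x :* z)) refl

    ∑-agreement : ∀ {n y} (c : Fin y) (f : Vec (Fin y) n) →
      ∑ (subsets n) (λ N → neighbourhoodMass N * agreement N c f) ≈ links c f
    ∑-agreement {zero}  c []      = trans (+-identityʳ _) (*-identityˡ 1#)
    ∑-agreement {suc n} c (d ∷ f) = begin
      ∑ (subsets (suc n)) (λ N → neighbourhoodMass N * agreement N c (d ∷ f))
        ≈⟨ ∑-cartesianProductWith _∷_ (outside ∷ inside ∷ []) (subsets n) (λ N → neighbourhoodMass N * agreement N c (d ∷ f)) ⟩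
      ∑ (subsets n) (λ N → (q * neighbourhoodMass N) * agreement N c f)
        + (∑ (subsets n) (λ N → (p * neighbourhoodMass N) * (indicator (c Fin.≟ d) * agreement N c f)) + 0#)
        ≈⟨ +-cong (trans (∑-cong (subsets n) (λ N → *-assoc _ _ _)) (∑-*ˡ (subsets n) q _))
             (trans (+-identityʳ _) (trans (∑-cong (subsets n) (λ N → *-interchange _ _ _ _)) (∑-*ˡ (subsets n) _ _))) ⟩
      q * S + p * indicator (c Fin.≟ d) * S
        ≈⟨ sym (distribʳ S q _) ⟩
      κ c d * S
        ≈⟨ *-congˡ (∑-agreement c f) ⟩
      κ c d * links c f ∎
      where S = ∑ (subsets n) (λ N → neighbourhoodMass N * agreement N c f)

    -- Independence of the edges: for a fixed colouring, both the mass and the indicator are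
    -- products over pairs, so the expectation is a product too.
    ∑-mass-monochromacy : ∀ {n y} (f : Vec (Fin y) n) →
      ∑ (graphs n) (λ g → mass ℝ p g * monochromacy g f) ≈ allLinks f
    ∑-mass-monochromacy {zero}  []      = trans (+-identityʳ _) (*-identityˡ 1#)
    ∑-mass-monochromacy {suc n} (c ∷ f) = begin
      ∑ (graphs (suc n)) (λ g → mass ℝ p g * monochromacy g (c ∷ f))
        ≈⟨ ∑-cartesianProductWith _∷_ (subsets n) (graphs n) (λ g → mass ℝ p g * monochromacy g (c ∷ f)) ⟩
      (∑ (subsets n) λ N → ∑ (graphs n) λ g → mass ℝ p (N ∷ g) * (agreement N c f * monochromacy g f))
        ≈⟨ ∑-cong (subsets n) (λ N → trans
             (∑-cong (graphs n) (λ g → trans (*-congʳ (reflexive (mass-∷ N g))) (*-interchange _ _ _ _)))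
             (trans (∑-*ˡ (graphs n) _ _) (*-congˡ (∑-mass-monochromacy f)))) ⟩
      (∑ (subsets n) λ N → neighbourhoodMass N * agreement N c f * allLinks f)
        ≈⟨ trans (∑-*ʳ (subsets n) _ _) (*-congʳ (∑-agreement c f)) ⟩
      links c f * allLinks f ∎

    weights : ∀ {n y} → (Fin y → Carrier) → Vec (Fin y) n → Carrier
    weights δ []      = 1#
    weights δ (c ∷ f) = δ c * weights δ f

    weights-κ : ∀ {n y} δ c (f : Vec (Fin y) n) → weights (λ d → δ d * κ c d) f ≈ weights δ f * links c f
    weights-κ δ c []      = sym (*-identityˡ 1#)
    weights-κ δ c (d ∷ f) = trans (*-congˡ (weights-κ δ c f)) (*-interchange _ _ _ _)

    -- The colour classes are revealed vertex by vertex; δ d is the cost of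
    -- giving the next vertex the colour d.
    T : ∀ {y} → ℕ → (Fin y → Carrier) → Carrier
    T zero    δ = 1#
    T (suc n) δ = sum λ c → δ c * T n (λ d → δ d * κ c d)

    -- `δ` is arbitrary because giving a vertex the colour `c` multiplies the cost of each colour
    -- `d` by `κ c d` for all later vertices.
    ∑-weights : ∀ n {y} (δ : Fin y → Carrier) → ∑ (colourings y n) (λ f → weights δ f * allLinks f) ≈ T n δ
    ∑-weights zero    δ = trans (+-identityʳ _) (*-identityˡ 1#)
    ∑-weights (suc n) {y} δ = begin
      ∑ (colourings y (suc n)) (λ f → weights δ f * allLinks f)
        ≈⟨ ∑-cartesianProductWith _∷_ (allFin y) (colourings y n) (λ f → weights δ f * allLinks f) ⟩
      (∑ (allFin y) λ c → ∑ (colourings y n) λ f → (δ c * weights δ f) * (links c f * allLinks f))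
        ≈⟨ ∑-cong (allFin y) (λ c → trans (∑-cong (colourings y n) (λ f → trans (regroup _ _ _ _)
             (*-congˡ (*-congʳ (sym (weights-κ δ c f)))))) (trans (∑-*ˡ (colourings y n) _ _)
             (*-congˡ (∑-weights n (λ d → δ d * κ c d))))) ⟩
      (∑ (allFin y) λ c → δ c * T n (λ d → δ d * κ c d))
        ≈⟨ ∑-allFin y _ ⟩
      T (suc n) δ ∎
      where
      regroup : ∀ w x y z → (w * x) * (y * z) ≈ w * ((x * y) * z)
      regroup = solve 4 (λ w x y z → (w :* x) :* (y :* z) := w :* ((x :* y) :* z)) refl

    Z : ℕ → ℕ → Carrier
    Z n y = ∑ (graphs n) λ g → mass ℝ p g * ι y ^ π₀ g

    -- Exchange of two sums: a fixed graph has `y ^ π₀` colourings constant along its edges, and for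
    -- a fixed colouring the sum over graphs is `allLinks`.
    Z≈T : ∀ n y → Z n y ≈ T {y} n (λ _ → 1#)
    Z≈T n y = begin
      (∑ (graphs n) λ g → mass ℝ p g * ι y ^ π₀ g)
        ≈⟨ ∑-cong (graphs n) (λ g → trans (*-congˡ (sym (∑-monochromacy g y))) (sym (∑-*ˡ (colourings y n) _ _))) ⟩
      (∑ (graphs n) λ g → ∑ (colourings y n) λ f → mass ℝ p g * monochromacy g f)
        ≈⟨ ∑-comm (graphs n) (colourings y n) _ ⟩
      (∑ (colourings y n) λ f → ∑ (graphs n) λ g → mass ℝ p g * monochromacy g f)
        ≈⟨ ∑-cong (colourings y n) (λ f → trans (∑-mass-monochromacy f)
             (trans (sym (*-identityˡ _)) (*-congʳ (sym (weights-1 f))))) ⟩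
      (∑ (colourings y n) λ f → weights (λ _ → 1#) f * allLinks f)
        ≈⟨ ∑-weights n (λ _ → 1#) ⟩
      T n (λ _ → 1#) ∎
      where
      weights-1 : ∀ {n y} (f : Vec (Fin y) n) → weights (λ _ → 1#) f ≈ 1#
      weights-1 []      = refl
      weights-1 (c ∷ f) = trans (*-identityˡ _) (weights-1 f)

binom-comm : ∀ i j → binom i j ≡ binom j i
binom-comm i j = ≡.trans (nCk≡nC[n∸k] (ℕₚ.m≤m+n i j))
  (≡.cong₂ _C_ (ℕₚ.+-comm i j) (ℕₚ.m+n∸m≡n i j))

-- Recursions obtained by splitting off one colour class.

module Recursion {c ℓ₁ ℓ₂} (ℝ : RealNumbers c ℓ₁ ℓ₂) (p : RealNumbers.Carrier ℝ) where
  open OrderedField ℝ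
  open Sums ℝ
  open Colourings ℝ
  open Model p
  open import Algebra.Properties.Semiring.Sum semiring using (∑-distrib-+)

  κ-refl : ∀ {y} (c : Fin y) → κ c c ≈ 1#
  κ-refl c with c Fin.≟ c
  ... | yes _  = trans (+-congˡ (*-identityʳ p)) q+p≈1
  ... | no c≢c = contradiction ≡.refl c≢c

  κ-≢ : ∀ {y} {c d : Fin y} → c ≢ d → κ c d ≈ q
  κ-≢ {c = c} {d} c≢d with c Fin.≟ d
  ... | yes c≡d = contradiction c≡d c≢d
  ... | no _    = trans (+-congˡ (zeroʳ p)) (+-identityʳ q)

  κ-punchIn : ∀ {y} (c : Fin (suc y)) d e → κ (punchIn c d) (punchIn c e) ≈ κ d e
  κ-punchIn c d e = +-congˡ (*-congˡ (indicator-cong (punchIn c d Fin.≟ punchIn c e) (d Fin.≟ e)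
    (punchIn-injective c d e) (≡.cong (punchIn c))))

  T-cong : ∀ n {y} {δ ε : Fin y → Carrier} → (∀ c → δ c ≈ ε c) → T n δ ≈ T n ε
  T-cong zero    δ≈ε = refl
  T-cong (suc n) δ≈ε = sum-cong-≋ λ c → *-cong (δ≈ε c) (T-cong n (λ d → *-congʳ (δ≈ε d)))

  -- Every vertex pays exactly one cost. In `T-split` the factor is `q`, paid by each vertex outside
  -- the class of `c`.
  T-scale : ∀ n {y} k (δ : Fin y → Carrier) → T n (λ c → k * δ c) ≈ k ^ n * T n δ
  T-scale zero    k δ = sym (*-identityˡ 1#)
  T-scale (suc n) {y} k δ = begin
    (sum λ c → (k * δ c) * T n (λ d → (k * δ d) * κ c d))
      ≈⟨ sum-cong-≋ {y} (λ c → trans (*-congˡ (trans (T-cong n (λ d → *-assoc k (δ d) (κ c d))) (T-scale n k (λ d → δ d * κ c d)))) (regroup _ _ _ _)) ⟩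
    (sum λ c → (k * k ^ n) * (δ c * T n (λ d → δ d * κ c d)))
      ≈⟨ sym (*-distribˡ-sum (k * k ^ n) (λ c → δ c * T n (λ d → δ d * κ c d))) ⟩
    (k * k ^ n) * T (suc n) δ ∎
    where
    regroup : ∀ w x y z → (w * x) * (y * z) ≈ (w * y) * (x * z)
    regroup = solve 4 (λ w x y z → (w :* x) :* (y :* z) := (w :* y) :* (x :* z)) refl

  sum-antidiag : ∀ n {y} (F : Fin y → ℕ → ℕ → Carrier) →
    sum (λ c → antidiag n (F c)) ≈ antidiag n (λ i j → sum λ c → F c i j)
  sum-antidiag zero    F = refl
  sum-antidiag (suc n) F = trans (∑-distrib-+ (λ c → F c 0 (suc n)) (λ c → antidiag n (λ i j → F c (suc i) j)))
    (+-congˡ (sum-antidiag n (λ c i j → F c (suc i) j)))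

  -- Splitting a colouring into the class of c, of size i, and the rest.
  T-split : ∀ n {y} (δ : Fin (suc y) → Carrier) c →
    T n δ ≈ antidiag n (λ i j → ι (binom i j) * (δ c ^ i * q ^ (i ℕ.* j) * T j (removeAt δ c)))
  T-split zero    δ c = sym (trans (*-cong ι1≈1 (trans (*-identityʳ _) (*-identityʳ _))) (*-identityʳ 1#))
  T-split (suc n) {y} δ c = begin
    T (suc n) δ
      ≈⟨ sum-remove {i = c} (λ d → δ d * T n (λ e → δ e * κ d e)) ⟩
    δ c * T n (λ e → δ e * κ c e) + (sum λ d → rest d * T n (λ e → δ e * κ (punchIn c d) e))
      ≈⟨ +-cong this others ⟩
    antidiag n (λ i j → ι (binom i j) * G (suc i) j) + antidiag n (λ i j → ι (binom i j) * G i (suc j))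
      ≈⟨ sym (antidiag-+ n (λ i j → ι (binom i j) * G (suc i) j) (λ i j → ι (binom i j) * G i (suc j))) ⟩
    antidiag n (λ i j → ι (binom i j) * G (suc i) j + ι (binom i j) * G i (suc j))
      ≈⟨ antidiag-cong n (λ i j _ → sym (distribˡ _ _ _)) ⟩
    antidiag n (λ i j → ι (binom i j) * (G (suc i) j + G i (suc j)))
      ≈⟨ sym (antidiag-pascal n G) ⟩
    antidiag (suc n) (λ i j → ι (binom i j) * G i j) ∎
    where
    rest = removeAt δ c
    G : ℕ → ℕ → Carrier
    G i j = δ c ^ i * q ^ (i ℕ.* j) * T j rest

    regroup₁ : ∀ d b x y z w → d * (b * (x * y * (z * w))) ≈ b * ((d * x) * (z * y) * w)
    regroup₁ = solve 6 (λ d b x y z w → d :* (b :* (x :* y :* (z :* w))) := b :* ((d :* x) :* (z :* y) :* w)) refl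

    -- The first vertex has colour `c`: its class is unaffected as `κ c c` is 1, while each of the
    -- `j` other vertices contributes `q`, raising the exponent to `suc i * j`.
    this : δ c * T n (λ e → δ e * κ c e) ≈ antidiag n (λ i j → ι (binom i j) * G (suc i) j)
    this = begin
      δ c * T n (λ e → δ e * κ c e)
        ≈⟨ *-congˡ (T-split n (λ e → δ e * κ c e) c) ⟩
      δ c * antidiag n (λ i j → ι (binom i j) * ((δ c * κ c c) ^ i * q ^ (i ℕ.* j) * T j (λ d → rest d * κ c (punchIn c d))))
        ≈⟨ sym (antidiag-*ˡ n (δ c) _) ⟩
      antidiag n (λ i j → δ c * (ι (binom i j) * ((δ c * κ c c) ^ i * q ^ (i ℕ.* j) * T j (λ d → rest d * κ c (punchIn c d)))))
        ≈⟨ antidiag-cong n (λ i j _ → trans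
             (*-congˡ (*-congˡ (*-cong (*-congʳ (^-congˡ i (trans (*-congˡ (κ-refl c)) (*-identityʳ _))))
               (trans (T-cong j (λ d → trans (*-congˡ (κ-≢ (punchInᵢ≢i c d ∘ ≡.sym))) (*-comm _ q))) (T-scale j q rest)))))
             (trans (regroup₁ _ _ _ _ _ _) (*-congˡ (*-congʳ (*-congˡ (sym (^-homo-* q j (i ℕ.* j)))))))) ⟩
      antidiag n (λ i j → ι (binom i j) * G (suc i) j) ∎

    regroup₂ : ∀ r b x y z w → r * (b * ((x * y) * z * w)) ≈ (b * (x * (y * z))) * (r * w)
    regroup₂ = solve 6 (λ r b x y z w → r :* (b :* ((x :* y) :* z :* w)) := (b :* (x :* (y :* z))) :* (r :* w)) refl

    -- The first vertex has another colour: now each of the `i` vertices of colour `c` contributes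
    -- `q`, raising the exponent to `i * suc j`.
    others : (sum λ d → rest d * T n (λ e → δ e * κ (punchIn c d) e)) ≈ antidiag n (λ i j → ι (binom i j) * G i (suc j))
    others = begin
      (sum λ d → rest d * T n (λ e → δ e * κ (punchIn c d) e))
        ≈⟨ sum-cong-≋ (λ d → trans (*-congˡ (T-split n (λ e → δ e * κ (punchIn c d) e) c))
             (trans (sym (antidiag-*ˡ n (rest d) _)) (antidiag-cong n (λ i j _ → trans
               (*-congˡ (*-congˡ (*-cong (*-congʳ (trans (^-congˡ i (*-congˡ (κ-≢ (punchInᵢ≢i c d)))) (^-distrib-* (δ c) q i)))
                  (T-cong j (λ e → *-congˡ (κ-punchIn c d e))))))
               (trans (regroup₂ _ _ _ _ _ _) (*-congʳ (*-congˡ (*-congˡ (trans (sym (^-homo-* q i (i ℕ.* j)))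
                 (reflexive (≡.cong (q ^_) (≡.sym (ℕₚ.*-suc i j)))))))))))) ) ⟩
      (sum λ d → antidiag n (λ i j → (ι (binom i j) * (δ c ^ i * q ^ (i ℕ.* suc j))) * (rest d * T j (λ e → rest e * κ d e))))
        ≈⟨ sum-antidiag n {y} (λ d i j → (ι (binom i j) * (δ c ^ i * q ^ (i ℕ.* suc j))) * (rest d * T j (λ e → rest e * κ d e))) ⟩
      antidiag n (λ i j → sum λ d → (ι (binom i j) * (δ c ^ i * q ^ (i ℕ.* suc j))) * (rest d * T j (λ e → rest e * κ d e)))
        ≈⟨ antidiag-cong n (λ i j _ → trans
             (sym (*-distribˡ-sum (ι (binom i j) * (δ c ^ i * q ^ (i ℕ.* suc j))) (λ d → rest d * T j (λ e → rest e * κ d e))))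
             (*-assoc _ _ _)) ⟩
      antidiag n (λ i j → ι (binom i j) * G i (suc j)) ∎

  -- Takes out the class of the colour `zero`, which may be empty. This form serves the induction on
  -- the number of colours in `Z-bounded`.
  Z-suc : ∀ n y → Z n (suc y) ≈ antidiag n (λ i j → ι (binom i j) * q ^ (i ℕ.* j) * Z j y)
  Z-suc n y = begin
    Z n (suc y)
      ≈⟨ Z≈T n (suc y) ⟩
    T {suc y} n (λ _ → 1#)
      ≈⟨ T-split n (λ _ → 1#) zero ⟩
    antidiag n (λ i j → ι (binom i j) * (1# ^ i * q ^ (i ℕ.* j) * T {y} j (λ _ → 1#)))
      ≈⟨ antidiag-cong n (λ i j _ → trans
           (*-congˡ (*-cong (trans (*-congʳ (1^n≈1 i)) (*-identityˡ _)) (sym (Z≈T j y)))) (sym (*-assoc _ _ _))) ⟩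
    antidiag n (λ i j → ι (binom i j) * q ^ (i ℕ.* j) * Z j y) ∎

  -- Takes out the class of the first vertex, of size `suc j`. By symmetry all `suc y` colours
  -- contribute equally, which is the factor `x` of the polynomial recursion.
  Z-suc-suc : ∀ n y → Z (suc n) (suc y) ≈ ι (suc y) * antidiag n (λ i j → ι (binom i j) * q ^ (i ℕ.* suc j) * Z i y)
  Z-suc-suc n y = begin
    Z (suc n) (suc y)
      ≈⟨ Z≈T (suc n) (suc y) ⟩
    sum {suc y} (λ c → 1# * T n (λ d → 1# * κ c d))
      ≈⟨ sum-cong-≋ {suc y} (λ c → trans (*-identityˡ _) (class c)) ⟩
    sum {suc y} (λ c → S)
      ≈⟨ trans (sym (∑-allFin (suc y) (λ _ → S))) (∑-allFin-const (suc y) S) ⟩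
    ι (suc y) * S ∎
    where
    S = antidiag n (λ i j → ι (binom i j) * q ^ (i ℕ.* suc j) * Z i y)
    regroup : ∀ b x y z → b * (x * (y * z)) ≈ b * (y * x) * z
    regroup = solve 4 (λ b x y z → b :* (x :* (y :* z)) := b :* (y :* x) :* z) refl
    class : ∀ c → T n (λ d → 1# * κ c d) ≈ S
    class c = begin
      T n (λ d → 1# * κ c d)
        ≈⟨ T-split n (λ d → 1# * κ c d) c ⟩
      antidiag n (λ i j → ι (binom i j) * ((1# * κ c c) ^ i * q ^ (i ℕ.* j) * T j (λ d → 1# * κ c (punchIn c d))))
        ≈⟨ antidiag-cong n (λ i j _ → trans (*-congˡ (*-cong
             (trans (*-congʳ (trans (^-congˡ i (trans (*-identityˡ _) (κ-refl c))) (1^n≈1 i))) (*-identityˡ _))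
             (trans (T-cong j (λ d → trans (*-identityˡ _) (trans (κ-≢ (punchInᵢ≢i c d ∘ ≡.sym)) (sym (*-identityʳ q)))))
               (trans (T-scale j q (λ _ → 1#)) (*-congˡ (sym (Z≈T j y)))))))
             (trans (regroup _ _ _ _) (*-congʳ (*-congˡ (trans (sym (^-homo-* q j (i ℕ.* j))) (reflexive (≡.cong (q ^_) (≡.trans (≡.cong (j ℕ.+_) (ℕₚ.*-comm i j)) (≡.sym (ℕₚ.*-suc j i))))))))) ) ⟩
      antidiag n (λ i j → ι (binom i j) * q ^ (j ℕ.* suc i) * Z j y)
        ≈⟨ antidiag-flip n _ ⟩
      antidiag n (λ i j → ι (binom j i) * q ^ (i ℕ.* suc j) * Z i y)
        ≈⟨ antidiag-cong n (λ i j _ → *-congʳ (*-congʳ (reflexive (≡.cong ι (binom-comm j i))))) ⟩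
      S ∎

-- Polynomials: from identities of values to identities of coefficients.

module Polynomials {c ℓ₁ ℓ₂} (ℝ : RealNumbers c ℓ₁ ℓ₂) where
  open OrderedField ℝ
  open Sums ℝ

  Polynomial : Set c
  Polynomial = List Carrier

  coeff : Polynomial → ℕ → Carrier
  coeff []      _       = 0#
  coeff (a ∷ P) zero    = a
  coeff (a ∷ P) (suc m) = coeff P m

  eval : Polynomial → Carrier → Carrier
  eval []      x = 0#
  eval (a ∷ P) x = a + x * eval P x

  infixl 6 _⊕_
  _⊕_ : Polynomial → Polynomial → Polynomial
  []      ⊕ Q       = Q
  (a ∷ P) ⊕ []      = a ∷ P
  (a ∷ P) ⊕ (b ∷ Q) = (a + b) ∷ (P ⊕ Q)

  infixr 7 _⊛_
  _⊛_ : Carrier → Polynomial → Polynomial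
  k ⊛ P = map (k *_) P

  coeff-⊕ : ∀ P Q m → coeff (P ⊕ Q) m ≈ coeff P m + coeff Q m
  coeff-⊕ []      Q       m       = sym (+-identityˡ _)
  coeff-⊕ (a ∷ P) []      m       = sym (+-identityʳ _)
  coeff-⊕ (a ∷ P) (b ∷ Q) zero    = refl
  coeff-⊕ (a ∷ P) (b ∷ Q) (suc m) = coeff-⊕ P Q m

  eval-⊕ : ∀ P Q x → eval (P ⊕ Q) x ≈ eval P x + eval Q x
  eval-⊕ []      Q       x = sym (+-identityˡ _)
  eval-⊕ (a ∷ P) []      x = sym (+-identityʳ _)
  eval-⊕ (a ∷ P) (b ∷ Q) x = trans (+-congˡ (*-congˡ (eval-⊕ P Q x)))
    (solve 5 (λ a b x y z → (a :+ b) :+ x :* (y :+ z) := (a :+ x :* y) :+ (b :+ x :* z)) refl a b x (eval P x) (eval Q x))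

  coeff-⊛ : ∀ k P m → coeff (k ⊛ P) m ≈ k * coeff P m
  coeff-⊛ k []      m       = sym (zeroʳ k)
  coeff-⊛ k (a ∷ P) zero    = refl
  coeff-⊛ k (a ∷ P) (suc m) = coeff-⊛ k P m

  eval-⊛ : ∀ k P x → eval (k ⊛ P) x ≈ k * eval P x
  eval-⊛ k []      x = sym (zeroʳ k)
  eval-⊛ k (a ∷ P) x = trans (+-congˡ (*-congˡ (eval-⊛ k P x)))
    (solve 4 (λ k a x y → k :* a :+ x :* (k :* y) := k :* (a :+ x :* y)) refl k a x (eval P x))

  eval-zero : ∀ P → (∀ m → coeff P m ≈ 0#) → ∀ x → eval P x ≈ 0#
  eval-zero []      P≈0 x = refl
  eval-zero (a ∷ P) P≈0 x = trans (+-cong (P≈0 0) (trans (*-congˡ (eval-zero P (P≈0 ∘ suc) x)) (zeroʳ x))) (+-identityˡ 0#)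

  -- The quotient of a ∷ P by x - r, which does not depend on a.
  quotient : Carrier → Polynomial → Polynomial
  quotient r []      = []
  quotient r (b ∷ P) = eval (b ∷ P) r ∷ quotient r P

  length-quotient : ∀ r P → length (quotient r P) ≡ length P
  length-quotient r []      = ≡.refl
  length-quotient r (b ∷ P) = ≡.cong suc (length-quotient r P)

  eval-quotient : ∀ a P r d → eval (a ∷ P) (r + d) ≈ eval (a ∷ P) r + d * eval (quotient r P) (r + d)
  eval-quotient a P r d = trans (+-congˡ (go P)) (sym (+-assoc _ _ _))
    where
    go : ∀ P → (r + d) * eval P (r + d) ≈ r * eval P r + d * eval (quotient r P) (r + d)
    go []      = solve 2 (λ r d → (r :+ d) :* con 0 := r :* con 0 :+ d :* con 0) refl r d
    go (b ∷ P) = trans (*-congˡ (+-congˡ (go P)))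
      (solve 5 (λ r d b e f → (r :+ d) :* (b :+ (r :* e :+ d :* f)) := r :* (b :+ r :* e) :+ d :* ((b :+ r :* e) :+ (r :+ d) :* f))
        refl r d b (eval P r) (eval (quotient r P) (r + d)))

  -- Horner's scheme is triangular with unit diagonal, so it can be undone from the leading
  -- coefficient down.
  quotient-zero : ∀ r P → (∀ m → coeff (quotient r P) m ≈ 0#) → ∀ m → coeff P m ≈ 0#
  quotient-zero r (b ∷ P) Q≈0 (suc m) = quotient-zero r P (Q≈0 ∘ suc) m
  quotient-zero r []      Q≈0 m       = refl
  quotient-zero r (b ∷ P) Q≈0 zero    = trans (sym (trans
    (+-congˡ (trans (*-congˡ (eval-zero P (quotient-zero r P (Q≈0 ∘ suc)) r)) (zeroʳ r))) (+-identityʳ b))) (Q≈0 0)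

  *-cancelˡ-0 : ∀ {x y} → 0# < x → x * y ≈ 0# → y ≈ 0#
  *-cancelˡ-0 {x} {y} 0<x xy≈0 with reciprocal 0<x
  ... | i , _ , xi≈1 = begin
    y             ≈⟨ sym (*-identityˡ y) ⟩
    1# * y        ≈⟨ *-congʳ (trans (sym xi≈1) (*-comm x i)) ⟩
    (i * x) * y   ≈⟨ *-assoc i x y ⟩
    i * (x * y)   ≈⟨ *-congˡ xy≈0 ⟩
    i * 0#        ≈⟨ zeroʳ i ⟩
    0#            ∎

  -- The root `ι N` is divided out; at the later points the factor `ι (suc z)` is positive and
  -- cancels, so no real number is tested for zero. The length is the measure because the quotient
  -- has the length of the tail.
  vanishing : ∀ P N → (∀ z → eval P (ι (N ℕ.+ z)) ≈ 0#) → ∀ m → coeff P m ≈ 0#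
  vanishing P = go (length P) P ≡.refl
    where
    go : ∀ k P → length P ≡ k → ∀ N → (∀ z → eval P (ι (N ℕ.+ z)) ≈ 0#) → ∀ m → coeff P m ≈ 0#
    go k       []      eq N P≈0 m = refl
    go (suc k) (a ∷ P) eq N P≈0   = λ
      { zero    → trans (sym (trans (+-congˡ (trans (*-congˡ (eval-zero P coeff-P _)) (zeroʳ _))) (+-identityʳ a))) root
      ; (suc m) → coeff-P m
      }
      where
      root : eval (a ∷ P) (ι N) ≈ 0#
      root = ≡.subst (λ n → eval (a ∷ P) (ι n) ≈ 0#) (ℕₚ.+-identityʳ N) (P≈0 0)
      Q = quotient (ι N) P
      eval-cong : ∀ P {x y} → x ≈ y → eval P x ≈ eval P y
      eval-cong []      x≈y = refl
      eval-cong (b ∷ P) x≈y = +-congˡ (*-cong x≈y (eval-cong P x≈y))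
      Q≈0 : ∀ z → eval Q (ι (suc N ℕ.+ z)) ≈ 0#
      Q≈0 z = *-cancelˡ-0 (0<ι {suc z} (ℕ.s≤s ℕ.z≤n)) (begin
        ι (suc z) * eval Q (ι (suc N ℕ.+ z))
          ≈⟨ *-congˡ (eval-cong Q N+z) ⟩
        ι (suc z) * eval Q (ι N + ι (suc z))
          ≈⟨ sym (+-identityˡ _) ⟩
        0# + ι (suc z) * eval Q (ι N + ι (suc z))
          ≈⟨ +-congʳ (sym root) ⟩
        eval (a ∷ P) (ι N) + ι (suc z) * eval Q (ι N + ι (suc z))
          ≈⟨ sym (eval-quotient a P (ι N) (ι (suc z))) ⟩
        eval (a ∷ P) (ι N + ι (suc z))
          ≈⟨ eval-cong (a ∷ P) (sym (ι-+ N (suc z))) ⟩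
        eval (a ∷ P) (ι (N ℕ.+ suc z))
          ≈⟨ P≈0 (suc z) ⟩
        0# ∎)
        where
        N+z : ι (suc N ℕ.+ z) ≈ ι N + ι (suc z)
        N+z = trans (reflexive (≡.cong ι (≡.sym (ℕₚ.+-suc N z)))) (ι-+ N (suc z))
      coeff-P : ∀ m → coeff P m ≈ 0#
      coeff-P = quotient-zero (ι N) P
        (go k Q (≡.trans (length-quotient (ι N) P) (ℕₚ.suc-injective eq)) (suc N) Q≈0)

  -- Couples values at natural numbers with coefficients, so that identities pass from the former to
  -- the latter without naming the polynomial.
  IsPolynomial : (e γ : ℕ → Carrier) → Set _
  IsPolynomial e γ = ∃[ P ] (∀ y → eval P (ι y) ≈ e y) × (∀ m → coeff P m ≈ γ m)

  isPolynomial-0 : IsPolynomial (λ _ → 0#) (λ _ → 0#)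
  isPolynomial-0 = [] , (λ _ → refl) , (λ _ → refl)

  isPolynomial-+ : ∀ {e γ e′ γ′} → IsPolynomial e γ → IsPolynomial e′ γ′ →
    IsPolynomial (λ y → e y + e′ y) (λ m → γ m + γ′ m)
  isPolynomial-+ (P , ev , co) (P′ , ev′ , co′) = P ⊕ P′ ,
    (λ y → trans (eval-⊕ P P′ (ι y)) (+-cong (ev y) (ev′ y))) ,
    (λ m → trans (coeff-⊕ P P′ m) (+-cong (co m) (co′ m)))

  isPolynomial-* : ∀ {e γ} k → IsPolynomial e γ → IsPolynomial (λ y → k * e y) (λ m → k * γ m)
  isPolynomial-* k (P , ev , co) = k ⊛ P ,
    (λ y → trans (eval-⊛ k P (ι y)) (*-congˡ (ev y))) ,
    (λ m → trans (coeff-⊛ k P m) (*-congˡ (co m)))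

  isPolynomial-∑ : ∀ {a} {A : Set a} (xs : List A) {e γ : A → ℕ → Carrier} → (∀ x → IsPolynomial (e x) (γ x)) →
    IsPolynomial (λ y → ∑ xs λ x → e x y) (λ m → ∑ xs λ x → γ x m)
  isPolynomial-∑ []       poly = isPolynomial-0
  isPolynomial-∑ (x ∷ xs) poly = isPolynomial-+ (poly x) (isPolynomial-∑ xs poly)

  isPolynomial-antidiag : ∀ n {e γ : ℕ → ℕ → ℕ → Carrier} → (∀ i j → IsPolynomial (e i j) (γ i j)) →
    IsPolynomial (λ y → antidiag n λ i j → e i j y) (λ m → antidiag n λ i j → γ i j m)
  isPolynomial-antidiag zero    poly = poly 0 0
  isPolynomial-antidiag (suc n) poly = isPolynomial-+ (poly 0 (suc n)) (isPolynomial-antidiag n (λ i j → poly (suc i) j))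

  timesLinear : ℕ → (ℕ → Carrier) → ℕ → Carrier
  timesLinear t γ zero    = - ι t * γ zero
  timesLinear t γ (suc m) = γ m + - ι t * γ (suc m)

  isPolynomial-timesLinear : ∀ t {e γ} → IsPolynomial e γ →
    IsPolynomial (λ y → (ι y - ι t) * e y) (timesLinear t γ)
  isPolynomial-timesLinear t {e} {γ} (P , ev , co) = (0# ∷ P) ⊕ (- ι t ⊛ P) ,
    (λ y → trans (eval-⊕ (0# ∷ P) (- ι t ⊛ P) (ι y)) (trans
      (+-cong (trans (+-identityˡ _) (*-congˡ (ev y))) (trans (eval-⊛ (- ι t) P (ι y)) (*-congˡ (ev y))))
      (sym (distribʳ (e y) (ι y) (- ι t))))) ,
    λ m → trans (coeff-⊕ (0# ∷ P) (- ι t ⊛ P) m) (trans (+-congˡ (trans (coeff-⊛ (- ι t) P m) (*-congˡ (co m)))) (shift m))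
    where
    shift : ∀ m → coeff (0# ∷ P) m + - ι t * γ m ≈ timesLinear t γ m
    shift zero    = +-identityˡ _
    shift (suc m) = +-congʳ (co m)

  -- The difference has infinitely many roots. The offset `N` is there because the values are
  -- compared only where `y - t` is again a number of colours.
  isPolynomial-unique : ∀ {e γ e′ γ′} N → IsPolynomial e γ → IsPolynomial e′ γ′ →
    (∀ z → e (N ℕ.+ z) ≈ e′ (N ℕ.+ z)) → ∀ m → γ m ≈ γ′ m
  isPolynomial-unique {e} {γ} {e′} {γ′} N poly poly′ e≈e′ m = x∙y⁻¹≈ε⇒x≈y (γ m) (γ′ m)
    (trans (+-congˡ (sym (-1*x≈-x (γ′ m)))) (trans (sym (co m)) (vanishing D N zeros m)))
    where
    difference = isPolynomial-+ poly (isPolynomial-* (- 1#) poly′)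
    D  = proj₁ difference
    ev = proj₁ (proj₂ difference)
    co = proj₂ (proj₂ difference)
    zeros : ∀ z → eval D (ι (N ℕ.+ z)) ≈ 0#
    zeros z = trans (ev (N ℕ.+ z)) (trans (+-cong (e≈e′ z) (-1*x≈-x _)) (-‿inverseʳ _))

  -- shifted t i m is the coefficient of x ^ m in x (x - 1) ⋯ (x - t + 1) (x - t) ^ i.
  shifted : ℕ → ℕ → ℕ → Carrier
  shifted zero    zero    zero    = 1#
  shifted zero    zero    (suc m) = 0#
  shifted (suc t) zero    m       = timesLinear t (shifted t zero) m
  shifted t       (suc i) m       = timesLinear t (shifted t i) m

  falling : ℕ → ℕ → Carrier
  falling zero    y = 1#
  falling (suc t) y = (ι y - ι t) * falling t y

  isPolynomial-shifted : ∀ t i → IsPolynomial (λ y → falling t y * (ι y - ι t) ^ i) (shifted t i)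
  isPolynomial-shifted zero zero = (1# ∷ []) ,
    (λ y → trans (+-congˡ (zeroʳ _)) (trans (+-identityʳ 1#) (sym (*-identityʳ 1#)))) ,
    λ { zero → refl ; (suc m) → refl }
  isPolynomial-shifted (suc t) zero with isPolynomial-timesLinear t (isPolynomial-shifted t zero)
  ... | P , ev , co = P , (λ y → trans (ev y) (sym (*-assoc _ _ _))) , co
  isPolynomial-shifted t (suc i) = isPoly t (isPolynomial-timesLinear t (isPolynomial-shifted t i))
    where
    -- Both cases are the same computation; splitting `t` lets `shifted t (suc i)` unfold.
    isPoly : ∀ t → IsPolynomial (λ y → (ι y - ι t) * (falling t y * (ι y - ι t) ^ i)) (timesLinear t (shifted t i)) →
      IsPolynomial (λ y → falling t y * (ι y - ι t) ^ suc i) (shifted t (suc i))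
    isPoly zero    (P , ev , co) = P , (λ y → trans (ev y) (swap _ _ _)) , co
      where swap = solve 3 (λ x y z → x :* (y :* z) := y :* (x :* z)) refl
    isPoly (suc t) (P , ev , co) = P , (λ y → trans (ev y) (swap _ _ _)) , co
      where swap = solve 3 (λ x y z → x :* (y :* z) := y :* (x :* z)) refl

  factorial : ℕ → Carrier
  factorial zero    = 1#
  factorial (suc t) = ι (suc t) * factorial t

  0≤factorial : ∀ t → 0# ≤ factorial t
  0≤factorial zero    = 0≤1
  0≤factorial (suc t) = 0≤* (0≤ι (suc t)) (0≤factorial t)

  abs-timesLinear : ∀ t {γ b} → 0# ≤ b → (∀ m → abs (γ m) ≤ b) → ∀ m → abs (timesLinear t γ m) ≤ ι (suc t) * b
  abs-timesLinear t {γ} {b} 0≤b le m = ≤-respʳ (sym (trans (distribʳ b 1# (ι t)) (+-congʳ (*-identityˡ b)))) (go m)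
    where
    term : ∀ m → abs (- ι t * γ m) ≤ ι t * b
    term m = abs-congˡ-≤ (-‿distribˡ-* _ _) (abs-neg (abs-* (0≤ι t) (le m)))
    go : ∀ m → abs (timesLinear t γ m) ≤ b + ι t * b
    go zero    = ≤-trans (term 0) (≤-respˡ (+-identityˡ _) (+-mono-≤ 0≤b ≤-refl))
    go (suc m) = abs-+ (le m) (term (suc m))

  -- By `abs-timesLinear` the factors `x`, ..., `x - t + 1` cost 1, ..., `t`, and each factor
  -- `x - t` costs `t + 1`.
  abs-shifted : ∀ t i m → abs (shifted t i m) ≤ factorial t * ι (suc t) ^ i
  abs-shifted zero    zero    zero    = nonneg⇒abs≤ 0≤1 (≤-reflexive (sym (*-identityʳ 1#)))
  abs-shifted zero    zero    (suc m) = abs-0 (0≤* 0≤1 0≤1)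
  abs-shifted (suc t) zero    m       = ≤-respʳ (sym (trans (*-identityʳ _) (*-congˡ (sym (*-identityʳ _)))))
    (abs-timesLinear t (0≤* (0≤factorial t) 0≤1) (abs-shifted t zero) m)
  abs-shifted zero    (suc i) m       = ≤-respʳ (solve 3 (λ x y z → x :* (y :* z) := y :* (x :* z)) refl _ _ _)
    (abs-timesLinear zero (0≤* (0≤factorial zero) (0≤^ i (0≤ι 1))) (abs-shifted zero i) m)
  abs-shifted (suc t) (suc i) m       = ≤-respʳ (solve 3 (λ x y z → x :* (y :* z) := y :* (x :* z)) refl _ _ _)
    (abs-timesLinear (suc t) (0≤* (0≤factorial (suc t)) (0≤^ i (0≤ι (suc (suc t))))) (abs-shifted (suc t) i) m)

-- Binomial coefficients: factorial identities and growth.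

private
  module S = +-*-Solver

binom-! : ∀ i j → binom i j ℕ.* (i ! ℕ.* j !) ≡ (i ℕ.+ j) !
binom-! zero    j       = ≡.trans (ℕₚ.+-identityʳ _) (ℕₚ.+-identityʳ (j !))
binom-! (suc i) zero    = ≡.trans (≡.cong (ℕ._* (suc i ! ℕ.* 1)) (binom-zeroʳ (suc i)))
  (≡.trans (ℕₚ.+-identityʳ _) (≡.trans (ℕₚ.*-identityʳ (suc i !)) (≡.cong _! (≡.sym (ℕₚ.+-identityʳ (suc i))))))
binom-! (suc i) (suc j) = begin
  binom (suc i) (suc j) ℕ.* (suc i ! ℕ.* suc j !)
    ≡⟨ ≡.cong (ℕ._* (suc i ! ℕ.* suc j !)) (binom-pascal i j) ⟩
  (binom i (suc j) ℕ.+ binom (suc i) j) ℕ.* ((suc i ℕ.* i !) ℕ.* (suc j ℕ.* j !))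
    ≡⟨ S.solve 6 (λ a b x y m n → (a S.:+ b) S.:* ((m S.:* x) S.:* (n S.:* y)) S.:=
         m S.:* (a S.:* (x S.:* (n S.:* y))) S.:+ n S.:* (b S.:* ((m S.:* x) S.:* y))) ≡.refl
         (binom i (suc j)) (binom (suc i) j) (i !) (j !) (suc i) (suc j) ⟩
  suc i ℕ.* (binom i (suc j) ℕ.* (i ! ℕ.* suc j !)) ℕ.+ suc j ℕ.* (binom (suc i) j ℕ.* (suc i ! ℕ.* j !))
    ≡⟨ ≡.cong₂ (λ a b → suc i ℕ.* a ℕ.+ suc j ℕ.* b) (binom-! i (suc j)) (binom-! (suc i) j) ⟩
  suc i ℕ.* (i ℕ.+ suc j) ! ℕ.+ suc j ℕ.* (suc i ℕ.+ j) !
    ≡⟨ ≡.cong (λ n → suc i ℕ.* (i ℕ.+ suc j) ! ℕ.+ suc j ℕ.* n !) (≡.sym (ℕₚ.+-suc i j)) ⟩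
  suc i ℕ.* (i ℕ.+ suc j) ! ℕ.+ suc j ℕ.* (i ℕ.+ suc j) !
    ≡⟨ ≡.sym (ℕₚ.*-distribʳ-+ ((i ℕ.+ suc j) !) (suc i) (suc j)) ⟩
  (suc i ℕ.+ suc j) ! ∎
  where open ≡.≡-Reasoning

private
  cancel-! : ∀ i j {m n} → m ℕ.* (i ! ℕ.* j !) ≡ n ℕ.* (i ! ℕ.* j !) → m ≡ n
  cancel-! i j {m} {n} = ℕₚ.*-cancelʳ-≡ m n (i ! ℕ.* j !) {{ℕₚ.m*n≢0 (i !) (j !) {{i ℕₚ.!≢0}} {{j ℕₚ.!≢0}}}}

binom-absorb : ∀ i j → suc i ℕ.* binom (suc i) j ≡ suc (i ℕ.+ j) ℕ.* binom i j
binom-absorb i j = cancel-! i j (begin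
  suc i ℕ.* binom (suc i) j ℕ.* (i ! ℕ.* j !)
    ≡⟨ S.solve 4 (λ m b x y → m S.:* b S.:* (x S.:* y) S.:= b S.:* (m S.:* x S.:* y)) ≡.refl (suc i) (binom (suc i) j) (i !) (j !) ⟩
  binom (suc i) j ℕ.* (suc i ! ℕ.* j !)
    ≡⟨ binom-! (suc i) j ⟩
  suc (i ℕ.+ j) ℕ.* (i ℕ.+ j) !
    ≡⟨ ≡.cong (suc (i ℕ.+ j) ℕ.*_) (≡.sym (binom-! i j)) ⟩
  suc (i ℕ.+ j) ℕ.* (binom i j ℕ.* (i ! ℕ.* j !))
    ≡⟨ ≡.sym (ℕₚ.*-assoc (suc (i ℕ.+ j)) (binom i j) (i ! ℕ.* j !)) ⟩
  suc (i ℕ.+ j) ℕ.* binom i j ℕ.* (i ! ℕ.* j !) ∎)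
  where open ≡.≡-Reasoning

binom-sucˡ-≤ : ∀ i j → binom (suc i) j ℕ.≤ suc (i ℕ.+ j) ℕ.* binom i j
binom-sucˡ-≤ i j = ℕₚ.≤-trans (ℕₚ.m≤n*m _ (suc i)) (ℕₚ.≤-reflexive (binom-absorb i j))

binom-sucʳ-≤ : ∀ i j → binom i (suc j) ℕ.≤ suc (i ℕ.+ j) ℕ.* binom i j
binom-sucʳ-≤ i j = ≡.subst₂ ℕ._≤_ (binom-comm (suc j) i)
  (≡.cong₂ (λ m b → suc m ℕ.* b) (ℕₚ.+-comm j i) (binom-comm j i)) (binom-sucˡ-≤ j i)

1≤binom : ∀ i j → 1 ℕ.≤ binom i j
1≤binom zero    j       = s≤s z≤n
1≤binom (suc i) zero    = ℕₚ.≤-reflexive (≡.sym (binom-zeroʳ (suc i)))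
1≤binom (suc i) (suc j) = ≡.subst (1 ℕ.≤_) (≡.sym (binom-pascal i j)) (ℕₚ.m≤n⇒m≤n+o _ (1≤binom i (suc j)))

-- Two ways to compute the trinomial coefficient `(i + j + d)! / (i! j! d!)`. In `doubleTerm` it
-- merges two successive choices of vertices.
binom-trinomial : ∀ i j d → binom j (i ℕ.+ d) ℕ.* binom i d ≡ binom (i ℕ.+ j) d ℕ.* binom i j
binom-trinomial i j d = cancel-! i j (ℕₚ.*-cancelʳ-≡ _ _ (d !) {{d ℕₚ.!≢0}} (begin
  binom j (i ℕ.+ d) ℕ.* binom i d ℕ.* (i ! ℕ.* j !) ℕ.* d !
    ≡⟨ S.solve 5 (λ b c x y z → b S.:* c S.:* (x S.:* y) S.:* z S.:= b S.:* (y S.:* (c S.:* (x S.:* z)))) ≡.refl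
         (binom j (i ℕ.+ d)) (binom i d) (i !) (j !) (d !) ⟩
  binom j (i ℕ.+ d) ℕ.* (j ! ℕ.* (binom i d ℕ.* (i ! ℕ.* d !)))
    ≡⟨ ≡.cong (λ n → binom j (i ℕ.+ d) ℕ.* (j ! ℕ.* n)) (binom-! i d) ⟩
  binom j (i ℕ.+ d) ℕ.* (j ! ℕ.* (i ℕ.+ d) !)
    ≡⟨ binom-! j (i ℕ.+ d) ⟩
  (j ℕ.+ (i ℕ.+ d)) !
    ≡⟨ ≡.cong _! (S.solve 3 (λ i j d → j S.:+ (i S.:+ d) S.:= i S.:+ j S.:+ d) ≡.refl i j d) ⟩
  (i ℕ.+ j ℕ.+ d) !
    ≡⟨ ≡.sym (binom-! (i ℕ.+ j) d) ⟩
  binom (i ℕ.+ j) d ℕ.* ((i ℕ.+ j) ! ℕ.* d !)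
    ≡⟨ ≡.cong (λ n → binom (i ℕ.+ j) d ℕ.* (n ℕ.* d !)) (≡.sym (binom-! i j)) ⟩
  binom (i ℕ.+ j) d ℕ.* (binom i j ℕ.* (i ! ℕ.* j !) ℕ.* d !)
    ≡⟨ S.solve 4 (λ b c x z → b S.:* (c S.:* x S.:* z) S.:= b S.:* c S.:* x S.:* z) ≡.refl
         (binom (i ℕ.+ j) d) (binom i j) (i ! ℕ.* j !) (d !) ⟩
  binom (i ℕ.+ j) d ℕ.* binom i j ℕ.* (i ! ℕ.* j !) ℕ.* d ! ∎))
  where open ≡.≡-Reasoning

-- Each unit added to one of the indices costs at most a factor equal to the new total, which never
-- exceeds `n`.
binom-growth : ∀ r s i j {n} → (r ℕ.+ i) ℕ.+ (s ℕ.+ j) ℕ.≤ n →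
  binom (r ℕ.+ i) (s ℕ.+ j) ℕ.≤ n ℕ.^ (r ℕ.+ s) ℕ.* binom i j
binom-growth zero    zero    i j {n} le = ℕₚ.≤-reflexive (≡.sym (ℕₚ.+-identityʳ _))
binom-growth zero    (suc s) i j {n} le = begin
  binom i (suc (s ℕ.+ j))                         ≤⟨ binom-sucʳ-≤ i (s ℕ.+ j) ⟩
  suc (i ℕ.+ (s ℕ.+ j)) ℕ.* binom i (s ℕ.+ j)     ≤⟨ ℕₚ.*-mono-≤ le′ (binom-growth zero s i j (ℕₚ.<⇒≤ le′)) ⟩
  n ℕ.* (n ℕ.^ s ℕ.* binom i j)                   ≡⟨ ≡.sym (ℕₚ.*-assoc n _ _) ⟩
  n ℕ.^ suc s ℕ.* binom i j                       ∎
  where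
  open ℕₚ.≤-Reasoning
  le′ : suc (i ℕ.+ (s ℕ.+ j)) ℕ.≤ n
  le′ = ≡.subst (ℕ._≤ n) (ℕₚ.+-suc i (s ℕ.+ j)) le
binom-growth (suc r) s       i j {n} le = begin
  binom (suc (r ℕ.+ i)) (s ℕ.+ j)                           ≤⟨ binom-sucˡ-≤ (r ℕ.+ i) (s ℕ.+ j) ⟩
  suc ((r ℕ.+ i) ℕ.+ (s ℕ.+ j)) ℕ.* binom (r ℕ.+ i) (s ℕ.+ j)
    ≤⟨ ℕₚ.*-mono-≤ le (binom-growth r s i j (ℕₚ.<⇒≤ le)) ⟩
  n ℕ.* (n ℕ.^ (r ℕ.+ s) ℕ.* binom i j)                     ≡⟨ ≡.sym (ℕₚ.*-assoc n _ _) ⟩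
  n ℕ.^ suc (r ℕ.+ s) ℕ.* binom i j                         ∎
  where open ℕₚ.≤-Reasoning

binom≤^ : ∀ i j → binom i j ℕ.≤ (i ℕ.+ j) ℕ.^ i
binom≤^ i j = ≡.subst₂ ℕ._≤_
  (≡.cong (λ m → binom m j) (ℕₚ.+-identityʳ i))
  (≡.trans (ℕₚ.*-identityʳ _) (≡.cong ((i ℕ.+ j) ℕ.^_) (ℕₚ.+-identityʳ i)))
  (binom-growth i 0 0 j (ℕₚ.≤-reflexive (≡.cong (ℕ._+ j) (ℕₚ.+-identityʳ i))))

-- The right side is the product `(n + 1) ⋯ (n + s)`.
^≤!*binom : ∀ n s → suc n ℕ.^ s ℕ.≤ s ! ℕ.* binom s n
^≤!*binom n zero    = s≤s z≤n
^≤!*binom n (suc s) = begin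
  suc n ℕ.* suc n ℕ.^ s                       ≤⟨ ℕₚ.*-mono-≤ (s≤s (ℕₚ.m≤n+m n s)) (^≤!*binom n s) ⟩
  suc (s ℕ.+ n) ℕ.* (s ! ℕ.* binom s n)       ≡⟨ S.solve 3 (λ x y z → x S.:* (y S.:* z) S.:= y S.:* (x S.:* z)) ≡.refl (suc (s ℕ.+ n)) (s !) (binom s n) ⟩
  s ! ℕ.* (suc (s ℕ.+ n) ℕ.* binom s n)       ≡⟨ ≡.cong (s ! ℕ.*_) (≡.sym (binom-absorb s n)) ⟩
  s ! ℕ.* (suc s ℕ.* binom (suc s) n)         ≡⟨ S.solve 3 (λ x y z → y S.:* (x S.:* z) S.:= x S.:* y S.:* z) ≡.refl (suc s) (s !) (binom (suc s) n) ⟩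
  suc s ! ℕ.* binom (suc s) n                 ∎
  where open ℕₚ.≤-Reasoning

-- Exponential decay and uniform bounds for binomial sums.

module Estimates {c ℓ₁ ℓ₂} (ℝ : RealNumbers c ℓ₁ ℓ₂) where
  open OrderedField ℝ
  open Sums ℝ

  antidiag-binomial : ∀ n x → antidiag n (λ i j → ι (binom i j) * x ^ i) ≈ (1# + x) ^ n
  antidiag-binomial zero    x = trans (*-identityʳ _) ι1≈1
  antidiag-binomial (suc n) x = begin
    antidiag (suc n) (λ i j → ι (binom i j) * x ^ i)
      ≈⟨ antidiag-pascal n (λ i j → x ^ i) ⟩
    antidiag n (λ i j → ι (binom i j) * (x * x ^ i + x ^ i))
      ≈⟨ antidiag-cong n (λ i j _ → regroup (ι (binom i j)) x (x ^ i)) ⟩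
    antidiag n (λ i j → (1# + x) * (ι (binom i j) * x ^ i))
      ≈⟨ antidiag-*ˡ n (1# + x) (λ i j → ι (binom i j) * x ^ i) ⟩
    (1# + x) * antidiag n (λ i j → ι (binom i j) * x ^ i)
      ≈⟨ *-congˡ (antidiag-binomial n x) ⟩
    (1# + x) ^ suc n ∎
    where
    regroup : ∀ b x y → b * (x * y + y) ≈ (1# + x) * (b * y)
    regroup = solve 3 (λ b x y → b :* (x :* y :+ y) := (con 1 :+ x) :* (b :* y)) refl

  -- A converse of Bernoulli's inequality. The step adds `x` and the product `x * (2 n x)`, which
  -- the hypothesis bounds by another `x`; hence the factor 2.
  bernoulli-upper : ∀ n {x} → 0# ≤ x → ι (2 ℕ.* n) * x ≤ 1# → (1# + x) ^ n ≤ 1# + ι (2 ℕ.* n) * x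
  bernoulli-upper zero    {x} 0≤x le = ≤-reflexive (sym (trans (+-congˡ (zeroˡ x)) (+-identityʳ 1#)))
  bernoulli-upper (suc n) {x} 0≤x le = ≤-trans
    (*-monoˡ-≤ (0≤+ 0≤1 0≤x) (bernoulli-upper n 0≤x small))
    (≤-respˡ (sym expand) (≤-respʳ (sym target) (+-mono-≤ ≤-refl (≤-respʳ (*-identityʳ x) (*-monoˡ-≤ 0≤x small)))))
    where
    k = ι (2 ℕ.* n)
    small : k * x ≤ 1#
    small = ≤-trans (*-monoʳ-≤ 0≤x (ι-mono-≤ (ℕₚ.*-monoʳ-≤ 2 (ℕₚ.n≤1+n n)))) le
    expand : (1# + x) * (1# + k * x) ≈ (1# + k * x + x) + x * (k * x)
    expand = trans (distribʳ (1# + k * x) 1# x) (trans (+-cong (*-identityˡ _) (trans (distribˡ x 1# (k * x)) (+-congʳ (*-identityʳ x)))) (sym (+-assoc _ _ _)))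
    target : 1# + ι (2 ℕ.* suc n) * x ≈ (1# + k * x + x) + x
    target = trans (+-congˡ (trans (*-congʳ (trans (reflexive (≡.cong ι (ℕₚ.*-suc 2 n))) (trans (ι-+ 2 (2 ℕ.* n)) (+-congʳ (+-congˡ ι1≈1)))))
      (trans (distribʳ x (1# + 1#) k) (+-congʳ (trans (distribʳ x 1# 1#) (+-cong (*-identityˡ x) (*-identityˡ x)))))))
      (solve 3 (λ o x y → o :+ ((x :+ x) :+ y) := (o :+ y :+ x) :+ x) refl 1# x (k * x))

  module Base (p : Carrier) (0<p : 0# < p) (p<1 : p < 1#) where
    open Colourings.Model ℝ p using (q; q+p≈1)

    0<q : 0# < q
    0<q = x<y⇒0<y-x p<1

    0≤q : 0# ≤ q
    0≤q = <⇒≤ 0<q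

    q≤1 : q ≤ 1#
    q≤1 = ≤-respˡ (+-identityʳ q) (≤-respʳ q+p≈1 (+-mono-≤ ≤-refl (<⇒≤ 0<p)))

    u : Carrier
    u = recipDiff p<1

    q*u≈1 : q * u ≈ 1#
    q*u≈1 = proj₂ (proj₂ (#⇒invertible (Equivalence.from #⇔< (inj₂ p<1))))

    ρ : Carrier
    ρ = p * u

    u≈1+ρ : u ≈ 1# + ρ
    u≈1+ρ = trans (sym (*-identityˡ u)) (trans (*-congʳ (sym q+p≈1)) (trans (distribʳ u q p) (+-congʳ q*u≈1)))

    0<u : 0# < u
    0<u = positive (reciprocal 0<q)
      where
      positive : ∃[ i ] (0# < i × q * i ≈ 1#) → 0# < u
      positive (i , 0<i , qi≈1) = <-respʳ (begin
        i             ≈⟨ sym (*-identityʳ i) ⟩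
        i * 1#        ≈⟨ *-congˡ (sym q*u≈1) ⟩
        i * (q * u)   ≈⟨ sym (*-assoc i q u) ⟩
        (i * q) * u   ≈⟨ *-congʳ (trans (*-comm i q) qi≈1) ⟩
        1# * u        ≈⟨ *-identityˡ u ⟩
        u             ∎) 0<i

    0≤u : 0# ≤ u
    0≤u = <⇒≤ 0<u

    0<ρ : 0# < ρ
    0<ρ = *-positive 0<p 0<u

    1≤u : 1# ≤ u
    1≤u = ≤-respˡ (+-identityʳ 1#) (≤-respʳ (sym u≈1+ρ) (+-mono-≤ ≤-refl (<⇒≤ 0<ρ)))

    0≤q^ : ∀ n → 0# ≤ q ^ n
    0≤q^ n = 0≤^ n 0≤q

    q^n*u^n≈1 : ∀ n → q ^ n * u ^ n ≈ 1#
    q^n*u^n≈1 n = trans (sym (^-distrib-* q u n)) (trans (^-congˡ n q*u≈1) (1^n≈1 n))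

    private
      binom*ρ^≤u^ : ∀ s n → ι (binom s n) * ρ ^ s ≤ u ^ (s ℕ.+ n)
      binom*ρ^≤u^ zero    n       = ≤-respˡ (sym (trans (*-identityʳ _) ι1≈1)) (1≤^ n 1≤u)
      binom*ρ^≤u^ (suc s) zero    = ≤-respˡ (sym (trans (*-congʳ (trans (reflexive (≡.cong ι (binom-zeroʳ (suc s)))) ι1≈1)) (*-identityˡ _)))
        (≤-respʳ (reflexive (≡.cong (u ^_) (≡.sym (ℕₚ.+-identityʳ (suc s)))))
          (^-monoˡ-≤ (suc s) (<⇒≤ 0<ρ) (≤-respˡ (+-identityˡ ρ) (≤-respʳ (sym u≈1+ρ) (+-mono-≤ 0≤1 ≤-refl)))))
      binom*ρ^≤u^ (suc s) (suc n) = ≤-respˡ (sym lhs) (≤-respʳ rhs (+-mono-≤ (*-monoˡ-≤ (<⇒≤ 0<ρ) (binom*ρ^≤u^ s (suc n))) (binom*ρ^≤u^ (suc s) n)))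
        where
        lhs : ι (binom (suc s) (suc n)) * ρ ^ suc s ≈ ρ * (ι (binom s (suc n)) * ρ ^ s) + ι (binom (suc s) n) * ρ ^ suc s
        lhs = trans (*-congʳ (trans (reflexive (≡.cong ι (binom-pascal s n))) (ι-+ (binom s (suc n)) (binom (suc s) n))))
          (solve 4 (λ a b r x → (a :+ b) :* (r :* x) := r :* (a :* x) :+ b :* (r :* x)) refl _ _ ρ (ρ ^ s))
        rhs : ρ * u ^ (s ℕ.+ suc n) + u ^ (suc s ℕ.+ n) ≈ u ^ suc (s ℕ.+ suc n)
        rhs = trans (+-congˡ (trans (reflexive (≡.cong (u ^_) (≡.sym (ℕₚ.+-suc s n)))) (sym (*-identityˡ _))))
          (trans (+-comm _ _) (trans (sym (distribʳ _ 1# ρ)) (*-congʳ (sym u≈1+ρ))))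

    -- Since `u = 1 / q` equals `1 + ρ`, one binomial term `binom s n * ρ ^ s` is at most
    -- `u ^ (s + n)`, and `s! * binom s n` is at least `(n + 1) ^ s`. Solving for the product gives
    -- `K = s! * u ^ s / ρ ^ s`.
    decay : ∀ s → ∃[ K ] 0# ≤ K × ∀ n → ι (suc n) ^ s * q ^ n ≤ K
    decay s = K , 0≤K , bound
      where
      i = proj₁ (reciprocal 0<ρ)
      0≤i = <⇒≤ (proj₁ (proj₂ (reciprocal 0<ρ)))
      ρi≈1 = proj₂ (proj₂ (reciprocal 0<ρ))
      m = ι (s !)
      K = m * u ^ s * i ^ s
      0≤K : 0# ≤ K
      0≤K = 0≤* (0≤* (0≤ι (s !)) (0≤^ s 0≤u)) (0≤^ s 0≤i)
      step : ∀ n → ι (suc n) ^ s * ρ ^ s ≤ m * u ^ (s ℕ.+ n)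
      step n = ≤-trans (*-monoʳ-≤ (0≤^ s (<⇒≤ 0<ρ)) (≤-respˡ (ι-^ (suc n) s) (≤-respʳ (ι-* (s !) (binom s n)) (ι-mono-≤ (^≤!*binom n s)))))
        (≤-respˡ (sym (*-assoc m (ι (binom s n)) (ρ ^ s))) (*-monoˡ-≤ (0≤ι (s !)) (binom*ρ^≤u^ s n)))
      lhs : ∀ n → ι (suc n) ^ s * ρ ^ s * (q ^ n * i ^ s) ≈ ι (suc n) ^ s * q ^ n
      lhs n = trans (solve 4 (λ a r b c → a :* r :* (b :* c) := a :* b :* (r :* c)) refl (ι (suc n) ^ s) (ρ ^ s) (q ^ n) (i ^ s))
        (trans (*-congˡ (trans (sym (^-distrib-* ρ i s)) (trans (^-congˡ s ρi≈1) (1^n≈1 s)))) (*-identityʳ (ι (suc n) ^ s * q ^ n)))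
      rhs : ∀ n → m * u ^ (s ℕ.+ n) * (q ^ n * i ^ s) ≈ K
      rhs n = trans (*-congʳ (*-congˡ (^-homo-* u s n)))
        (trans (solve 5 (λ a b c d e → a :* (b :* c) :* (d :* e) := a :* b :* e :* (d :* c)) refl m (u ^ s) (u ^ n) (q ^ n) (i ^ s))
          (trans (*-congˡ (q^n*u^n≈1 n)) (*-identityʳ K)))
      bound : ∀ n → ι (suc n) ^ s * q ^ n ≤ K
      bound n = ≤-respˡ (lhs n) (≤-respʳ (rhs n) (*-monoʳ-≤ (0≤* (0≤q^ n) (0≤^ s 0≤i)) (step n)))

    -- One of two powers is given away: `decay 2` bounds `(n + 1) ^ 2 * q ^ n` by `K`, and `n + 1`
    -- exceeds `K / e` eventually.
    vanish : ∀ e → 0# < e → ∃[ N ] ∀ n → N ℕ.≤ n → ι (suc n) * q ^ n ≤ e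
    vanish e 0<e = N , bound
      where
      K = proj₁ (decay 2)
      i = proj₁ (reciprocal 0<e)
      N = proj₁ (archimedean (K * i))
      i*e≈1 : i * e ≈ 1#
      i*e≈1 = trans (*-comm i e) (proj₂ (proj₂ (reciprocal 0<e)))
      K≤N*e : K ≤ ι N * e
      K≤N*e = ≤-respˡ (trans (*-assoc K i e) (trans (*-congˡ i*e≈1) (*-identityʳ K)))
        (*-monoʳ-≤ (<⇒≤ 0<e) (<⇒≤ (proj₂ (archimedean (K * i)))))
      square : ∀ n → ι (suc n) * (ι (suc n) * q ^ n) ≤ K
      square n = ≤-respˡ (trans (*-congʳ (*-congˡ (*-identityʳ (ι (suc n))))) (*-assoc (ι (suc n)) (ι (suc n)) (q ^ n)))
        (proj₂ (proj₂ (decay 2)) n)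
      bound : ∀ n → N ℕ.≤ n → ι (suc n) * q ^ n ≤ e
      bound n N≤n = *-cancelˡ-≤ (0<ι {suc n} (s≤s z≤n)) (≤-trans (square n) (≤-trans K≤N*e
        (*-monoʳ-≤ (<⇒≤ 0<e) (ι-mono-≤ (ℕₚ.m≤n⇒m≤1+n N≤n)))))

    private
      h≤i⊎h≤j : ∀ {i j n} → i ℕ.+ j ≡ n → ⌊ n /2⌋ ℕ.≤ i ⊎ ⌊ n /2⌋ ℕ.≤ j
      h≤i⊎h≤j {i} {j} {n} eq with ℕₚ.≤-<-connex ⌊ n /2⌋ i | ℕₚ.≤-<-connex ⌊ n /2⌋ j
      ... | inj₁ h≤i | _        = inj₁ h≤i
      ... | inj₂ _   | inj₁ h≤j = inj₂ h≤j
      ... | inj₂ i<h | inj₂ j<h = contradiction (ℕₚ.+-mono-<-≤ i<h (ℕₚ.≤-trans (ℕₚ.<⇒≤ j<h) (ℕₚ.⌊n/2⌋≤⌈n/2⌉ n)))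
                                    (ℕₚ.≤⇒≯ (ℕₚ.≤-reflexive (≡.trans (ℕₚ.⌊n/2⌋+⌈n/2⌉≡n n) (≡.sym eq))))

      n≤1+2h : ∀ n → n ℕ.≤ suc (⌊ n /2⌋ ℕ.+ ⌊ n /2⌋)
      n≤1+2h zero          = z≤n
      n≤1+2h (suc zero)    = s≤s z≤n
      n≤1+2h (suc (suc n)) = s≤s (ℕₚ.≤-trans (s≤s (n≤1+2h n)) (ℕₚ.≤-reflexive (≡.cong suc (≡.sym (ℕₚ.+-suc _ _)))))

      1≤2 : 1# ≤ 1# + 1#
      1≤2 = ≤-respˡ (+-identityʳ 1#) (+-mono-≤ ≤-refl 0≤1)

      0≤2 : 0# ≤ 1# + 1#
      0≤2 = 0≤+ 0≤1 0≤1

      0≤q^h : ∀ n → 0# ≤ q ^ ⌊ n /2⌋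
      0≤q^h n = 0≤q^ ⌊ n /2⌋

      bounded-above : ∀ n → ι (2 ℕ.* n) * q ^ ⌊ n /2⌋ ≤ 1# → (1# + q ^ ⌊ n /2⌋) ^ n ≤ 1# + 1#
      bounded-above n nx≤1 = ≤-trans (bernoulli-upper n (0≤q^h n) nx≤1) (+-mono-≤ ≤-refl nx≤1)

      bounded-below : ∀ n H → ⌊ n /2⌋ ℕ.≤ H → (1# + q ^ ⌊ n /2⌋) ^ n ≤ (1# + 1#) ^ suc (H ℕ.+ H)
      bounded-below n H h≤H = ≤-trans
        (^-monoˡ-≤ n (0≤+ 0≤1 (0≤q^h n)) (+-mono-≤ ≤-refl (^≤1 ⌊ n /2⌋ 0≤q q≤1)))
        (^-monoʳ-≤ 1≤2 (ℕₚ.≤-trans (n≤1+2h n) (s≤s (ℕₚ.+-mono-≤ h≤H h≤H))))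

      n-small : ∀ n → 2 ℕ.* n ℕ.≤ 4 ℕ.* suc ⌊ n /2⌋
      n-small n = ℕₚ.≤-trans (ℕₚ.*-monoʳ-≤ 2 (ℕₚ.m≤n⇒m≤1+n (n≤1+2h n)))
        (ℕₚ.≤-reflexive (S.solve 1 (λ h → S.con 2 S.:* (S.con 2 S.:+ (h S.:+ h)) S.:= S.con 4 S.:* (S.con 1 S.:+ h)) ≡.refl ⌊ n /2⌋))

      nx-small : ∀ e → ι 4 * e ≈ 1# → ∀ n → ι (suc ⌊ n /2⌋) * q ^ ⌊ n /2⌋ ≤ e → ι (2 ℕ.* n) * q ^ ⌊ n /2⌋ ≤ 1#
      nx-small e four*e≈1 n le = ≤-trans (*-monoʳ-≤ (0≤q^h n) (ι-mono-≤ (n-small n)))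
        (≤-respˡ (trans (sym (*-assoc (ι 4) (ι (suc ⌊ n /2⌋)) (q ^ ⌊ n /2⌋))) (*-congʳ (sym (ι-* 4 (suc ⌊ n /2⌋)))))
          (≤-respʳ four*e≈1 (*-monoˡ-≤ (0≤ι 4) le)))

      power-bounded-from : ∀ e H → ι 4 * e ≈ 1# → (∀ n → H ℕ.≤ n → ι (suc n) * q ^ n ≤ e) →
        ∀ n → (1# + q ^ ⌊ n /2⌋) ^ n ≤ (1# + 1#) + (1# + 1#) ^ suc (H ℕ.+ H)
      power-bounded-from e H four*e≈1 small n with ℕₚ.≤-total H ⌊ n /2⌋
      ... | inj₁ H≤h = ≤-respˡ (+-identityʳ _)
              (+-mono-≤ (bounded-above n (nx-small e four*e≈1 n (small ⌊ n /2⌋ H≤h))) (0≤^ (suc (H ℕ.+ H)) 0≤2))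
      ... | inj₂ h≤H = ≤-respˡ (+-identityˡ _) (+-mono-≤ 0≤2 (bounded-below n H h≤H))

      power-bounded : ∃[ B ] 0# ≤ B × ∀ n → (1# + q ^ ⌊ n /2⌋) ^ n ≤ B
      power-bounded = (1# + 1#) + (1# + 1#) ^ suc (H ℕ.+ H) , 0≤+ 0≤2 (0≤^ (suc (H ℕ.+ H)) 0≤2) ,
        power-bounded-from e H (proj₂ (proj₂ quarter)) (proj₂ (vanish e (proj₁ (proj₂ quarter))))
        where
        -- With `h = ⌊ n /2⌋` one has `2 n ≤ 4 (h + 1)`, so `(h + 1) * q ^ h ≤ 1 / 4` gives the
        -- hypothesis of `bernoulli-upper`. The remaining `h ≤ H` leave only bounded `n`.
        quarter = reciprocal (0<ι {4} (s≤s z≤n))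
        e = proj₁ quarter
        H = proj₁ (vanish e (proj₁ (proj₂ quarter)))

    -- One of `i` and `j` is at least `h = ⌊ n /2⌋`, hence `q ^ (i j)` is at most
    -- `q ^ (h i) + q ^ (h j)`. The binomial theorem sums each part to `(1 + q ^ h) ^ n`, which is
    -- bounded because `n * q ^ h` tends to 0.
    antidiag-q^ij-bounded : ∃[ L ] 0# ≤ L × ∀ n → antidiag n (λ i j → ι (binom i j) * q ^ (i ℕ.* j)) ≤ L
    antidiag-q^ij-bounded = B + B , 0≤+ 0≤B 0≤B , λ n → ≤-trans (split n) (+-mono-≤ (bound n) (bound n))
      where
      B = proj₁ power-bounded
      0≤B : 0# ≤ B
      0≤B = proj₁ (proj₂ power-bounded)
      bound : ∀ n → (1# + q ^ ⌊ n /2⌋) ^ n ≤ B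
      bound = proj₂ (proj₂ power-bounded)
      split : ∀ n → antidiag n (λ i j → ι (binom i j) * q ^ (i ℕ.* j)) ≤ (1# + q ^ ⌊ n /2⌋) ^ n + (1# + q ^ ⌊ n /2⌋) ^ n
      split n = ≤-trans (antidiag-mono-≤ n (λ i j eq → ≤-respʳ (distribˡ _ _ _) (*-monoˡ-≤ (0≤ι (binom i j)) (term i j eq))))
        (≤-reflexive (trans (antidiag-+ n (λ i j → ι (binom i j) * x ^ i) (λ i j → ι (binom i j) * x ^ j)) (+-cong (antidiag-binomial n x)
          (trans (antidiag-flip n _) (trans (antidiag-cong n (λ i j _ → *-congʳ (reflexive (≡.cong ι (binom-comm j i))))) (antidiag-binomial n x))))))
        where
        h = ⌊ n /2⌋
        x = q ^ h
        weaken : ∀ i j → h ℕ.≤ j → q ^ (i ℕ.* j) ≤ x ^ i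
        weaken i j h≤j = ≤-respʳ (sym (^-assocʳ q h i))
          (^-antiʳ-≤ 0≤q q≤1 (ℕₚ.≤-trans (ℕₚ.≤-reflexive (ℕₚ.*-comm h i)) (ℕₚ.*-monoʳ-≤ i h≤j)))
        term : ∀ i j → i ℕ.+ j ≡ n → q ^ (i ℕ.* j) ≤ x ^ i + x ^ j
        term i j eq with h≤i⊎h≤j {i} {j} eq
        ... | inj₂ h≤j = ≤-respˡ (+-identityʳ _) (+-mono-≤ (weaken i j h≤j) (0≤^ j (0≤q^h n)))
        ... | inj₁ h≤i = ≤-respˡ (trans (+-identityˡ _) (reflexive (≡.cong (q ^_) (ℕₚ.*-comm j i))))
                           (+-mono-≤ (0≤^ i (0≤q^h n)) (weaken j i h≤i))

C≡binom : ∀ {n k} → k ℕ.≤ n → n C k ≡ binom k (n ∸ k)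
C≡binom {n} {k} k≤n = ≡.cong (_C k) (≡.sym (ℕₚ.m+[n∸m]≡n k≤n))

C-upper≡binom : ∀ {n k} → k ℕ.≤ n → n C k ≡ binom (n ∸ k) k
C-upper≡binom {n} {k} k≤n = ≡.trans (C≡binom k≤n) (binom-comm k (n ∸ k))

C≤^ : ∀ {n k} → k ℕ.≤ n → n C k ℕ.≤ suc n ℕ.^ k
C≤^ {n} {k} k≤n = ℕₚ.≤-trans (ℕₚ.≤-reflexive (C≡binom k≤n)) (ℕₚ.≤-trans (binom≤^ k (n ∸ k))
  (ℕₚ.^-monoˡ-≤ k (ℕₚ.≤-trans (ℕₚ.≤-reflexive (ℕₚ.m+[n∸m]≡n k≤n)) (ℕₚ.n≤1+n n))))

-- Asymptotic induction for any bounded family satisfying the recursion.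

module Expansion {c ℓ₁ ℓ₂} (ℝ : RealNumbers c ℓ₁ ℓ₂) (p : RealNumbers.Carrier ℝ)
  (0<p : RealNumbers._<_ ℝ (RealNumbers.0# ℝ) p) (p<1 : RealNumbers._<_ ℝ p (RealNumbers.1# ℝ)) where
  open OrderedField ℝ
  open Sums ℝ
  open Colourings.Model ℝ p using (q)
  open Estimates.Base ℝ p 0<p p<1

  -- The exponent `s` is left free, so binomial coefficients with a fixed lower index count as
  -- bounded; `absorb` later pays for it with a single `q ^ n`.
  Dominated : (x f : ℕ → Carrier) → Set _
  Dominated x f = ∃[ K ] ∃[ s ] ∃[ N ] (0# ≤ K × ∀ n → N ℕ.≤ n → abs (f n) ≤ K * (ι (suc n) ^ s * x n))

  1≤ι1+n : ∀ n → 1# ≤ ι (suc n)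
  1≤ι1+n n = 1≤ι {suc n} (s≤s z≤n)

  dominated-+ : ∀ {x f g} → (∀ n → 0# ≤ x n) → Dominated x f → Dominated x g → Dominated x (λ n → f n + g n)
  dominated-+ {x} 0≤x (K , s , N , 0≤K , f≤) (K′ , s′ , N′ , 0≤K′ , g≤) =
    K + K′ , s ℕ.+ s′ , N ℕ.+ N′ , 0≤+ 0≤K 0≤K′ , λ n N≤n →
      ≤-respʳ (sym (distribʳ _ K K′)) (abs-+
        (≤-trans (f≤ n (ℕₚ.≤-trans (ℕₚ.m≤m+n N N′) N≤n))
          (*-monoˡ-≤ 0≤K (*-monoʳ-≤ (0≤x n) (^-monoʳ-≤ (1≤ι1+n n) (ℕₚ.m≤m+n s s′)))))
        (≤-trans (g≤ n (ℕₚ.≤-trans (ℕₚ.m≤n+m N′ N) N≤n))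
          (*-monoˡ-≤ 0≤K′ (*-monoʳ-≤ (0≤x n) (^-monoʳ-≤ (1≤ι1+n n) (ℕₚ.m≤n+m s′ s))))))

  dominated-sum< : ∀ {x} → (∀ n → 0# ≤ x n) → ∀ r {f : ℕ → ℕ → Carrier} → (∀ j → j ℕ.< r → Dominated x (f j)) →
    Dominated x (λ n → sum< r (λ j → f j n))
  dominated-sum< {x} 0≤x zero    dom = 0# , 0 , 0 , ≤-refl , λ n _ → abs-0 (≤-reflexive (sym (zeroˡ _)))
  dominated-sum< {x} 0≤x (suc r) dom = dominated-+ 0≤x (dom 0 (s≤s z≤n)) (dominated-sum< 0≤x r (λ j j<r → dom (suc j) (s≤s j<r)))

  dominated-cong : ∀ {x f g} M → (∀ n → M ℕ.≤ n → f n ≈ g n) → Dominated x f → Dominated x g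
  dominated-cong M f≈g (K , s , N , 0≤K , f≤) = K , s , M ℕ.+ N , 0≤K , λ n M+N≤n →
    abs-congˡ-≤ (f≈g n (ℕₚ.≤-trans (ℕₚ.m≤m+n M N) M+N≤n)) (f≤ n (ℕₚ.≤-trans (ℕₚ.m≤n+m N M) M+N≤n))

  dominated-unshift : ∀ {x f} → (∀ n → 0# ≤ x n) → Dominated (x ∘ suc) (f ∘ suc) → Dominated x f
  dominated-unshift {x} {f} 0≤x (K , s , N , 0≤K , f≤) = K , s , suc N , 0≤K , bound
    where
    bound : ∀ n → suc N ℕ.≤ n → abs (f n) ≤ K * (ι (suc n) ^ s * x n)
    bound (suc n) (s≤s N≤n) = ≤-trans (f≤ n N≤n)
      (*-monoˡ-≤ 0≤K (*-monoʳ-≤ (0≤x (suc n)) (^-monoˡ-≤ s (0≤ι (suc n)) (ι-mono-≤ (ℕₚ.n≤1+n (suc n))))))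

  truncation : (ℕ → Carrier) → ℕ → ℕ → Carrier
  truncation b r n = sum< r (λ k → ι (n C k) * q ^ (k ℕ.* (n ∸ k)) * b k)

  q^-+ : ∀ {k} m n → k ≡ m ℕ.+ n → q ^ k ≈ q ^ m * q ^ n
  q^-+ m n eq = trans (reflexive (≡.cong (q ^_) eq)) (^-homo-* q m n)

  -- For exponents that miss the target order by a constant: the deficit becomes a constant factor.
  q^-shift : ∀ k m n → k ℕ.+ m ≡ n → q ^ k ≈ u ^ m * q ^ n
  q^-shift k m n eq = begin
    q ^ k                     ≈⟨ sym (*-identityˡ _) ⟩
    1# * q ^ k                ≈⟨ *-congʳ (trans (sym (q^n*u^n≈1 m)) (*-comm _ _)) ⟩
    (u ^ m * q ^ m) * q ^ k   ≈⟨ *-assoc _ _ _ ⟩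
    u ^ m * (q ^ m * q ^ k)   ≈⟨ *-congˡ (sym (q^-+ m k (≡.trans (≡.sym eq) (ℕₚ.+-comm k m)))) ⟩
    u ^ m * q ^ n             ∎

  module Chain (a : ℕ → ℕ → Carrier)
    (chain : ∀ t n → a t (suc n) ≈ antidiag n (λ i j → ι (binom i j) * q ^ (i ℕ.* suc j) * a (suc t) i))
    (bounded : ∀ t → ∃[ K ] (0# ≤ K × ∀ n → abs (a t n) ≤ K)) where

    remainder : ℕ → ℕ → ℕ → Carrier
    remainder t r n = a t n - truncation (a (suc t)) r n

    HasOrder : ℕ → Set _
    HasOrder r = ∀ t → Dominated (λ n → q ^ (r ℕ.* n)) (remainder t r)

    order-0 : HasOrder 0
    order-0 t with bounded t
    ... | K , 0≤K , a≤K = K , 0 , 0 , 0≤K , λ n _ →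
      abs-congˡ-≤ (sym (x-0≈x _)) (≤-respʳ (sym (trans (*-congˡ (*-identityˡ 1#)) (*-identityʳ K))) (a≤K n))

    module Step (r : ℕ) (ih : ∀ r′ → r′ ℕ.≤ r → HasOrder r′) (t : ℕ) where
      b = a (suc t)
      d = a (suc (suc t))
      R = suc r

      -- Here `i` vertices lie outside the colour class of the first vertex and `suc j` inside.
      -- Because of this `suc`, cutting off `i < R` and `j < r` leaves at least `R` vertices on both
      -- sides.
      F : ℕ → ℕ → Carrier
      F i j = ι (binom i j) * q ^ (i ℕ.* suc j) * b i

      middle : ℕ → Carrier
      middle M = antidiag M (λ i j → F (R ℕ.+ i) (r ℕ.+ j))

      upperTerm : (ℕ → Carrier) → ℕ → ℕ → Carrier
      upperTerm f n j = ι (n C j) * q ^ ((n ∸ j) ℕ.* suc j) * f (n ∸ j)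

      lowerSum upperSum : ℕ → Carrier
      lowerSum n = sum< R (λ i → ι (n C i) * q ^ (i ℕ.* suc (n ∸ i)) * b i)
      upperSum n = sum< r (upperTerm b n)

      a-split : ∀ M → let n = R ℕ.+ (r ℕ.+ M) in a t (suc n) ≈ lowerSum n + (upperSum n + middle M)
      a-split M = begin
        a t (suc n)
          ≈⟨ chain t n ⟩
        antidiag n F
          ≈⟨ antidiag-lower R (r ℕ.+ M) F ⟩
        sum< R (λ i → F i (n ∸ i)) + antidiag (r ℕ.+ M) (λ i j → F (R ℕ.+ i) j)
          ≈⟨ +-cong (sum<-cong R lower) (trans (antidiag-upper r M (λ i j → F (R ℕ.+ i) j)) (+-congʳ (sum<-cong r upper))) ⟩
        lowerSum n + (upperSum n + middle M) ∎
        where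
        n = R ℕ.+ (r ℕ.+ M)
        lower : ∀ i → i ℕ.< R → F i (n ∸ i) ≈ ι (n C i) * q ^ (i ℕ.* suc (n ∸ i)) * b i
        lower i i<R = *-congʳ (*-congʳ (reflexive (≡.cong ι (≡.sym (C≡binom (ℕₚ.m≤n⇒m≤n+o (r ℕ.+ M) (ℕₚ.<⇒≤ i<R)))))))
        upper : ∀ j → j ℕ.< r → F (R ℕ.+ ((r ℕ.+ M) ∸ j)) j ≈ upperTerm b n j
        upper j j<r = trans (reflexive (≡.cong (λ m → F m j) (≡.sym (ℕₚ.+-∸-assoc R j≤r+M))))
          (*-congʳ (*-congʳ (reflexive (≡.cong ι (≡.sym (C-upper≡binom (ℕₚ.m≤n⇒m≤o+n R j≤r+M)))))))
          where j≤r+M = ℕₚ.m≤n⇒m≤n+o M (ℕₚ.<⇒≤ j<r)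

      private
        regroup : ∀ {a₁ b₁ c₁ d₁ a₂ b₂ c₂ d₂} x → a₁ * c₁ ≈ a₂ * c₂ → b₁ * d₁ ≈ b₂ * d₂ →
          a₁ * b₁ * (c₁ * d₁ * x) ≈ a₂ * b₂ * (c₂ * d₂ * x)
        regroup x eq₁ eq₂ = trans (shuffle _ _ _ _ x) (trans (*-congʳ (*-cong eq₁ eq₂)) (sym (shuffle _ _ _ _ x)))
          where
          shuffle : ∀ a b c d x → a * b * (c * d * x) ≈ (a * c) * (b * d) * x
          shuffle = solve 5 (λ a b c d x → a :* b :* (c :* d :* x) := (a :* c) :* (b :* d) :* x) refl

      -- With `e = n - i - j`, the exponents agree by `(i + e) (j + 1) + i e = (i + j + 1) e + i (j
      -- + 1)`. All but the last bracket on the right depends on `i + j` alone, so terms can be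
      -- collected along diagonals.
      doubleTerm : ∀ n i j → i ℕ.+ j ℕ.≤ n →
        ι (n C j) * q ^ ((n ∸ j) ℕ.* suc j) * (ι ((n ∸ j) C i) * q ^ (i ℕ.* ((n ∸ j) ∸ i)) * d i) ≈
        ι (n C (i ℕ.+ j)) * q ^ (suc (i ℕ.+ j) ℕ.* (n ∸ (i ℕ.+ j))) * (ι (binom i j) * q ^ (i ℕ.* suc j) * d i)
      doubleTerm n i j i+j≤n = regroup (d i)
        (trans (sym (ι-* (n C j) ((n ∸ j) C i))) (trans (reflexive (≡.cong ι binoms)) (ι-* (n C (i ℕ.+ j)) (binom i j))))
        (trans (sym (^-homo-* q ((n ∸ j) ℕ.* suc j) (i ℕ.* ((n ∸ j) ∸ i))))
          (trans (reflexive (≡.cong (q ^_) exponents)) (^-homo-* q (suc (i ℕ.+ j) ℕ.* e) (i ℕ.* suc j))))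
        where
        e = n ∸ (i ℕ.+ j)
        j≤n : j ℕ.≤ n
        j≤n = ℕₚ.≤-trans (ℕₚ.m≤n+m j i) i+j≤n
        n∸j∸i≡e : (n ∸ j) ∸ i ≡ e
        n∸j∸i≡e = ≡.trans (ℕₚ.∸-+-assoc n j i) (≡.cong (n ∸_) (ℕₚ.+-comm j i))
        i≤n∸j : i ℕ.≤ n ∸ j
        i≤n∸j = ≡.subst (ℕ._≤ n ∸ j) (ℕₚ.m+n∸n≡m i j) (ℕₚ.∸-monoˡ-≤ j i+j≤n)
        n∸j≡i+e : n ∸ j ≡ i ℕ.+ e
        n∸j≡i+e = ≡.trans (≡.sym (ℕₚ.m+[n∸m]≡n i≤n∸j)) (≡.cong (i ℕ.+_) n∸j∸i≡e)
        binoms : (n C j) ℕ.* ((n ∸ j) C i) ≡ (n C (i ℕ.+ j)) ℕ.* binom i j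
        binoms = ≡.trans
          (≡.cong₂ ℕ._*_ (≡.trans (C≡binom j≤n) (≡.cong (binom j) n∸j≡i+e))
                         (≡.trans (C≡binom i≤n∸j) (≡.cong (binom i) n∸j∸i≡e)))
          (≡.trans (binom-trinomial i j e) (≡.cong (ℕ._* binom i j) (≡.sym (C≡binom i+j≤n))))
        exponents : (n ∸ j) ℕ.* suc j ℕ.+ i ℕ.* ((n ∸ j) ∸ i) ≡ suc (i ℕ.+ j) ℕ.* e ℕ.+ i ℕ.* suc j
        exponents = ≡.trans (≡.cong₂ (λ x y → x ℕ.* suc j ℕ.+ i ℕ.* y) n∸j≡i+e n∸j∸i≡e)
          (S.solve 3 (λ i j e → (i S.:+ e) S.:* (S.con 1 S.:+ j) S.:+ i S.:* e S.:=
             (S.con 1 S.:+ (i S.:+ j)) S.:* e S.:+ i S.:* (S.con 1 S.:+ j)) ≡.refl i j e)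

      -- On the diagonal `i + j = l` the collected brackets are the recursion for `b (suc l)`; thus
      -- truncations with coefficients `d` produce a sum with coefficients `b`.
      upperMain : ∀ n → r ℕ.≤ n →
        sum< r (λ j → ι (n C j) * q ^ ((n ∸ j) ℕ.* suc j) * truncation d (r ∸ j) (n ∸ j)) ≈
        sum< r (λ l → ι (n C l) * q ^ (suc l ℕ.* (n ∸ l)) * b (suc l))
      upperMain n r≤n = begin
        sum< r (λ j → ι (n C j) * q ^ ((n ∸ j) ℕ.* suc j) * truncation d (r ∸ j) (n ∸ j))
          ≈⟨ sum<-cong r (λ j _ → sym (sum<-*ˡ (r ∸ j) _ _)) ⟩
        sum< r (λ j → sum< (r ∸ j) (λ i → H i j))
          ≈⟨ sym (sum<-antidiag r H) ⟩
        sum< r (λ l → antidiag l H)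
          ≈⟨ sum<-cong r (λ l l<r → trans (antidiag-cong l (collect l l<r)) (trans (antidiag-*ˡ l _ _) (*-congˡ (sym (chain (suc t) l))))) ⟩
        sum< r (λ l → ι (n C l) * q ^ (suc l ℕ.* (n ∸ l)) * b (suc l)) ∎
        where
        H : ℕ → ℕ → Carrier
        H i j = ι (n C j) * q ^ ((n ∸ j) ℕ.* suc j) * (ι ((n ∸ j) C i) * q ^ (i ℕ.* ((n ∸ j) ∸ i)) * d i)
        collect : ∀ l → l ℕ.< r → ∀ i j → i ℕ.+ j ≡ l →
          H i j ≈ ι (n C l) * q ^ (suc l ℕ.* (n ∸ l)) * (ι (binom i j) * q ^ (i ℕ.* suc j) * d i)
        collect .(i ℕ.+ j) l<r i j ≡.refl = doubleTerm n i j (ℕₚ.≤-trans (ℕₚ.<⇒≤ l<r) r≤n)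

      -- For `k ≥ 1` both sums carry `q ^ (k (n + 1 - k)) * b k`, one with `n C k` and one with
      -- `n C (k - 1)`; Pascal's rule joins them.
      lower+upper : ∀ n → r ℕ.≤ n →
        lowerSum n + sum< r (λ l → ι (n C l) * q ^ (suc l ℕ.* (n ∸ l)) * b (suc l)) ≈ truncation b R (suc n)
      lower+upper n r≤n = trans (+-assoc _ _ _) (+-congˡ (trans (sym (sum<-+ r _ _)) (sum<-cong r pascal)))
        where
        pascal : ∀ l → l ℕ.< r →
          ι (n C suc l) * q ^ (suc l ℕ.* suc (n ∸ suc l)) * b (suc l) + ι (n C l) * q ^ (suc l ℕ.* (n ∸ l)) * b (suc l)
          ≈ ι (suc n C suc l) * q ^ (suc l ℕ.* (n ∸ l)) * b (suc l)
        pascal l l<r = trans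
          (+-congʳ (*-congʳ (*-congˡ (reflexive (≡.cong (λ m → q ^ (suc l ℕ.* m)) (≡.sym (ℕₚ.+-∸-assoc 1 (ℕₚ.≤-trans l<r r≤n))))))))
          (trans (solve 4 (λ x y z w → x :* z :* w :+ y :* z :* w := (y :+ x) :* z :* w) refl
              (ι (n C suc l)) (ι (n C l)) (q ^ (suc l ℕ.* (n ∸ l))) (b (suc l)))
            (*-congʳ (*-congʳ (trans (sym (ι-+ (n C l) (n C suc l))) (reflexive (≡.cong ι (nCk+nC[k+1]≡[n+1]C[k+1] n l)))))))

      upperError : ℕ → Carrier
      upperError n = sum< r (λ j → ι (n C j) * q ^ ((n ∸ j) ℕ.* suc j) * remainder (suc t) (r ∸ j) (n ∸ j))

      remainder-split : ∀ M → let n = R ℕ.+ (r ℕ.+ M) in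
        remainder t R (suc n) ≈ upperError n + middle M
      remainder-split M = x≈y+z⇒x-y≈z (begin
        a t (suc n)
          ≈⟨ a-split M ⟩
        lowerSum n + (upperSum n + middle M)
          ≈⟨ +-congˡ (+-congʳ (trans (sum<-cong r (λ j _ → trans (*-congˡ (sym (main+remainder j))) (distribˡ _ _ _))) (sum<-+ r _ _))) ⟩
        lowerSum n + ((main + upperError n) + middle M)
          ≈⟨ solve 4 (λ x y z w → x :+ ((y :+ z) :+ w) := (x :+ y) :+ (z :+ w)) refl (lowerSum n) main (upperError n) (middle M) ⟩
        (lowerSum n + main) + (upperError n + middle M)
          ≈⟨ +-congʳ (trans (+-congˡ (upperMain n r≤n)) (lower+upper n r≤n)) ⟩
        truncation b R (suc n) + (upperError n + middle M) ∎)
        where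
        n = R ℕ.+ (r ℕ.+ M)
        r≤n : r ℕ.≤ n
        r≤n = ℕₚ.m≤n⇒m≤o+n R (ℕₚ.m≤m+n r M)
        main = sum< r (λ j → ι (n C j) * q ^ ((n ∸ j) ℕ.* suc j) * truncation d (r ∸ j) (n ∸ j))
        main+remainder : ∀ j → truncation d (r ∸ j) (n ∸ j) + remainder (suc t) (r ∸ j) (n ∸ j) ≈ b (n ∸ j)
        main+remainder j = trans (+-comm _ _) (x-y+y≈x _ _)

      scale : ℕ → Carrier
      scale n = q ^ (R ℕ.* n)

      0≤scale : ∀ n → 0# ≤ scale n
      0≤scale n = 0≤q^ (R ℕ.* n)

      -- The term supplies `q ^ ((j + 1) (n - j))` and the induction hypothesis
      -- `q ^ ((r - j) (n - j))`. Together they give `q ^ (R (n - j))`, the target up to the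
      -- constant `u ^ (R (j + 1))`.
      dominated-upperTerm : ∀ j → j ℕ.< r →
        Dominated (scale ∘ suc) (λ n → ι (n C j) * q ^ ((n ∸ j) ℕ.* suc j) * remainder (suc t) (r ∸ j) (n ∸ j))
      dominated-upperTerm j j<r with ih (r ∸ j) (ℕₚ.m∸n≤m r j) (suc t)
      ... | K , s , N , 0≤K , rem≤ = K * u ^ (R ℕ.* suc j) , j ℕ.+ s , N ℕ.+ j , 0≤* 0≤K (0≤^ (R ℕ.* suc j) 0≤u) , bound
        where
        bound : ∀ n → N ℕ.+ j ℕ.≤ n →
          abs (ι (n C j) * q ^ ((n ∸ j) ℕ.* suc j) * remainder (suc t) (r ∸ j) (n ∸ j)) ≤
          K * u ^ (R ℕ.* suc j) * (ι (suc n) ^ (j ℕ.+ s) * scale (suc n))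
        bound n N+j≤n = ≤-trans (abs-* (0≤* (0≤ι (n C j)) (0≤q^ (m ℕ.* suc j))) (rem≤ m N≤m))
          (≤-trans (*-mono-≤ 0≤tail (0≤* (0≤^ j (0≤ι (suc n))) (0≤q^ (m ℕ.* suc j))) (*-monoʳ-≤ (0≤q^ (m ℕ.* suc j)) C≤)
             (*-monoˡ-≤ 0≤K (*-monoʳ-≤ (0≤q^ ((r ∸ j) ℕ.* m)) (^-monoˡ-≤ s (0≤ι (suc m)) (ι-mono-≤ (s≤s (ℕₚ.m∸n≤m n j)))))))
            (≤-reflexive (begin
              ι (suc n) ^ j * q ^ (m ℕ.* suc j) * (K * (ι (suc n) ^ s * q ^ ((r ∸ j) ℕ.* m)))
                ≈⟨ solve 5 (λ x y k z w → x :* y :* (k :* (z :* w)) := k :* (x :* z :* (y :* w))) refl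
                     (ι (suc n) ^ j) (q ^ (m ℕ.* suc j)) K (ι (suc n) ^ s) (q ^ ((r ∸ j) ℕ.* m)) ⟩
              K * (ι (suc n) ^ j * ι (suc n) ^ s * (q ^ (m ℕ.* suc j) * q ^ ((r ∸ j) ℕ.* m)))
                ≈⟨ *-congˡ (*-cong (sym (^-homo-* (ι (suc n)) j s)) (trans (sym (^-homo-* q (m ℕ.* suc j) ((r ∸ j) ℕ.* m))) (q^-shift (m ℕ.* suc j ℕ.+ (r ∸ j) ℕ.* m) (R ℕ.* suc j) (R ℕ.* suc n) exponents))) ⟩
              K * (ι (suc n) ^ (j ℕ.+ s) * (u ^ (R ℕ.* suc j) * scale (suc n)))
                ≈⟨ solve 4 (λ k x y z → k :* (x :* (y :* z)) := k :* y :* (x :* z)) refl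
                     K (ι (suc n) ^ (j ℕ.+ s)) (u ^ (R ℕ.* suc j)) (scale (suc n)) ⟩
              K * u ^ (R ℕ.* suc j) * (ι (suc n) ^ (j ℕ.+ s) * scale (suc n)) ∎)))
          where
          m = n ∸ j
          j≤n : j ℕ.≤ n
          j≤n = ℕₚ.≤-trans (ℕₚ.m≤n+m j N) N+j≤n
          N≤m : N ℕ.≤ m
          N≤m = ≡.subst (ℕ._≤ m) (ℕₚ.m+n∸n≡m N j) (ℕₚ.∸-monoˡ-≤ j N+j≤n)
          0≤tail : 0# ≤ K * (ι (suc m) ^ s * q ^ ((r ∸ j) ℕ.* m))
          0≤tail = 0≤* 0≤K (0≤* (0≤^ s (0≤ι (suc m))) (0≤q^ ((r ∸ j) ℕ.* m)))
          C≤ : ι (n C j) ≤ ι (suc n) ^ j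
          C≤ = ≤-respʳ (ι-^ (suc n) j) (ι-mono-≤ (C≤^ j≤n))
          exponents : m ℕ.* suc j ℕ.+ (r ∸ j) ℕ.* m ℕ.+ R ℕ.* suc j ≡ R ℕ.* suc n
          exponents = ≡.trans
            (≡.cong (λ x → m ℕ.* suc j ℕ.+ (r ∸ j) ℕ.* m ℕ.+ suc x ℕ.* suc j) (≡.sym r≡))
            (≡.trans (S.solve 3 (λ m j k → m S.:* (S.con 1 S.:+ j) S.:+ k S.:* m S.:+ (S.con 1 S.:+ (j S.:+ k)) S.:* (S.con 1 S.:+ j)
                S.:= (S.con 1 S.:+ (j S.:+ k)) S.:* (S.con 1 S.:+ (m S.:+ j))) ≡.refl m j (r ∸ j))
              (≡.cong₂ (λ x y → suc x ℕ.* suc y) r≡ (ℕₚ.m∸n+n≡m j≤n)))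
            where r≡ = ℕₚ.m+[n∸m]≡n (ℕₚ.<⇒≤ j<r)

      -- Since `(R + i) (R + j) + R * R = R (n + 1) + i j`, each term has the target order and a
      -- spare `q ^ (i j)`. The binomial is at most a power of `n + 1` times `binom i j`, so `L`
      -- bounds what remains of the sum.
      dominated-middle : ∀ K L → 0# ≤ K → 0# ≤ L → (∀ n → abs (b n) ≤ K) →
        (∀ n → antidiag n (λ i j → ι (binom i j) * q ^ (i ℕ.* j)) ≤ L) →
        Dominated (scale ∘ suc) (λ n → middle (n ∸ (R ℕ.+ r)))
      dominated-middle K L 0≤K 0≤L b≤K q^ij≤L =
        u ^ (R ℕ.* R) * (K * L) , R ℕ.+ r , R ℕ.+ r , 0≤* (0≤^ (R ℕ.* R) 0≤u) (0≤* 0≤K 0≤L) , bound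
        where
        bound : ∀ n → R ℕ.+ r ℕ.≤ n →
          abs (middle (n ∸ (R ℕ.+ r))) ≤ u ^ (R ℕ.* R) * (K * L) * (ι (suc n) ^ (R ℕ.+ r) * scale (suc n))
        bound n R+r≤n = ≤-trans (abs-antidiag M term) (≤-respˡ (sym (antidiag-*ˡ M k (λ i j → ι (binom i j) * q ^ (i ℕ.* j))))
          (≤-trans (*-monoˡ-≤ 0≤k (q^ij≤L M))
            (≤-reflexive (solve 5 (λ x K y z L → x :* K :* (y :* z) :* L := x :* (K :* L) :* (y :* z)) refl
              (u ^ (R ℕ.* R)) K (ι (suc n) ^ (R ℕ.+ r)) (scale (suc n)) L))))
          where
          M = n ∸ (R ℕ.+ r)
          n≡ : R ℕ.+ r ℕ.+ M ≡ n
          n≡ = ℕₚ.m+[n∸m]≡n R+r≤n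
          k = u ^ (R ℕ.* R) * K * (ι (suc n) ^ (R ℕ.+ r) * scale (suc n))
          0≤k : 0# ≤ k
          0≤k = 0≤* (0≤* (0≤^ (R ℕ.* R) 0≤u) 0≤K) (0≤* (0≤^ (R ℕ.+ r) (0≤ι (suc n))) (0≤scale (suc n)))
          term : ∀ i j → i ℕ.+ j ≡ M → abs (F (R ℕ.+ i) (r ℕ.+ j)) ≤ k * (ι (binom i j) * q ^ (i ℕ.* j))
          term i j i+j≡M = ≤-trans (abs-* (0≤* (0≤ι (binom (R ℕ.+ i) (r ℕ.+ j))) (0≤q^ ((R ℕ.+ i) ℕ.* suc (r ℕ.+ j)))) (b≤K (R ℕ.+ i)))
            (≤-trans (*-monoʳ-≤ 0≤K (*-monoʳ-≤ (0≤q^ ((R ℕ.+ i) ℕ.* suc (r ℕ.+ j))) growth))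
              (≤-reflexive (begin
                ι (suc n) ^ (R ℕ.+ r) * ι (binom i j) * q ^ ((R ℕ.+ i) ℕ.* suc (r ℕ.+ j)) * K
                  ≈⟨ *-congʳ (*-congˡ (trans (q^-shift ((R ℕ.+ i) ℕ.* suc (r ℕ.+ j)) (R ℕ.* R) (R ℕ.* suc n ℕ.+ i ℕ.* j) exponents) (*-congˡ (^-homo-* q (R ℕ.* suc n) (i ℕ.* j))))) ⟩
                ι (suc n) ^ (R ℕ.+ r) * ι (binom i j) * (u ^ (R ℕ.* R) * (scale (suc n) * q ^ (i ℕ.* j))) * K
                  ≈⟨ solve 6 (λ x y z w v K → x :* y :* (z :* (w :* v)) :* K := z :* K :* (x :* w) :* (y :* v)) refl
                       (ι (suc n) ^ (R ℕ.+ r)) (ι (binom i j)) (u ^ (R ℕ.* R)) (scale (suc n)) (q ^ (i ℕ.* j)) K ⟩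
                k * (ι (binom i j) * q ^ (i ℕ.* j)) ∎)))
            where
            total : (R ℕ.+ i) ℕ.+ (r ℕ.+ j) ≡ n
            total = ≡.trans (S.solve 4 (λ R i r j → (R S.:+ i) S.:+ (r S.:+ j) S.:= R S.:+ r S.:+ (i S.:+ j)) ≡.refl R i r j)
              (≡.trans (≡.cong (R ℕ.+ r ℕ.+_) i+j≡M) n≡)
            growth : ι (binom (R ℕ.+ i) (r ℕ.+ j)) ≤ ι (suc n) ^ (R ℕ.+ r) * ι (binom i j)
            growth = ≤-respʳ (trans (ι-* (suc n ℕ.^ (R ℕ.+ r)) (binom i j)) (*-congʳ (ι-^ (suc n) (R ℕ.+ r))))
              (ι-mono-≤ (binom-growth R r i j (ℕₚ.m≤n⇒m≤1+n (ℕₚ.≤-reflexive total))))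
            exponents : (R ℕ.+ i) ℕ.* suc (r ℕ.+ j) ℕ.+ R ℕ.* R ≡ R ℕ.* suc n ℕ.+ i ℕ.* j
            exponents = ≡.trans
              (S.solve 3 (λ r i j → let R = S.con 1 S.:+ r in
                 (R S.:+ i) S.:* (S.con 1 S.:+ (r S.:+ j)) S.:+ R S.:* R S.:=
                 R S.:* (S.con 1 S.:+ ((R S.:+ i) S.:+ (r S.:+ j))) S.:+ i S.:* j) ≡.refl r i j)
              (≡.cong (λ m → R ℕ.* suc m ℕ.+ i ℕ.* j) total)

      dominated-remainder : Dominated scale (remainder t R)
      dominated-remainder = dominated-unshift 0≤scale (dominated-cong (R ℕ.+ r) split
        (dominated-+ (0≤scale ∘ suc) (dominated-sum< (0≤scale ∘ suc) r dominated-upperTerm)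
          (dominated-middle (proj₁ bound-b) (proj₁ bound-q) (proj₁ (proj₂ bound-b)) (proj₁ (proj₂ bound-q))
            (proj₂ (proj₂ bound-b)) (proj₂ (proj₂ bound-q)))))
        where
        bound-b = bounded (suc t)
        bound-q = antidiag-q^ij-bounded
        split : ∀ n → R ℕ.+ r ℕ.≤ n → upperError n + middle (n ∸ (R ℕ.+ r)) ≈ remainder t R (suc n)
        split n R+r≤n = sym (≡.subst (λ m → remainder t R (suc m) ≈ upperError m + middle (n ∸ (R ℕ.+ r)))
          (≡.trans (≡.sym (ℕₚ.+-assoc R r _)) (ℕₚ.m+[n∸m]≡n R+r≤n)) (remainder-split (n ∸ (R ℕ.+ r))))

    expansion : ∀ r → HasOrder r
    expansion r = below r r ℕₚ.≤-refl
      where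
      -- Strong induction, because classes of different sizes use different lower orders; the bound
      -- `r` decreases structurally.
      below : ∀ r r′ → r′ ℕ.≤ r → HasOrder r′
      below r       zero     _   = order-0
      below (suc r) (suc r′) (s≤s r′≤r) = Step.dominated-remainder r′ (λ r″ r″≤r′ → below r r″ (ℕₚ.≤-trans r″≤r′ r′≤r))

-- Binomial coefficients and exponents of the stated scale.

C-monoˡ-suc : ∀ n k → n C k ℕ.≤ suc n C k
C-monoˡ-suc n zero    = ℕₚ.≤-refl
C-monoˡ-suc n (suc k) = ≡.subst (n C suc k ℕ.≤_) (nCk+nC[k+1]≡[n+1]C[k+1] n k) (ℕₚ.m≤n+m (n C suc k) (n C k))

C-suc-≤ : ∀ n k → n C suc k ℕ.≤ suc n ℕ.* (n C k)
C-suc-≤ zero    k = z≤n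
C-suc-≤ (suc n) k = begin
  suc n C suc k                        ≡⟨ ≡.sym (nCk+nC[k+1]≡[n+1]C[k+1] n k) ⟩
  n C k ℕ.+ n C suc k                  ≤⟨ ℕₚ.+-monoʳ-≤ (n C k) (C-suc-≤ n k) ⟩
  suc (suc n) ℕ.* (n C k)              ≤⟨ ℕₚ.*-monoʳ-≤ (suc (suc n)) (C-monoˡ-suc n k) ⟩
  suc (suc n) ℕ.* (suc n C k)          ∎
  where open ℕₚ.≤-Reasoning

-- The number `n (n - 1) / 2` of vertex pairs, in the recursive form that matches `Graph`; the scale
-- uses `pairs (suc k)`.
pairs : ℕ → ℕ
pairs zero    = 0
pairs (suc n) = n ℕ.+ pairs n

k[k+1]/2≡pairs : ∀ k → (k ℕ.* suc k) / 2 ≡ pairs (suc k)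
k[k+1]/2≡pairs k = ≡.trans (≡.cong (_/ 2) (double k)) (m*n/n≡m (pairs (suc k)) 2)
  where
  double : ∀ k → k ℕ.* suc k ≡ pairs (suc k) ℕ.* 2
  double zero    = ≡.refl
  double (suc k) = ≡.trans
    (S.solve 1 (λ k → (S.con 1 S.:+ k) S.:* (S.con 2 S.:+ k) S.:= (S.con 1 S.:+ k) S.:* S.con 2 S.:+ k S.:* (S.con 1 S.:+ k)) ≡.refl k)
    (≡.trans (≡.cong (suc k ℕ.* 2 ℕ.+_) (double k)) (≡.sym (ℕₚ.*-distribʳ-+ 2 (suc k) (pairs (suc k)))))

k*k≡pairs+pairs : ∀ k → k ℕ.* k ≡ pairs (suc k) ℕ.+ pairs k
k*k≡pairs+pairs zero    = ≡.refl
k*k≡pairs+pairs (suc k) = ≡.trans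
  (S.solve 1 (λ k → (S.con 1 S.:+ k) S.:* (S.con 1 S.:+ k) S.:= S.con 1 S.:+ k S.:+ k S.:+ k S.:* k) ≡.refl k)
  (≡.trans (≡.cong (suc k ℕ.+ k ℕ.+_) (k*k≡pairs+pairs k))
    (S.solve 3 (λ k x y → S.con 1 S.:+ k S.:+ k S.:+ (x S.:+ y) S.:= S.con 1 S.:+ k S.:+ x S.:+ (k S.:+ y)) ≡.refl k (pairs (suc k)) (pairs k)))

-- The family for component counts and its translation into the stated expansion.

module Components {c ℓ₁ ℓ₂} (ℝ : RealNumbers c ℓ₁ ℓ₂) (p : RealNumbers.Carrier ℝ)
  (0<p : RealNumbers._<_ ℝ (RealNumbers.0# ℝ) p) (p<1 : RealNumbers._<_ ℝ p (RealNumbers.1# ℝ)) where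
  open OrderedField ℝ
  open Sums ℝ
  open Polynomials ℝ
  open Colourings.Model ℝ p
  open Recursion ℝ p
  open Estimates.Base ℝ p 0<p p<1
  open Expansion ℝ p 0<p p<1

  0≤mass : ∀ {n} (g : Graph n) → 0# ≤ mass ℝ p g
  0≤mass []      = 0≤1
  0≤mass (N ∷ g) = ≤-respʳ (reflexive (≡.sym (mass-∷ N g))) (0≤* (nonneg N) (0≤mass g))
    where
    nonneg : ∀ {n} (N : Subset n) → 0# ≤ neighbourhoodMass N
    nonneg []            = 0≤1
    nonneg (outside ∷ N) = 0≤* 0≤q (nonneg N)
    nonneg (inside ∷ N)  = 0≤* (<⇒≤ 0<p) (nonneg N)

  Z-bounded : ∀ y → ∃[ L ] (0# ≤ L × ∀ n → Z n y ≤ L)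
  Z-bounded zero    = 1# , 0≤1 , λ n → ≤-respˡ (sym (Z≈T n 0)) (T-0 n)
    where
    T-0 : ∀ n → T {0} n (λ _ → 1#) ≤ 1#
    T-0 zero    = ≤-refl
    T-0 (suc n) = 0≤1
  Z-bounded (suc y) = L * proj₁ ih , 0≤* 0≤L (proj₁ (proj₂ ih)) , λ n →
    ≤-respˡ (sym (Z-suc n y)) (≤-trans
      (antidiag-mono-≤ n (λ i j _ → *-monoˡ-≤ (0≤* (0≤ι (binom i j)) (0≤q^ (i ℕ.* j))) (proj₂ (proj₂ ih) j)))
      (≤-respˡ (trans (sym (antidiag-*ˡ n (proj₁ ih) (λ i j → ι (binom i j) * q ^ (i ℕ.* j)))) (antidiag-cong n (λ i j _ → *-comm _ _)))
        (≤-respˡ (*-comm _ _) (*-monoʳ-≤ (proj₁ (proj₂ ih)) (proj₂ (proj₂ antidiag-q^ij-bounded) n)))))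
    where
    ih = Z-bounded y
    L = proj₁ antidiag-q^ij-bounded
    0≤L = proj₁ (proj₂ antidiag-q^ij-bounded)

  module _ (m : ℕ) where

    -- The m-th coefficient of 𝔼 [ x (x - 1) ⋯ (x - t + 1) (x - t) ^ π₀ ].
    a : ℕ → ℕ → Carrier
    a t n = ∑ (graphs n) λ g → mass ℝ p g * shifted t (π₀ g) m

    -- At `y = t + 1 + z` the polynomial behind `a t (suc n)` takes the value
    -- `falling t y * Z (suc n) (suc z)`. `Z-suc-suc` brings out `z + 1 = y - t`, the factor that
    -- completes `falling (suc t) y`.
    a-chain : ∀ t n → a t (suc n) ≈ antidiag n (λ i j → ι (binom i j) * q ^ (i ℕ.* suc j) * a (suc t) i)
    a-chain t n = isPolynomial-unique (suc t)
      (poly t (suc n))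
      (isPolynomial-antidiag n (λ i j → isPolynomial-* (ι (binom i j) * q ^ (i ℕ.* suc j)) (poly (suc t) i)))
      values m
      where
      value : ℕ → ℕ → ℕ → Carrier
      value t n y = ∑ (graphs n) λ g → mass ℝ p g * (falling t y * (ι y - ι t) ^ π₀ g)

      poly : ∀ t n → IsPolynomial (value t n) (λ m → ∑ (graphs n) λ g → mass ℝ p g * shifted t (π₀ g) m)
      poly t n = isPolynomial-∑ (graphs n) (λ g → isPolynomial-* (mass ℝ p g) (isPolynomial-shifted t (π₀ g)))

      value≈Z : ∀ t n y z → ι y - ι t ≈ ι z → value t n y ≈ falling t y * Z n z
      value≈Z t n y z y-t≈z = trans
        (∑-cong (graphs n) (λ g → trans (*-congˡ (*-congˡ (^-congˡ (π₀ g) y-t≈z)))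
          (solve 3 (λ x y z → x :* (y :* z) := y :* (x :* z)) refl (mass ℝ p g) (falling t y) (ι z ^ π₀ g))))
        (∑-*ˡ (graphs n) (falling t y) (λ g → mass ℝ p g * ι z ^ π₀ g))

      values : ∀ z → value t (suc n) (suc t ℕ.+ z) ≈
        antidiag n (λ i j → ι (binom i j) * q ^ (i ℕ.* suc j) * value (suc t) i (suc t ℕ.+ z))
      values z = begin
        value t (suc n) y
          ≈⟨ value≈Z t (suc n) y (suc z) y-t≈1+z ⟩
        falling t y * Z (suc n) (suc z)
          ≈⟨ *-congˡ (Z-suc-suc n z) ⟩
        falling t y * (ι (suc z) * antidiag n (λ i j → k i j * Z i z))
          ≈⟨ trans (sym (*-assoc _ _ _)) (*-congʳ (trans (*-comm _ _) (*-congʳ (sym y-t≈1+z)))) ⟩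
        falling (suc t) y * antidiag n (λ i j → k i j * Z i z)
          ≈⟨ sym (antidiag-*ˡ n (falling (suc t) y) (λ i j → k i j * Z i z)) ⟩
        antidiag n (λ i j → falling (suc t) y * (k i j * Z i z))
          ≈⟨ antidiag-cong n (λ i j _ → trans
               (solve 3 (λ x y z → x :* (y :* z) := y :* (x :* z)) refl (falling (suc t) y) (k i j) (Z i z))
               (*-congˡ (sym (value≈Z (suc t) i y z (x≈y+z⇒x-y≈z (ι-+ (suc t) z)))))) ⟩
        antidiag n (λ i j → k i j * value (suc t) i y) ∎
        where
        y = suc t ℕ.+ z
        k : ℕ → ℕ → Carrier
        k i j = ι (binom i j) * q ^ (i ℕ.* suc j)
        y-t≈1+z : ι y - ι t ≈ ι (suc z)
        y-t≈1+z = x≈y+z⇒x-y≈z (trans (reflexive (≡.cong ι (≡.sym (ℕₚ.+-suc t z)))) (ι-+ t (suc z)))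

    a-bounded : ∀ t → ∃[ K ] (0# ≤ K × ∀ n → abs (a t n) ≤ K)
    a-bounded t = factorial t * proj₁ L , 0≤* (0≤factorial t) (proj₁ (proj₂ L)) , λ n →
      ≤-trans (abs-∑ (graphs n) (λ g → abs-* (0≤mass g) (abs-shifted t (π₀ g) m)))
        (≤-respˡ (sym (trans
          (∑-cong (graphs n) (λ g → solve 3 (λ x y z → x :* (y :* z) := y :* (x :* z)) refl (mass ℝ p g) (factorial t) (ι (suc t) ^ π₀ g)))
          (∑-*ˡ (graphs n) (factorial t) (λ g → mass ℝ p g * ι (suc t) ^ π₀ g))))
          (*-monoˡ-≤ (0≤factorial t) (proj₂ (proj₂ L) n)))
      where L = Z-bounded (suc t)

  -0*x≈0 : ∀ x → - ι 0 * x ≈ 0#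
  -0*x≈0 x = trans (*-congʳ -0#≈0#) (zeroˡ x)

  shifted-0 : ∀ i m → shifted 0 i m ≈ indicator (i ≟ m)
  shifted-0 zero    zero    = refl
  shifted-0 zero    (suc m) = refl
  shifted-0 (suc i) zero    = -0*x≈0 (shifted 0 i 0)
  shifted-0 (suc i) (suc m) = trans (+-congˡ (-0*x≈0 (shifted 0 i (suc m)))) (trans (+-identityʳ _)
    (trans (shifted-0 i m) (indicator-cong (i ≟ m) (suc i ≟ suc m) (≡.cong suc) ℕₚ.suc-injective)))

  shifted-1-0 : ∀ i → shifted 1 i 0 ≈ 0#
  shifted-1-0 zero    = -0*x≈0 (shifted 0 0 0)
  shifted-1-0 (suc i) = trans (*-congˡ (shifted-1-0 i)) (zeroʳ (- ι 1))

  -ι1≈-1 : - ι 1 ≈ - 1#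
  -ι1≈-1 = -‿cong ι1≈1

  -- Expands `x (x - 1) ^ i` by Pascal's rule; this is where the signed binomials of `P` come from.
  shifted-1 : ∀ i m → shifted 1 i (suc m) ≈ (- 1#) ^ (i ∸ m) * ι (i C m)
  shifted-1 zero    zero    = trans (+-congˡ (-0*x≈0 0#)) (trans (+-identityʳ 1#) (sym (trans (*-identityˡ (ι 1)) ι1≈1)))
  shifted-1 zero    (suc m) = trans (+-congˡ (-0*x≈0 0#)) (trans (+-identityʳ 0#) (sym (zeroʳ _)))
  shifted-1 (suc i) zero    = trans (+-cong (shifted-1-0 i) (*-cong -ι1≈-1 (shifted-1 i zero)))
    (trans (+-identityˡ _) (sym (*-assoc (- 1#) ((- 1#) ^ i) (ι (i C 0)))))
  shifted-1 (suc i) (suc m) = begin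
    shifted 1 i (suc m) + - ι 1 * shifted 1 i (suc (suc m))
      ≈⟨ +-cong (shifted-1 i m) (*-cong -ι1≈-1 (shifted-1 i (suc m))) ⟩
    (- 1#) ^ (i ∸ m) * ι (i C m) + - 1# * ((- 1#) ^ (i ∸ suc m) * ι (i C suc m))
      ≈⟨ +-congˡ (sign (ℕₚ.≤-<-connex (suc m) i)) ⟩
    (- 1#) ^ (i ∸ m) * ι (i C m) + (- 1#) ^ (i ∸ m) * ι (i C suc m)
      ≈⟨ sym (distribˡ _ _ _) ⟩
    (- 1#) ^ (i ∸ m) * (ι (i C m) + ι (i C suc m))
      ≈⟨ *-congˡ (trans (sym (ι-+ (i C m) (i C suc m))) (reflexive (≡.cong ι (nCk+nC[k+1]≡[n+1]C[k+1] i m)))) ⟩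
    (- 1#) ^ (i ∸ m) * ι (suc i C suc m) ∎
    where
    -- If `i ≤ m`, the truncated exponents no longer differ by one, but then `i C suc m` is 0.
    sign : suc m ℕ.≤ i ⊎ i ℕ.< suc m →
      - 1# * ((- 1#) ^ (i ∸ suc m) * ι (i C suc m)) ≈ (- 1#) ^ (i ∸ m) * ι (i C suc m)
    sign (inj₁ m<i) = trans (sym (*-assoc _ _ _))
      (*-congʳ (reflexive (≡.cong ((- 1#) ^_) (≡.sym (ℕₚ.+-∸-assoc 1 m<i)))))
    sign (inj₂ i<1+m) = trans (*-congˡ (vanishes _)) (trans (zeroʳ _) (sym (vanishes _)))
      where
      vanishes : ∀ x → x * ι (i C suc m) ≈ 0#
      vanishes x = trans (*-congˡ (reflexive (≡.cong ι (k>n⇒nCk≡0 i<1+m)))) (zeroʳ x)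

  -- Writing the `p` of every edge as `q * ρ` leaves a factor `q` for each pair.
  mass≈weight : ∀ {n} (g : Graph n) → mass ℝ p g ≈ q ^ pairs n * weight ℝ ρ g
  mass≈weight []              = sym (*-identityˡ 1#)
  mass≈weight {suc n} (N ∷ g) = begin
    mass ℝ p (N ∷ g)
      ≡⟨ mass-∷ N g ⟩
    neighbourhoodMass N * mass ℝ p g
      ≈⟨ *-cong (neighbourhood N) (mass≈weight g) ⟩
    q ^ n * ρ ^ ∣ N ∣ * (q ^ pairs n * ρ ^ edgeCount g)
      ≈⟨ solve 4 (λ x y z w → x :* y :* (z :* w) := x :* z :* (y :* w)) refl (q ^ n) (ρ ^ ∣ N ∣) (q ^ pairs n) (ρ ^ edgeCount g) ⟩
    q ^ n * q ^ pairs n * (ρ ^ ∣ N ∣ * ρ ^ edgeCount g)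
      ≈⟨ *-cong (sym (^-homo-* q n (pairs n))) (sym (^-homo-* ρ ∣ N ∣ (edgeCount g))) ⟩
    q ^ (n ℕ.+ pairs n) * ρ ^ (∣ N ∣ ℕ.+ edgeCount g) ∎
    where
    p≈q*ρ : p ≈ q * ρ
    p≈q*ρ = sym (trans (solve 3 (λ q p u → q :* (p :* u) := p :* (q :* u)) refl q p u) (trans (*-congˡ q*u≈1) (*-identityʳ p)))
    neighbourhood : ∀ {n} (N : Subset n) → neighbourhoodMass N ≈ q ^ n * ρ ^ ∣ N ∣
    neighbourhood []                    = sym (*-identityˡ 1#)
    neighbourhood {suc n} (outside ∷ N) = trans (*-congˡ (neighbourhood N)) (sym (*-assoc q (q ^ n) (ρ ^ ∣ N ∣)))
    neighbourhood {suc n} (inside ∷ N)  = trans (*-cong p≈q*ρ (neighbourhood N))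
      (solve 4 (λ x y z w → x :* y :* (z :* w) := x :* z :* (y :* w)) refl q ρ (q ^ n) (ρ ^ ∣ N ∣))

  a-0 : ∀ m n → a m 0 n ≈ ℙ ℝ {n} p (λ g → π₀ g ≟ m)
  a-0 m n = trans (∑-cong (graphs n) (λ g → *-congˡ (shifted-0 (π₀ g) m))) (sym (∑-filter (λ g → π₀ g ≟ m) (graphs n) (mass ℝ p)))

  a-1 : ∀ m k → a (suc m) 1 k ≈ q ^ pairs k * P ℝ k (suc m) ρ
  a-1 m k = trans (∑-cong (graphs k) term) (∑-*ˡ (graphs k) (q ^ pairs k) _)
    where
    term : ∀ g → mass ℝ p g * shifted 1 (π₀ g) (suc m) ≈
      q ^ pairs k * ((- 1#) ^ (π₀ g ∸ m) * (π₀ g C m) · weight ℝ ρ g)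
    term g = trans (*-cong (mass≈weight g) (shifted-1 (π₀ g) m)) (trans
      (solve 4 (λ x y z w → x :* y :* (z :* w) := x :* (z :* (w :* y))) refl
        (q ^ pairs k) (weight ℝ ρ g) ((- 1#) ^ (π₀ g ∸ m)) (ι (π₀ g C m)))
      (*-congˡ (*-congˡ (sym (·≈ι* (π₀ g C m) (weight ℝ ρ g))))))

  scaleTerm : ℕ → ℕ → Carrier
  scaleTerm k n = (n C k) · (q ^ (n ℕ.* k) * u ^ ((k ℕ.* suc k) / 2))

  binomialTerm : ℕ → ℕ → Carrier
  binomialTerm k n = ι (n C k) * q ^ (k ℕ.* (n ∸ k))

  scaleTerm≈ι : ∀ k n → scaleTerm k n ≈ ι (n C k) * (q ^ (n ℕ.* k) * u ^ pairs (suc k))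
  scaleTerm≈ι k n = trans (·≈ι* (n C k) _) (*-congˡ (*-congˡ (reflexive (≡.cong (u ^_) (k[k+1]/2≡pairs k)))))

  -- For `k ≤ n`, `n k = k (n - k) + k ^ 2` and `k ^ 2 = pairs (suc k) + pairs k`, so
  -- `u ^ pairs (suc k)` cancels. For `n < k` both sides vanish with the binomial coefficient.
  scaleTerm≈binomialTerm : ∀ k n → scaleTerm k n ≈ binomialTerm k n * q ^ pairs k
  scaleTerm≈binomialTerm k n with ℕₚ.≤-<-connex k n
  ... | inj₂ n<k = trans (scaleTerm≈ι k n) (trans (vanishes _) (sym (trans (*-congʳ (vanishes _)) (zeroˡ _))))
    where
    vanishes : ∀ x → ι (n C k) * x ≈ 0#
    vanishes x = trans (*-congʳ (reflexive (≡.cong ι (k>n⇒nCk≡0 n<k)))) (zeroˡ x)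
  ... | inj₁ k≤n = trans (scaleTerm≈ι k n) (trans (*-congˡ powers) (sym (*-assoc (ι (n C k)) (q ^ (k ℕ.* (n ∸ k))) (q ^ pairs k))))
    where
    exponents : n ℕ.* k ≡ (k ℕ.* (n ∸ k) ℕ.+ pairs k) ℕ.+ pairs (suc k)
    exponents = ≡.trans (≡.cong (ℕ._* k) (≡.sym (ℕₚ.m∸n+n≡m k≤n))) (≡.trans (ℕₚ.*-distribʳ-+ k (n ∸ k) k)
      (≡.trans (≡.cong₂ ℕ._+_ (ℕₚ.*-comm (n ∸ k) k) (≡.trans (k*k≡pairs+pairs k) (ℕₚ.+-comm (pairs (suc k)) (pairs k))))
        (≡.sym (ℕₚ.+-assoc (k ℕ.* (n ∸ k)) (pairs k) (pairs (suc k))))))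
    powers : q ^ (n ℕ.* k) * u ^ pairs (suc k) ≈ q ^ (k ℕ.* (n ∸ k)) * q ^ pairs k
    powers = begin
      q ^ (n ℕ.* k) * u ^ pairs (suc k)
        ≈⟨ *-congʳ (trans (reflexive (≡.cong (q ^_) exponents)) (^-homo-* q (k ℕ.* (n ∸ k) ℕ.+ pairs k) (pairs (suc k)))) ⟩
      q ^ (k ℕ.* (n ∸ k) ℕ.+ pairs k) * q ^ pairs (suc k) * u ^ pairs (suc k)
        ≈⟨ trans (*-assoc _ _ _) (trans (*-congˡ (q^n*u^n≈1 (pairs (suc k)))) (*-identityʳ _)) ⟩
      q ^ (k ℕ.* (n ∸ k) ℕ.+ pairs k)
        ≈⟨ ^-homo-* q (k ℕ.* (n ∸ k)) (pairs k) ⟩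
      q ^ (k ℕ.* (n ∸ k)) * q ^ pairs k ∎

  0≤scaleTerm : ∀ k n → 0# ≤ scaleTerm k n
  0≤scaleTerm k n = ≤-respʳ (sym (scaleTerm≈ι k n))
    (0≤* (0≤ι (n C k)) (0≤* (0≤q^ (n ℕ.* k)) (0≤^ (pairs (suc k)) 0≤u)))

  -- Passing from `k` to `suc k` multiplies the term by at most `(n + 1) * q ^ n * u ^ (k + 1)`,
  -- hence the tolerance `e * q ^ suc k` given to `vanish`.
  scaleTerm-littleO : ∀ k → LittleO ℝ (scaleTerm (suc k)) (scaleTerm k)
  scaleTerm-littleO k e 0<e = proj₁ small , λ n N≤n →
    nonneg⇒abs≤ (0≤scaleTerm (suc k) n) (≤-trans (bound n (proj₂ small n N≤n)) (*-monoˡ-≤ (<⇒≤ 0<e) (x≤abs _)))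
    where
    small = vanish (e * q ^ suc k) (*-positive 0<e (0<^ (suc k) 0<q))
    bound : ∀ n → ι (suc n) * q ^ n ≤ e * q ^ suc k → scaleTerm (suc k) n ≤ e * scaleTerm k n
    bound n le = ≤-respˡ (sym (scaleTerm≈ι (suc k) n)) (≤-respʳ (*-congˡ (sym (scaleTerm≈ι k n)))
      (≤-trans (*-monoʳ-≤ 0≤tail (≤-respʳ (ι-* (suc n) (n C k)) (ι-mono-≤ (C-suc-≤ n k))))
        (≤-respˡ (sym lhs) (≤-respʳ rhs (*-monoʳ-≤ 0≤w (*-monoʳ-≤ (0≤^ (suc k) 0≤u) le))))))
      where
      w = ι (n C k) * (q ^ (n ℕ.* k) * u ^ pairs (suc k))
      0≤w : 0# ≤ w
      0≤w = 0≤* (0≤ι (n C k)) (0≤* (0≤q^ (n ℕ.* k)) (0≤^ (pairs (suc k)) 0≤u))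
      0≤tail : 0# ≤ q ^ (n ℕ.* suc k) * u ^ pairs (suc (suc k))
      0≤tail = 0≤* (0≤q^ (n ℕ.* suc k)) (0≤^ (pairs (suc (suc k))) 0≤u)
      lhs : ι (suc n) * ι (n C k) * (q ^ (n ℕ.* suc k) * u ^ pairs (suc (suc k))) ≈ ι (suc n) * q ^ n * u ^ suc k * w
      lhs = trans (*-congˡ (*-cong (trans (reflexive (≡.cong (q ^_) (ℕₚ.*-suc n k))) (^-homo-* q n (n ℕ.* k)))
                                   (^-homo-* u (suc k) (pairs (suc k)))))
        (solve 6 (λ x y a b c d → x :* y :* ((a :* b) :* (c :* d)) := x :* a :* c :* (y :* (b :* d))) refl
          (ι (suc n)) (ι (n C k)) (q ^ n) (q ^ (n ℕ.* k)) (u ^ suc k) (u ^ pairs (suc k)))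
      rhs : e * q ^ suc k * u ^ suc k * w ≈ e * w
      rhs = *-congʳ (trans (*-assoc _ _ _) (trans (*-congˡ (q^n*u^n≈1 (suc k))) (*-identityʳ e)))

  module _ (m : ℕ) where
    open Chain (a (suc m)) (a-chain (suc m)) (a-bounded (suc m))

    probability coefficient : ℕ → Carrier
    probability n = ℙ ℝ {n} p (λ g → π₀ g ≟ suc m)
    coefficient k = P ℝ k (suc m) ρ

    partialSum≈truncation : ∀ r n → ∑ (upTo r) (λ k → coefficient k * scaleTerm k n) ≈ truncation (a (suc m) 1) r n
    partialSum≈truncation r n = trans (∑-upTo r _) (sum<-cong r (λ k _ → begin
      coefficient k * scaleTerm k n
        ≈⟨ *-congˡ (scaleTerm≈binomialTerm k n) ⟩
      coefficient k * (binomialTerm k n * q ^ pairs k)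
        ≈⟨ solve 3 (λ x y z → x :* (y :* z) := y :* (z :* x)) refl (coefficient k) (binomialTerm k n) (q ^ pairs k) ⟩
      binomialTerm k n * (q ^ pairs k * coefficient k)
        ≈⟨ *-congˡ (sym (a-1 m k)) ⟩
      binomialTerm k n * a (suc m) 1 k ∎))

    -- The remainder of order r + 2 is known up to a polynomial factor only; this is
    -- harmless since the term of order r + 1 is moved to the error.
    error≈ : ∀ r n → remainder 0 (suc (suc r)) n + binomialTerm (suc r) n * a (suc m) 1 (suc r) ≈
      probability n - ∑ (upTo (suc r)) (λ k → coefficient k * scaleTerm k n)
    error≈ r n = sym (begin
      probability n - ∑ (upTo (suc r)) (λ k → coefficient k * scaleTerm k n)
        ≈⟨ +-cong (sym (a-0 (suc m) n)) (-‿cong (partialSum≈truncation (suc r) n)) ⟩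
      a (suc m) 0 n - T₁
        ≈⟨ x≈y+z⇒x-y≈z (begin
             a (suc m) 0 n
               ≈⟨ sym (x-y+y≈x (a (suc m) 0 n) T₂) ⟩
             remainder 0 (suc (suc r)) n + T₂
               ≈⟨ +-congˡ (sum<-last (suc r) (λ k → binomialTerm k n * a (suc m) 1 k)) ⟩
             remainder 0 (suc (suc r)) n + (T₁ + last)
               ≈⟨ solve 3 (λ x y z → x :+ (y :+ z) := y :+ (x :+ z)) refl (remainder 0 (suc (suc r)) n) T₁ last ⟩
             T₁ + (remainder 0 (suc (suc r)) n + last) ∎) ⟩
      remainder 0 (suc (suc r)) n + last ∎)
      where
      T₁ = truncation (a (suc m) 1) (suc r) n
      T₂ = truncation (a (suc m) 1) (suc (suc r)) n
      last = binomialTerm (suc r) n * a (suc m) 1 (suc r)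

    module _ (r : ℕ) where
      private
        R = suc r

      0≤binomialTerm : ∀ n → 0# ≤ binomialTerm R n
      0≤binomialTerm n = 0≤* (0≤ι (n C R)) (0≤q^ (R ℕ.* (n ∸ R)))

      binomialTerm≈scaleTerm : ∀ n → binomialTerm R n ≈ u ^ pairs R * scaleTerm R n
      binomialTerm≈scaleTerm n = sym (begin
        u ^ pairs R * scaleTerm R n
          ≈⟨ *-congˡ (scaleTerm≈binomialTerm R n) ⟩
        u ^ pairs R * (binomialTerm R n * q ^ pairs R)
          ≈⟨ solve 3 (λ x y z → x :* (y :* z) := y :* (z :* x)) refl (u ^ pairs R) (binomialTerm R n) (q ^ pairs R) ⟩
        binomialTerm R n * (q ^ pairs R * u ^ pairs R)
          ≈⟨ trans (*-congˡ (q^n*u^n≈1 (pairs R))) (*-identityʳ _) ⟩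
        binomialTerm R n ∎)

      -- The surplus `q ^ n` of order `suc R` pays for the polynomial. Then
      -- `q ^ (R n) ≤ q ^ (R (n - R))`, and `n C R` is at least 1 as `R ≤ n`.
      absorb : ∀ D s n → R ℕ.≤ n → ι (suc n) ^ s * q ^ n ≤ D → 0# ≤ D →
        ι (suc n) ^ s * q ^ (suc R ℕ.* n) ≤ D * binomialTerm R n
      absorb D s n R≤n le 0≤D = ≤-respˡ lhs (*-mono-≤ (0≤q^ (R ℕ.* n)) 0≤D le
        (≤-trans (^-antiʳ-≤ 0≤q q≤1 (ℕₚ.*-monoʳ-≤ R (ℕₚ.m∸n≤m n R)))
          (≤-respˡ (*-identityˡ _) (*-monoʳ-≤ (0≤q^ (R ℕ.* (n ∸ R)))
            (1≤ι (ℕₚ.≤-trans (1≤binom R (n ∸ R)) (ℕₚ.≤-reflexive (≡.sym (C≡binom R≤n)))))))))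
        where
        lhs : ι (suc n) ^ s * q ^ n * q ^ (R ℕ.* n) ≈ ι (suc n) ^ s * q ^ (suc R ℕ.* n)
        lhs = trans (*-assoc _ _ _) (*-congˡ (sym (^-homo-* q n (R ℕ.* n))))

      error-bigO : BigO ℝ (λ n → probability n - ∑ (upTo R) (λ k → coefficient k * scaleTerm k n)) (scaleTerm R)
      error-bigO = from (expansion (suc R) 0) (a-bounded (suc m) 1)
        where
        from : Dominated (λ n → q ^ (suc R ℕ.* n)) (remainder 0 (suc R)) → ∃[ K ] (0# ≤ K × ∀ n → abs (a (suc m) 1 n) ≤ K) →
          BigO ℝ (λ n → probability n - ∑ (upTo R) (λ k → coefficient k * scaleTerm k n)) (scaleTerm R)
        from (K , s , N , 0≤K , rem≤) (K₁ , 0≤K₁ , a≤K₁) = K₂ * u ^ pairs R , N ℕ.+ R , bound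
          where
          D = proj₁ (decay s)
          0≤D = proj₁ (proj₂ (decay s))
          -- `K * D` is for the remainder of order `suc R`, `K₁` for the term number `R` moved into
          -- the error; `u ^ pairs R` passes from `binomialTerm` to `scaleTerm`.
          K₂ = K * D + K₁
          0≤K₂ : 0# ≤ K₂
          0≤K₂ = 0≤+ (0≤* 0≤K 0≤D) 0≤K₁
          bound : ∀ n → N ℕ.+ R ℕ.≤ n →
            abs (probability n - ∑ (upTo R) (λ k → coefficient k * scaleTerm k n)) ≤ K₂ * u ^ pairs R * abs (scaleTerm R n)
          bound n N+R≤n = abs-congˡ-≤ (error≈ r n) (≤-trans
            (abs-+ (≤-trans (rem≤ n (ℕₚ.≤-trans (ℕₚ.m≤m+n N R) N+R≤n))
                     (*-monoˡ-≤ 0≤K (absorb D s n (ℕₚ.≤-trans (ℕₚ.m≤n+m R N) N+R≤n) (proj₂ (proj₂ (decay s)) n) 0≤D)))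
                   (abs-* (0≤binomialTerm n) (a≤K₁ R)))
            (≤-respˡ (trans (distribʳ _ (K * D) K₁) (+-cong (*-assoc K D _) (*-comm K₁ _)))
              (≤-respˡ (*-congˡ (sym (binomialTerm≈scaleTerm n)))
                (≤-respˡ (*-assoc K₂ (u ^ pairs R) (scaleTerm R n))
                  (*-monoˡ-≤ (0≤* 0≤K₂ (0≤^ (pairs R) 0≤u)) (x≤abs (scaleTerm R n)))))))

theorem4p2 : ∀ {c ℓ₁ ℓ₂} (ℝ : RealNumbers c ℓ₁ ℓ₂) → let open RealNumbers ℝ in
    (m : ℕ) .{{_ : ℕ.NonZero m}} (p : Carrier) → 0# < p → (p<1 : p < 1#) →
    let q   = 1# - p
        q⁻¹ = recipDiff p<1
        ρ   = p * q⁻¹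
    in AsymptoticExpansion ℝ
         (λ n → ℙ ℝ {n} p (λ g → π₀ g ≟ m))
         (λ k → P ℝ k m ρ)
         (λ k n → (n C k) · (q ^ (n ℕ.* k) * q⁻¹ ^ ((k ℕ.* suc k) / 2)))
theorem4p2 ℝ (suc m) p 0<p p<1 = scaleTerm-littleO , error-bigO m
  where open Components ℝ p 0<p p<1
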